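{- Let $n\ge1$, let $b_1<\dots<b_n$ be a strictly increasing sequence of integers and let $\alpha\le a\le\beta$ be integers with $\alpha\le b_1$ and $b_n\le\beta$. Then $\sum_M u^{\operatorname{inv}(M)}v^{\operatorname{inv}'(M)}$, the sum over all monotone triangles $M$ with $n$ rows, bottom row $(b_1,\dots,b_n)$ and top entry $m_{1,1}=a$, equals the constant term in $x_1,\dots,x_n$ of $$\prod_{i=1}^{n}(1+x_i)^{b_i}x_i^{ -n+1}\prod_{1\le i<j\le n}(x_i-x_j)\bigl(1+(1-v)x_i+u(x_j+x_ix_j)\bigr)\cdot\sum_{b=0}^{\beta-\alpha}(-1)^{a+\alpha+b}\binom{b}{a-\alpha}\prod_{i=1}^n(1+x_i)^{ -\alpha}\,\langle z^b\rangle\prod_{i=1}^n\frac{1}{1-x_i^{ -1}z}.$$ In the special case $u=v=1$ it suffices that $b_1\le\dots\le b_n$ is weakly increasing.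
   Context: A monotone triangle with $n$ rows is a triangular array $M=(m_{i,j})_{1\le j\le i\le n}$ of integers with $m_{i+1,j}\le m_{i,j}\le m_{i+1,j+1}$ for all $1\le j\le i<n$, and each row except possibly the bottom row strictly increasing; its bottom row is $(m_{n,1},\dots,m_{n,n})$ and its top entry is $m_{1,1}$. $\operatorname{inv}(M)=\#\{(i,j):m_{i,j}=m_{i+1,j+1}\}$, $\operatorname{inv}'(M)=\#\{(i,j):m_{i,j}=m_{i+1,j}\}$. $u,v$ are indeterminates. $\langle z^b\rangle$ denotes the coefficient of $z^b$, where $\frac{1}{1-x_i^{ -1}z}=\sum_{k\ge0}z^kx_i^{ -k}$. Powers $(1+x_i)^{c}$ with negative exponent are expanded as power series in $x_i$ with non-negative exponents. -}

module Defs where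

open import Level using (0ℓ)
open import Data.Bool using (Bool; true; false; _∧_; if_then_else_)
open import Data.Nat as ℕ using (ℕ; zero; suc; _∸_)
open import Data.Nat.Combinatorics using (_C_)
open import Data.Integer as ℤ using (ℤ; +_; -[1+_])
open import Data.Fin as Fin using (Fin; toℕ)
open import Data.Vec as Vec using (Vec; []; _∷_; lookup; replicate; zipWith)
open import Data.List as List using (List; []; _∷_; _++_; map; concatMap; upTo; allFin; filter; foldr)
open import Data.Product using (_×_; _,_)
open import Relation.Nullary.Decidable using (⌊_⌋)
open import Algebra.Bundles using (CommutativeRing)

-- A triangular array built row by row from the top: a value of type
-- Tri k has k rows, the i-th row (from the top) having length i.
-- (t ▹ r) appends the row r below the rows of t.
data Tri : ℕ → Set where
  ∅   : Tri 0
  _▹_ : ∀ {k} → Tri k → Vec ℤ (suc k) → Tri (suc k)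

top : ∀ {k} → Tri (suc k) → ℤ
top (∅ ▹ (x ∷ [])) = x
top ((t ▹ r) ▹ s)  = top (t ▹ r)

interlaceᵇ : ∀ {k} → Vec ℤ k → Vec ℤ (suc k) → Bool
interlaceᵇ [] (s ∷ [])                  = true
interlaceᵇ (r ∷ rs) (s ∷ ss@(s' ∷ _)) =
  (s ℤ.≤ᵇ r) ∧ (r ℤ.≤ᵇ s') ∧ interlaceᵇ rs ss

strictᵇ : ∀ {k} → Vec ℤ k → Bool
strictᵇ []                 = true
strictᵇ (x ∷ [])           = true
strictᵇ (x ∷ ys@(y ∷ _)) = ⌊ x ℤ.<? y ⌋ ∧ strictᵇ ys

isMTᵇ : ∀ {k} → Tri k → Bool
isMTᵇ ∅                 = true
isMTᵇ (∅ ▹ r)           = true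
isMTᵇ ((t ▹ r) ▹ s)     = isMTᵇ (t ▹ r) ∧ interlaceᵇ r s ∧ strictᵇ r

invPair : ∀ {k} → Vec ℤ k → Vec ℤ (suc k) → ℕ
invPair [] (s ∷ [])                  = 0
invPair (r ∷ rs) (s ∷ ss@(s' ∷ _)) =
  (if ⌊ r ℤ.≟ s' ⌋ then 1 else 0) ℕ.+ invPair rs ss

inv'Pair : ∀ {k} → Vec ℤ k → Vec ℤ (suc k) → ℕ
inv'Pair [] (s ∷ [])                  = 0
inv'Pair (r ∷ rs) (s ∷ ss@(s' ∷ _)) =
  (if ⌊ r ℤ.≟ s ⌋ then 1 else 0) ℕ.+ inv'Pair rs ss

inv : ∀ {k} → Tri k → ℕ
inv ∅             = 0
inv (∅ ▹ r)       = 0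
inv ((t ▹ r) ▹ s) = inv (t ▹ r) ℕ.+ invPair r s

inv' : ∀ {k} → Tri k → ℕ
inv' ∅             = 0
inv' (∅ ▹ r)       = 0
inv' ((t ▹ r) ▹ s) = inv' (t ▹ r) ℕ.+ inv'Pair r s

range : ℤ → ℤ → List ℤ
range lo hi with hi ℤ.- lo
... | + d      = map (λ i → lo ℤ.+ + i) (upTo (suc d))
... | -[1+ _ ] = []

vecs : ℤ → ℤ → (k : ℕ) → List (Vec ℤ k)
vecs lo hi zero    = [] ∷ []
vecs lo hi (suc k) = concatMap (λ x → map (x ∷_) (vecs lo hi k)) (range lo hi)

tris : ℤ → ℤ → (k : ℕ) → List (Tri k)
tris lo hi zero    = ∅ ∷ []
tris lo hi (suc k) = concatMap (λ t → map (t ▹_) (vecs lo hi (suc k))) (tris lo hi k)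

StrictlyIncreasing : ∀ {k} → Vec ℤ k → Set
StrictlyIncreasing {k} b = (i j : Fin k) → i Fin.< j → lookup b i ℤ.< lookup b j

WeaklyIncreasing : ∀ {k} → Vec ℤ k → Set
WeaklyIncreasing {k} b = (i j : Fin k) → i Fin.< j → lookup b i ℤ.≤ lookup b j

signℕ : ℕ → ℤ
signℕ zero          = ℤ.1ℤ
signℕ (suc zero)    = ℤ.-1ℤ
signℕ (suc (suc n)) = signℕ n

signℤ : ℤ → ℤ
signℤ m = signℕ ℤ.∣ m ∣

-- generalized binomial coefficient: the coefficient of x^k in (1+x)^c
-- for c ∈ ℤ, (1+x)^c being expanded as a power series in x;
-- for c = -(m+1) this is (-1)^k binom(m+k, k).
gbin : ℤ → ℕ → ℤ
gbin (+ c)    k = + (c C k)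
gbin -[1+ m ] k = signℕ k ℤ.* + ((m ℕ.+ k) C k)

-- coefficient of x^k in the power series (1+x)^c (1+x)^d  (Cauchy product)
coefProd : ℤ → ℤ → ℕ → ℤ
coefProd c d k = List.foldr ℤ._+_ ℤ.0ℤ
  (map (λ l → gbin c l ℤ.* gbin d (k ∸ l)) (upTo (suc k)))

compositions : (n b : ℕ) → List (Vec ℕ n)
compositions zero    zero    = [] ∷ []
compositions zero    (suc _) = []
compositions (suc n) b       =
  concatMap (λ k → map (k ∷_) (compositions n (b ∸ k))) (upTo (suc b))

unit : ∀ {n} → Fin n → Vec ℤ n
unit i = Vec.tabulate (λ j → if ⌊ i Fin.≟ j ⌋ then ℤ.1ℤ else ℤ.0ℤ)

pairs : (n : ℕ) → List (Fin n × Fin n)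
pairs n = concatMap (λ i → map (i ,_) (filter (λ j → i Fin.<? j) (allFin n))) (allFin n)

module _ (R : CommutativeRing 0ℓ 0ℓ) where
  open CommutativeRing R

  pow : Carrier → ℕ → Carrier
  pow x zero    = 1#
  pow x (suc k) = x * pow x k

  fromℕ : ℕ → Carrier
  fromℕ zero    = 0#
  fromℕ (suc k) = 1# + fromℕ k

  fromℤ : ℤ → Carrier
  fromℤ (+ k)      = fromℕ k
  fromℤ -[1+ k ]   = - fromℕ (suc k)

  Σ : ∀ {A : Set} → List A → (A → Carrier) → Carrier
  Σ xs f = List.foldr (λ x acc → f x + acc) 0# xs

  -- LHS: Σ_M u^{inv M} v^{inv' M} over monotone triangles M with rows
  -- 1..m+1, bottom row b and top entry a.  Every such M has all its
  -- entries in [b_1, b_{m+1}] ⊆ [α, β], so it is enough to range over the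
  -- arrays t ▹ b, t having m rows with entries in [α, β].
  mtSum : Carrier → Carrier → (m : ℕ) → Vec ℤ (suc m) → (a α β : ℤ) → Carrier
  mtSum u v m b a α β =
    Σ (tris α β m) λ t →
      if isMTᵇ (t ▹ b) ∧ ⌊ top (t ▹ b) ℤ.≟ a ⌋
      then pow u (inv (t ▹ b)) * pow v (inv' (t ▹ b))
      else 0#

  -- Laurent polynomials in x_1..x_n over R, as formal sums of monomials
  -- (coefficient, exponent vector)
  LPoly : ℕ → Set
  LPoly n = List (Carrier × Vec ℤ n)

  _⊗_ : ∀ {n} → LPoly n → LPoly n → LPoly n
  P ⊗ Q = concatMap (λ { (c , e) → map (λ { (d , f) → (c * d , zipWith ℤ._+_ e f) }) Q }) P

  one : ∀ {n} → LPoly n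
  one = (1# , replicate _ ℤ.0ℤ) ∷ []

  prodL : ∀ {n} {A : Set} → List A → (A → LPoly n) → LPoly n
  prodL xs f = List.foldr (λ x acc → f x ⊗ acc) one xs

  sumL : ∀ {n} {A : Set} → List A → (A → LPoly n) → LPoly n
  sumL xs f = concatMap f xs

  scale : ∀ {n} → Carrier → LPoly n → LPoly n
  scale c P = map (λ { (d , e) → (c * d , e) }) P

  -- ⟨z^b⟩ ∏_{i=1}^n 1/(1 - x_i^{-1} z) = Σ_{k_1+...+k_n = b} ∏ x_i^{-k_i}
  hInv : (n b : ℕ) → LPoly n
  hInv n b = map (λ k → (1# , Vec.map (λ kᵢ → ℤ.- (+ kᵢ)) k)) (compositions n b)

  -- The Laurent polynomial part of the expression, i.e. everything except
  -- the power series ∏_i (1+x_i)^{b_i} (1+x_i)^{-α}: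
  --   ∏_i x_i^{-n+1} · ∏_{i<j} (x_i - x_j)(1 + (1-v)x_i + u(x_j + x_i x_j))
  --   · Σ_{b=0}^{β-α} (-1)^{a+α+b} binom(b, a-α) ⟨z^b⟩ ∏_i 1/(1 - x_i^{-1} z)
  laurentPart : Carrier → Carrier → (n : ℕ) → (a α β : ℤ) → LPoly n
  laurentPart u v n a α β =
    ((1# , replicate n (ℤ.- (+ (n ∸ 1)))) ∷ [])
    ⊗ (prodL (pairs n) (λ { (i , j) →
          ((1# , unit i) ∷ (- 1# , unit j) ∷ [])
          ⊗ ((1# , replicate n ℤ.0ℤ) ∷ (1# - v , unit i) ∷ (u , unit j)
              ∷ (u , zipWith ℤ._+_ (unit i) (unit j)) ∷ []) })
    ⊗ sumL (upTo (suc ℤ.∣ β ℤ.- α ∣)) (λ b →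
          scale (fromℤ (signℤ (a ℤ.+ α ℤ.+ + b)) * fromℕ (b C ℤ.∣ a ℤ.- α ∣))
                (hInv n b)))

  seriesCoef : ℤ → ℤ → ℤ → Carrier
  seriesCoef c d (+ k)    = fromℤ (coefProd c d k)
  seriesCoef c d -[1+ _ ] = 0#

  -- constant term in x_1..x_n of  L · ∏_i (1+x_i)^{b_i} (1+x_i)^{-α},
  -- L a Laurent polynomial: Σ_{c x^e ∈ L} c · ∏_i [x_i^{-e_i}] (1+x_i)^{b_i}(1+x_i)^{-α}
  ctExpr : Carrier → Carrier → (m : ℕ) → Vec ℤ (suc m) → (a α β : ℤ) → Carrier
  ctExpr u v m b a α β =
    Σ (laurentPart u v (suc m) a α β) λ { (c , e) →
      c * List.foldr _*_ 1#
            (map (λ i → seriesCoef (lookup b i) (ℤ.- α) (ℤ.- lookup e i))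
                 (allFin (suc m))) }

{-# OPTIONS --safe #-}
module Submission where

-- Everything is shifted so that the bottom row k consists of naturals, and Laurent polynomials are
-- elements of the group ring R[ℤⁿ].  Write z = 1/x, X = 1 + x, Q(x, y) = 1 + (1-v)x + u(y + xy).
-- For fixed b put
--   F_n(k) = CT ∏ X_i^{k_i} ∏_{i<j} Q(x_i, x_j) · ∏_{i<j} (z_j - z_i) h_b(z);
-- it suffices that F_n(k) = Σ_r w(r, k) F_{n-1}(r) over the strict rows r interlacing k, the case
-- n = 1 being binomial inversion.
--
-- The weighted sum of X^r over k_i ≤ r ≤ k_{i+1} is A + B with A = z X^{k_{i+1}} (1 + ux) and
-- B = -z X^{k_i} (1 + (1-v)x).  When the sum over r is expanded, a term in which both neighbours of
-- some entry of k are attached to it has, after removing the non-strict rows, the factor Q(x', x)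
-- next to an expression symmetric in x, x'; multiplied by the alternating Laurent polynomial above it
-- has constant term 0.  (For u = v = 1 and weakly increasing k there are also terms symmetric in three
-- variables up to Q(x,x')Q(x,x'')Q(x',x''), which die because this product is a sum of two polynomials,
-- each symmetric in two neighbouring variables.)  What survives is, for each s, the term in which
-- entry s of k is left unused.
--
-- On the other side, the Laplace expansion of the alternant ∏_{i<j} (z_j - z_i) h_b(z) along the
-- exponent 0 lets x_s occur in the term number s only through ∏ X_i^{k_i} and Q; the constant term in
-- x_s then sets x_s = 0, and Q(x_j, 0), Q(0, x_j) are the factors 1 + (1-v)x_j, 1 + u x_j of B and A.

open import Defs
open import Level using (0ℓ)
open import Data.Nat as ℕ using (ℕ; zero; suc; _<_; z≤n; s≤s; _≤?_; _<?_; _≟_)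
open import Data.Integer as ℤ using (ℤ; +_; -[1+_]; _⊖_; _◃_; _≤_)
open import Data.Vec as Vec using (Vec; []; _∷_; head; last; lookup; replicate; zipWith)
open import Data.Product using (∃-syntax; _×_; _,_; proj₁; proj₂)
open import Algebra.Bundles using (CommutativeRing; CommutativeMonoid)

open import Algebra.Morphism.Structures using (module RingMorphisms)
import Algebra.Solver.Ring
open import Algebra.Solver.Ring.AlmostCommutativeRing
  using (fromCommutativeRing; _-Raw-AlmostCommutative⟶_; Induced-equivalence)
open import Data.Bool using (Bool; true; false; _∧_; if_then_else_)
open import Data.Empty using (⊥-elim)
open import Data.Fin as Fin using (Fin; toℕ)
import Data.Integer.Properties as ℤₚ
open import Data.List as List using (List; []; _∷_; _++_; map; concatMap; applyUpTo; upTo; allFin; filter)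
open import Data.Maybe using (just; nothing)
import Data.Nat.Combinatorics as Comb
open import Data.Nat.Combinatorics using (nCn≡1; nCk≡nC[n∸k]; nCk+nC[k+1]≡[n+1]C[k+1]; k>n⇒nCk≡0)
open import Data.Nat.Properties as ℕₚ
  using (<⇒≤; ≤-trans; ≤-refl; <-cmp; <⇒≱; +-suc; <⇒≢; >⇒≢; ≤⇒≯; <-irrefl)
import Data.Sign as Sign
open import Data.Sum using (_⊎_; inj₁; inj₂)
import Data.Vec.Properties as Vecₚ
open import Function using (_∘_; mk⇔)
open import Relation.Binary.Definitions using (WeaklyDecidable; tri<; tri≈; tri>)
open import Relation.Binary.PropositionalEquality as ≡ using (_≡_)
open import Relation.Nullary using (Dec; does; yes; no; ¬_)
open import Relation.Nullary.Decidable using (dec-true; dec-false; does-⇔; isYes≗does; ⌊_⌋; map′; T?)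
open import Relation.Unary using (Decidable)


-- The weights w(r, k) in the recursion do not involve b. So the coefficient (-1)^(a+b) binom(b, a),
-- with a measured from α, passes unchanged from the bottom row to the top, where F_1(k) = binom(k,
-- b). Its purpose is to invert this matrix and thereby to select the top entry. No power series
-- survive: (1+x)^(α+k) (1+x)^(-α) is the polynomial X^k, and the prefactor ∏ x_i^(-n+1) turns ∏
-- (x_i - x_j) into ∏ (z_j - z_i). A sum of powers of X over an interval is geometric, and its
-- denominator X - 1 = x is invertible among Laurent polynomials; this is why A and B carry z. The
-- coefficient ring is arbitrary, so antisymmetry alone would show only that twice a constant term
-- is 0. Vanishing is obtained instead by writing the constant term as a difference of two that an
-- exchange of variables carries into each other. Setting x_s = 0 is not a map on Laurent
-- polynomials, since negative powers occur; it therefore appears as a relation, closed under sums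
-- and products.

-- Ring solver with integer coefficients

module IntegerSolver (S : CommutativeRing 0ℓ 0ℓ) where
  open CommutativeRing S
  open import Algebra.Properties.Ring ring
    using (-0#≈0#; -‿distribˡ-*; -‿distribʳ-*; -‿involutive; -‿+-comm)
  open import Relation.Binary.Reasoning.Setoid setoid
  open import Algebra.Properties.CommutativeSemigroup +-commutativeSemigroup
    using () renaming (interchange to +-interchange)

  fromℕ-+ : ∀ m n → fromℕ S (m ℕ.+ n) ≈ fromℕ S m + fromℕ S n
  fromℕ-+ zero    n = sym (+-identityˡ _)
  fromℕ-+ (suc m) n = trans (+-congˡ (fromℕ-+ m n)) (sym (+-assoc _ _ _))

  fromℕ-* : ∀ m n → fromℕ S (m ℕ.* n) ≈ fromℕ S m * fromℕ S n
  fromℕ-* zero    n = sym (zeroˡ _)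
  fromℕ-* (suc m) n = begin
    fromℕ S (n ℕ.+ m ℕ.* n)             ≈⟨ fromℕ-+ n (m ℕ.* n) ⟩
    fromℕ S n + fromℕ S (m ℕ.* n)       ≈⟨ +-cong (sym (*-identityˡ _)) (fromℕ-* m n) ⟩
    1# * fromℕ S n + fromℕ S m * fromℕ S n ≈⟨ distribʳ _ _ _ ⟨
    (1# + fromℕ S m) * fromℕ S n        ∎

  fromℤ-⊖ : ∀ m n → fromℤ S (m ⊖ n) ≈ fromℕ S m - fromℕ S n
  fromℤ-⊖ m       zero    = sym (trans (+-congˡ -0#≈0#) (+-identityʳ _))
  fromℤ-⊖ zero    (suc n) = sym (+-identityˡ _)
  fromℤ-⊖ (suc m) (suc n) = begin
    fromℤ S (suc m ⊖ suc n)                ≡⟨ ≡.cong (fromℤ S) (ℤₚ.[1+m]⊖[1+n]≡m⊖n m n) ⟩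
    fromℤ S (m ⊖ n)                        ≈⟨ fromℤ-⊖ m n ⟩
    fromℕ S m - fromℕ S n                  ≈⟨ +-identityˡ _ ⟨
    0# + (fromℕ S m - fromℕ S n)           ≈⟨ +-congʳ (-‿inverseʳ 1#) ⟨
    (1# - 1#) + (fromℕ S m - fromℕ S n)    ≈⟨ +-interchange _ _ _ _ ⟩
    (1# + fromℕ S m) + (- 1# - fromℕ S n)  ≈⟨ +-congˡ (-‿+-comm _ _) ⟩
    (1# + fromℕ S m) - (1# + fromℕ S n)    ∎

  fromℤ-+ : ∀ i j → fromℤ S (i ℤ.+ j) ≈ fromℤ S i + fromℤ S j
  fromℤ-+ (+ m)    (+ n)    = fromℕ-+ m n
  fromℤ-+ (+ m)    -[1+ n ] = fromℤ-⊖ m (suc n)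
  fromℤ-+ -[1+ m ] (+ n)    = trans (fromℤ-⊖ n (suc m)) (+-comm _ _)
  fromℤ-+ -[1+ m ] -[1+ n ] = begin
    - (1# + (1# + fromℕ S (m ℕ.+ n)))           ≈⟨ -‿cong (+-congˡ (+-congˡ (fromℕ-+ m n))) ⟩
    - (1# + (1# + (fromℕ S m + fromℕ S n)))     ≈⟨ -‿cong (+-assoc _ _ _) ⟨
    - ((1# + 1#) + (fromℕ S m + fromℕ S n))     ≈⟨ -‿cong (+-interchange _ _ _ _) ⟩
    - ((1# + fromℕ S m) + (1# + fromℕ S n))     ≈⟨ -‿+-comm _ _ ⟨
    - (1# + fromℕ S m) - (1# + fromℕ S n)       ∎

  fromℤ-neg : ∀ i → fromℤ S (ℤ.- i) ≈ - fromℤ S i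
  fromℤ-neg (+ zero)  = sym -0#≈0#
  fromℤ-neg (+ suc n) = refl
  fromℤ-neg -[1+ n ]  = sym (-‿involutive _)

  fromℤ-◃⁺ : ∀ k → fromℤ S (Sign.+ ◃ k) ≈ fromℕ S k
  fromℤ-◃⁺ zero    = refl
  fromℤ-◃⁺ (suc k) = refl

  fromℤ-+* : ∀ m j → fromℤ S (+ m ℤ.* j) ≈ fromℕ S m * fromℤ S j
  fromℤ-+* m (+ n)    = trans (fromℤ-◃⁺ (m ℕ.* n)) (fromℕ-* m n)
  fromℤ-+* m -[1+ n ] = begin
    fromℤ S ((+ m) ℤ.* (ℤ.- + suc n))  ≡⟨ ≡.cong (fromℤ S) (ℤₚ.neg-distribʳ-* (+ m) (+ suc n)) ⟨
    fromℤ S (ℤ.- ((+ m) ℤ.* + suc n))  ≈⟨ fromℤ-neg ((+ m) ℤ.* + suc n) ⟩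
    - fromℤ S ((+ m) ℤ.* + suc n)      ≈⟨ -‿cong (trans (fromℤ-◃⁺ (m ℕ.* suc n)) (fromℕ-* m (suc n))) ⟩
    - (fromℕ S m * fromℕ S (suc n))    ≈⟨ -‿distribʳ-* _ _ ⟩
    fromℕ S m * - fromℕ S (suc n)      ∎

  fromℤ-* : ∀ i j → fromℤ S (i ℤ.* j) ≈ fromℤ S i * fromℤ S j
  fromℤ-* (+ m)    j = fromℤ-+* m j
  fromℤ-* -[1+ m ] j = begin
    fromℤ S ((ℤ.- + suc m) ℤ.* j)      ≡⟨ ≡.cong (fromℤ S) (ℤₚ.neg-distribˡ-* (+ suc m) j) ⟨
    fromℤ S (ℤ.- (+ suc m ℤ.* j))      ≈⟨ fromℤ-neg (+ suc m ℤ.* j) ⟩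
    - fromℤ S (+ suc m ℤ.* j)          ≈⟨ -‿cong (fromℤ-+* (suc m) j) ⟩
    - (fromℕ S (suc m) * fromℤ S j)    ≈⟨ -‿distribˡ-* _ _ ⟩
    - fromℕ S (suc m) * fromℤ S j      ∎

  -- fromℤ (+ 1) is 1# + 0#; mapping 1 to 1# itself lets solver constants match 1# definitionally.
  embed : ℤ → Carrier
  embed (+ 1) = 1#
  embed i     = fromℤ S i

  embed≈fromℤ : ∀ i → embed i ≈ fromℤ S i
  embed≈fromℤ (+ zero)          = refl
  embed≈fromℤ (+ suc zero)      = sym (+-identityʳ 1#)
  embed≈fromℤ (+ suc (suc n))   = refl
  embed≈fromℤ -[1+ n ]          = refl

  coefficients : ℤ.+-*-rawRing -Raw-AlmostCommutative⟶ fromCommutativeRing S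
  coefficients = record
    { ⟦_⟧    = embed
    ; +-homo = λ i j → trans (embed≈fromℤ (i ℤ.+ j))
        (trans (fromℤ-+ i j) (sym (+-cong (embed≈fromℤ i) (embed≈fromℤ j))))
    ; *-homo = λ i j → trans (embed≈fromℤ (i ℤ.* j))
        (trans (fromℤ-* i j) (sym (*-cong (embed≈fromℤ i) (embed≈fromℤ j))))
    ; -‿homo = λ i → trans (embed≈fromℤ (ℤ.- i)) (trans (fromℤ-neg i) (sym (-‿cong (embed≈fromℤ i))))
    ; 0-homo = refl
    ; 1-homo = refl
    }

  _coeff≟_ : WeaklyDecidable (Induced-equivalence coefficients)
  i coeff≟ j with i ℤ.≟ j
  ... | yes ≡.refl = just refl
  ... | no  _      = nothing

  open Algebra.Solver.Ring ℤ.+-*-rawRing (fromCommutativeRing S) coefficients _coeff≟_ public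
    using (solve; _:=_; _:+_; _:*_; _:-_; :-_; con; Polynomial)

  :0 :1 : ∀ {n} → Polynomial n
  :0 = con (+ 0)
  :1 = con (+ 1)

-- Finite sums and products

-- the increasing enumeration of the naturals other than s
punch : ℕ → ℕ → ℕ
punch zero    j       = suc j
punch (suc s) zero    = zero
punch (suc s) (suc j) = suc (punch s j)

module Fold (M : CommutativeMonoid 0ℓ 0ℓ) where
  open CommutativeMonoid M
  open import Relation.Binary.Reasoning.Setoid setoid
  open import Algebra.Properties.CommutativeSemigroup commutativeSemigroup
    using (interchange; x∙yz≈y∙xz)

  fold : ℕ → (ℕ → Carrier) → Carrier
  fold zero    f = ε
  fold (suc n) f = f 0 ∙ fold n (f ∘ suc)

  fold-cong : ∀ n {f g : ℕ → Carrier} → (∀ i → i < n → f i ≈ g i) → fold n f ≈ fold n g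
  fold-cong zero    eq = refl
  fold-cong (suc n) eq = ∙-cong (eq 0 (s≤s z≤n)) (fold-cong n (λ i i<n → eq (suc i) (s≤s i<n)))

  fold-cong′ : ∀ n {f g : ℕ → Carrier} → (∀ i → f i ≈ g i) → fold n f ≈ fold n g
  fold-cong′ n eq = fold-cong n (λ i _ → eq i)

  fold-∙ : ∀ n (f g : ℕ → Carrier) → fold n (λ i → f i ∙ g i) ≈ fold n f ∙ fold n g
  fold-∙ zero    f g = sym (identityˡ ε)
  fold-∙ (suc n) f g = trans (∙-congˡ (fold-∙ n (f ∘ suc) (g ∘ suc))) (interchange _ _ _ _)

  fold-ε : ∀ n → fold n (λ _ → ε) ≈ ε
  fold-ε zero    = refl
  fold-ε (suc n) = trans (identityˡ _) (fold-ε n)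

  fold-punch : ∀ n s → s ℕ.≤ n → (f : ℕ → Carrier) →
    fold (suc n) f ≈ f s ∙ fold n (f ∘ punch s)
  fold-punch n       zero    _         f = refl
  fold-punch (suc n) (suc s) (s≤s s≤n) f =
    trans (∙-congˡ (fold-punch n s s≤n (f ∘ suc))) (x∙yz≈y∙xz _ _ _)

module RingKit (S : CommutativeRing 0ℓ 0ℓ) where
  open CommutativeRing S public hiding (zero)
  open IntegerSolver S public
  open import Algebra.Properties.Ring ring public
    using (-0#≈0#; -‿distribˡ-*; -‿distribʳ-*; -‿involutive; -‿+-comm)
  open Fold +-commutativeMonoid public
    renaming (fold to sum; fold-cong to sum-cong; fold-cong′ to sum-cong′; fold-∙ to sum-+; fold-ε to sum-0)
    hiding (fold-punch)
  open Fold *-commutativeMonoid public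
    renaming (fold to prod; fold-cong′ to prod-cong′; fold-∙ to prod-*; fold-punch to prod-punch)
    hiding (fold-cong; fold-ε)

  infixr 8 _^_
  _^_ : Carrier → ℕ → Carrier
  _^_ = pow S

  ^-cong : ∀ n {x y} → x ≈ y → x ^ n ≈ y ^ n
  ^-cong zero    eq = refl
  ^-cong (suc n) eq = *-cong eq (^-cong n eq)

  *-sum : ∀ n x (f : ℕ → Carrier) → x * sum n f ≈ sum n (λ i → x * f i)
  *-sum zero    x f = zeroʳ x
  *-sum (suc n) x f = trans (distribˡ _ _ _) (+-congˡ (*-sum n x (f ∘ suc)))

  sum-neg : ∀ n (f : ℕ → Carrier) → sum n (λ i → - f i) ≈ - sum n f
  sum-neg zero    f = sym -0#≈0#
  sum-neg (suc n) f = trans (+-congˡ (sum-neg n (f ∘ suc))) (-‿+-comm _ _)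

-- Adjacent transpositions of indices

swapIx : ℕ → ℕ → ℕ
swapIx zero    zero          = 1
swapIx zero    (suc zero)    = 0
swapIx zero    (suc (suc j)) = suc (suc j)
swapIx (suc i) zero          = zero
swapIx (suc i) (suc j)       = suc (swapIx i j)

swapIx-left : ∀ i → swapIx i i ≡ suc i
swapIx-left zero    = ≡.refl
swapIx-left (suc i) = ≡.cong suc (swapIx-left i)

swapIx-right : ∀ i → swapIx i (suc i) ≡ i
swapIx-right zero    = ≡.refl
swapIx-right (suc i) = ≡.cong suc (swapIx-right i)

swapIx-< : ∀ {s i} → i < s → swapIx s i ≡ i
swapIx-< {suc s} {zero}  _         = ≡.refl
swapIx-< {suc s} {suc i} (s≤s i<s) = ≡.cong suc (swapIx-< i<s)

swapIx-> : ∀ {s i} → suc s < i → swapIx s i ≡ i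
swapIx-> {zero}  {suc (suc i)} _         = ≡.refl
swapIx-> {zero}  {suc zero}    (s≤s ())
swapIx-> {suc s} {suc i}       (s≤s s<i) = ≡.cong suc (swapIx-> s<i)

-- x if the j-th of the positions other than s lies before s, and y otherwise.
side : ∀ {A : Set} → ℕ → ℕ → A → A → A
side zero    j       x y = y
side (suc s) zero    x y = x
side (suc s) (suc j) x y = side s j x y

-- Pair products, complete homogeneous polynomials and Laplace expansion

module Vandermonde (S : CommutativeRing 0ℓ 0ℓ) where
  open RingKit S
  open import Relation.Binary.Reasoning.Setoid setoid

  pairProd : ℕ → (ℕ → ℕ → Carrier) → Carrier
  pairProd zero    F = 1#
  pairProd (suc n) F = prod n (F 0 ∘ suc) * pairProd n (λ i j → F (suc i) (suc j))

  pairProd-cong : ∀ n {F G : ℕ → ℕ → Carrier} → (∀ i j → F i j ≈ G i j) → pairProd n F ≈ pairProd n G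
  pairProd-cong zero    eq = refl
  pairProd-cong (suc n) eq =
    *-cong (prod-cong′ n (λ j → eq 0 (suc j))) (pairProd-cong n (λ i j → eq (suc i) (suc j)))

  pairProd-* : ∀ n (F G : ℕ → ℕ → Carrier) →
    pairProd n (λ i j → F i j * G i j) ≈ pairProd n F * pairProd n G
  pairProd-* zero    F G = sym (*-identityˡ 1#)
  pairProd-* (suc n) F G = begin
    prod n _ * pairProd n _
      ≈⟨ *-cong (prod-* n _ _) (pairProd-* n _ _) ⟩
    (prod n (F 0 ∘ suc) * prod n (G 0 ∘ suc)) * (pairProd n _ * pairProd n _)
      ≈⟨ solve 4 (λ a b c d → (a :* b) :* (c :* d) := (a :* c) :* (b :* d)) refl _ _ _ _ ⟩
    pairProd (suc n) F * pairProd (suc n) G ∎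

  -- The factors containing index s keep their orientation: s is the second argument for smaller
  -- indices and the first for larger ones. For the non-symmetric Q this difference produces the two
  -- kinds of factors p and q.
  pairProd-punch : ∀ n s → s ℕ.≤ n → (F : ℕ → ℕ → Carrier) →
    pairProd (suc n) F ≈
    pairProd n (λ i j → F (punch s i) (punch s j))
      * prod n (λ j → side s j (F (punch s j) s) (F s (punch s j)))
  pairProd-punch n       zero    _         F = *-comm _ _
  pairProd-punch (suc n) (suc s) (s≤s s≤n) F = begin
    prod (suc n) (F 0 ∘ suc) * pairProd (suc n) F′
      ≈⟨ *-cong (prod-punch n s s≤n (F 0 ∘ suc)) (pairProd-punch n s s≤n F′) ⟩
    (F 0 (suc s) * prod n _) * (pairProd n _ * prod n _)
      ≈⟨ solve 4 (λ a b c d → (a :* b) :* (c :* d) := (b :* c) :* (a :* d)) refl _ _ _ _ ⟩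
    (prod n _ * pairProd n _) * (F 0 (suc s) * prod n _) ∎
    where F′ = λ i j → F (suc i) (suc j)

  -- The pair product without its factor at (i, i+1). The default 1# is not reached when suc i < n.
  rest₂ : ℕ → ℕ → (ℕ → ℕ → Carrier) → Carrier
  rest₂ zero    (suc (suc n)) F =
    (prod n (λ j → F 0 (2 ℕ.+ j)) * prod n (λ j → F 1 (2 ℕ.+ j)))
      * pairProd n (λ i j → F (2 ℕ.+ i) (2 ℕ.+ j))
  rest₂ (suc i) (suc n) F = prod n (F 0 ∘ suc) * rest₂ i n (λ i j → F (suc i) (suc j))
  rest₂ _       _       F = 1#

  -- The pair product without the three factors among i, i+1, i+2. The default 1# is not reached
  -- when i+2 < n.
  rest₃ : ℕ → ℕ → (ℕ → ℕ → Carrier) → Carrier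
  rest₃ zero    (suc (suc (suc n))) F =
    ((prod n (λ j → F 0 (3 ℕ.+ j)) * prod n (λ j → F 1 (3 ℕ.+ j))) * prod n (λ j → F 2 (3 ℕ.+ j)))
      * pairProd n (λ i j → F (3 ℕ.+ i) (3 ℕ.+ j))
  rest₃ (suc i) (suc n) F = prod n (F 0 ∘ suc) * rest₃ i n (λ i j → F (suc i) (suc j))
  rest₃ _       _       F = 1#

  pairProd-rest₂ : ∀ i n → suc i < n → (F : ℕ → ℕ → Carrier) →
    pairProd n F ≈ F i (suc i) * rest₂ i n F
  pairProd-rest₂ zero    (suc (suc n)) _         F =
    solve 4 (λ a b c d → (a :* b) :* (c :* d) := a :* ((b :* c) :* d)) refl _ _ _ _
  pairProd-rest₂ zero    (suc zero)    (s≤s ()) F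
  pairProd-rest₂ (suc i) (suc n)       (s≤s i<n) F = begin
    prod n _ * pairProd n _                  ≈⟨ *-congˡ (pairProd-rest₂ i n i<n _) ⟩
    prod n _ * (F (suc i) (suc (suc i)) * _) ≈⟨ solve 3 (λ a b c → a :* (b :* c) := b :* (a :* c)) refl _ _ _ ⟩
    F (suc i) (suc (suc i)) * _              ∎

  pairProd-rest₃ : ∀ i n → suc (suc i) < n → (F : ℕ → ℕ → Carrier) →
    pairProd n F ≈ (F i (suc i) * (F i (suc (suc i)) * F (suc i) (suc (suc i)))) * rest₃ i n F
  pairProd-rest₃ zero    (suc (suc (suc n))) _ F =
    solve 7 (λ a b c d e f g →
      (a :* (b :* c)) :* ((d :* e) :* (f :* g)) := (a :* (b :* d)) :* (((c :* e) :* f) :* g))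
      refl _ _ _ _ _ _ _
  pairProd-rest₃ zero    (suc zero)          (s≤s ()) F
  pairProd-rest₃ zero    (suc (suc zero))    (s≤s (s≤s ())) F
  pairProd-rest₃ (suc i) (suc n)             (s≤s i<n) F = begin
    prod n _ * pairProd n _ ≈⟨ *-congˡ (pairProd-rest₃ i n i<n _) ⟩
    prod n _ * (_ * _)      ≈⟨ solve 3 (λ a b c → a :* (b :* c) := b :* (a :* c)) refl _ _ _ ⟩
    _ * _                   ∎

  swapF : ℕ → (ℕ → ℕ → Carrier) → (ℕ → ℕ → Carrier)
  swapF i F j k = F (swapIx i j) (swapIx i k)

  prod-swap : ∀ i n → suc i < n → (f : ℕ → Carrier) → prod n (f ∘ swapIx i) ≈ prod n f
  prod-swap zero    (suc (suc n)) _         f =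
    solve 3 (λ a b c → a :* (b :* c) := b :* (a :* c)) refl _ _ _
  prod-swap zero    (suc zero)    (s≤s ()) f
  prod-swap (suc i) (suc n)       (s≤s i<n) f = *-congˡ (prod-swap i n i<n (f ∘ suc))

  rest₂-swap : ∀ i n → suc i < n → (F : ℕ → ℕ → Carrier) → rest₂ i n (swapF i F) ≈ rest₂ i n F
  rest₂-swap zero    (suc (suc n)) _         F = *-congʳ (*-comm _ _)
  rest₂-swap zero    (suc zero)    (s≤s ()) F
  rest₂-swap (suc i) (suc n)       (s≤s i<n) F =
    *-cong (prod-swap i n i<n (F 0 ∘ suc)) (rest₂-swap i n i<n _)

  rest₂-cong : ∀ i n {F G : ℕ → ℕ → Carrier} → (∀ i j → F i j ≈ G i j) → rest₂ i n F ≈ rest₂ i n G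
  rest₂-cong zero    zero          eq = refl
  rest₂-cong zero    (suc zero)    eq = refl
  rest₂-cong zero    (suc (suc n)) eq = *-cong
    (*-cong (prod-cong′ n (λ j → eq 0 _)) (prod-cong′ n (λ j → eq 1 _))) (pairProd-cong n (λ i j → eq _ _))
  rest₂-cong (suc i) zero          eq = refl
  rest₂-cong (suc i) (suc n)       eq =
    *-cong (prod-cong′ n (λ j → eq 0 (suc j))) (rest₂-cong i n (λ i j → eq (suc i) (suc j)))

  rest₃-cong : ∀ i n {F G : ℕ → ℕ → Carrier} → (∀ i j → F i j ≈ G i j) → rest₃ i n F ≈ rest₃ i n G
  rest₃-cong zero    zero                eq = refl
  rest₃-cong zero    (suc zero)          eq = refl
  rest₃-cong zero    (suc (suc zero))    eq = refl
  rest₃-cong zero    (suc (suc (suc n))) eq = *-cong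
    (*-cong (*-cong (prod-cong′ n (λ j → eq 0 _)) (prod-cong′ n (λ j → eq 1 _))) (prod-cong′ n (λ j → eq 2 _)))
    (pairProd-cong n (λ i j → eq _ _))
  rest₃-cong (suc i) zero                eq = refl
  rest₃-cong (suc i) (suc n)             eq =
    *-cong (prod-cong′ n (λ j → eq 0 (suc j))) (rest₃-cong i n (λ i j → eq (suc i) (suc j)))

  rest₃-swapˡ : ∀ i n → suc (suc i) < n → (F : ℕ → ℕ → Carrier) → rest₃ i n (swapF i F) ≈ rest₃ i n F
  rest₃-swapˡ zero    (suc (suc (suc n))) _ F = *-congʳ (*-congʳ (*-comm _ _))
  rest₃-swapˡ zero    (suc zero)          (s≤s ()) F
  rest₃-swapˡ zero    (suc (suc zero))    (s≤s (s≤s ())) F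
  rest₃-swapˡ (suc i) (suc n)             (s≤s i<n) F =
    *-cong (prod-swap i n (<⇒≤ i<n) (F 0 ∘ suc)) (rest₃-swapˡ i n i<n _)

  rest₃-swapʳ : ∀ i n → suc (suc i) < n → (F : ℕ → ℕ → Carrier) →
    rest₃ i n (swapF (suc i) F) ≈ rest₃ i n F
  rest₃-swapʳ zero    (suc (suc (suc n))) _ F =
    *-congʳ (solve 3 (λ a b c → (a :* c) :* b := (a :* b) :* c) refl _ _ _)
  rest₃-swapʳ zero    (suc zero)          (s≤s ()) F
  rest₃-swapʳ zero    (suc (suc zero))    (s≤s (s≤s ())) F
  rest₃-swapʳ (suc i) (suc n)             (s≤s i<n) F =
    *-cong (prod-swap (suc i) n i<n (F 0 ∘ suc)) (rest₃-swapʳ i n i<n _)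

  -- The only pair whose order is reversed by the exchange of i and i+1 is (i, i+1) itself, so
  -- multiplying by the factor of the reversed pair makes the product symmetric under this exchange.
  pairProd-swap : ∀ i n → suc i < n → (F : ℕ → ℕ → Carrier) →
    F (suc i) i * pairProd n F ≈ F i (suc i) * pairProd n (swapF i F)
  pairProd-swap i n i<n F = begin
    F (suc i) i * pairProd n F                ≈⟨ *-congˡ (pairProd-rest₂ i n i<n F) ⟩
    F (suc i) i * (F i (suc i) * rest₂ i n F) ≈⟨ solve 3 (λ a b c → a :* (b :* c) := b :* (a :* c)) refl _ _ _ ⟩
    F i (suc i) * (F (suc i) i * rest₂ i n F)
      ≈⟨ *-congˡ (*-cong (reflexive (≡.sym (≡.cong₂ F (swapIx-left i) (swapIx-right i)))) (sym (rest₂-swap i n i<n F))) ⟩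
    F i (suc i) * (swapF i F i (suc i) * rest₂ i n (swapF i F)) ≈⟨ *-congˡ (pairProd-rest₂ i n i<n (swapF i F)) ⟨
    F i (suc i) * pairProd n (swapF i F)      ∎

  vdm : ℕ → (ℕ → Carrier) → Carrier
  vdm n z = pairProd n (λ i j → z j - z i)

  vdm-cong : ∀ n {z w : ℕ → Carrier} → (∀ i → z i ≈ w i) → vdm n z ≈ vdm n w
  vdm-cong n eq = pairProd-cong n (λ i j → +-cong (eq j) (-‿cong (eq i)))

  -- h_b(z₀, …, z_{n-1})
  hom-sym : ℕ → ℕ → (ℕ → Carrier) → Carrier
  hom-sym n       zero    z = 1#
  hom-sym zero    (suc b) z = 0#
  hom-sym (suc n) (suc b) z = hom-sym n (suc b) (z ∘ suc) + z 0 * hom-sym (suc n) b z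

  hom-sym-cong : ∀ n b {z w : ℕ → Carrier} → (∀ i → z i ≈ w i) → hom-sym n b z ≈ hom-sym n b w
  hom-sym-cong n       zero    eq = refl
  hom-sym-cong zero    (suc b) eq = refl
  hom-sym-cong (suc n) (suc b) eq =
    +-cong (hom-sym-cong n (suc b) (eq ∘ suc)) (*-cong (eq 0) (hom-sym-cong (suc n) b eq))

  -- The generating function ∏ 1/(1 - z_i t) treats all variables alike, so the defining recursion
  -- may single out any variable s. Its cases s = 0 and s = 1 together give the symmetry of h_b.
  hom-sym-punch : ∀ n b s → s ℕ.≤ n → (z : ℕ → Carrier) →
    hom-sym (suc n) (suc b) z ≈ hom-sym n (suc b) (z ∘ punch s) + z s * hom-sym (suc n) b z
  hom-sym-punch n       b       zero    _         z = refl
  hom-sym-punch (suc n) zero    (suc s) (s≤s s≤n) z = begin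
    hom-sym (suc n) 1 (z ∘ suc) + z 0 * 1#
      ≈⟨ +-congʳ (hom-sym-punch n zero s s≤n (z ∘ suc)) ⟩
    (_ + z (suc s) * 1#) + z 0 * 1#
      ≈⟨ solve 3 (λ a b c → (a :+ b) :+ c := (a :+ c) :+ b) refl _ _ _ ⟩
    (_ + z 0 * 1#) + z (suc s) * 1# ∎
  hom-sym-punch (suc n) (suc b) (suc s) (s≤s s≤n) z = begin
    hom-sym (suc n) (2 ℕ.+ b) z′ + z 0 * hom-sym (2 ℕ.+ n) (suc b) z
      ≈⟨ +-cong (hom-sym-punch n (suc b) s s≤n z′) (*-congˡ (hom-sym-punch (suc n) b (suc s) (s≤s s≤n) z)) ⟩
    (A + z′ s * B) + z 0 * (C + z′ s * D)
      ≈⟨ solve 6 (λ a b c d x y → (a :+ y :* b) :+ x :* (c :+ y :* d) := (a :+ x :* c) :+ y :* (b :+ x :* d))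
           refl A B C D (z 0) (z′ s) ⟩
    (A + z 0 * C) + z′ s * (B + z 0 * D) ∎
    where
    z′ = z ∘ suc
    A = hom-sym n (2 ℕ.+ b) (z′ ∘ punch s)
    B = hom-sym (suc n) (suc b) z′
    C = hom-sym (suc n) (suc b) (z ∘ punch (suc s))
    D = hom-sym (2 ℕ.+ n) b z

  hom-sym-swap : ∀ i n b → suc i < n → (z : ℕ → Carrier) → hom-sym n b (z ∘ swapIx i) ≈ hom-sym n b z
  hom-sym-swap i       n             zero    _ z = refl
  hom-sym-swap zero    (suc (suc n)) (suc b) l z = begin
    hom-sym (suc n) (suc b) (z ∘ swapIx 0 ∘ suc) + z 1 * hom-sym (2 ℕ.+ n) b (z ∘ swapIx 0)
      ≈⟨ +-cong (hom-sym-cong (suc n) (suc b) (λ { zero → refl ; (suc j) → refl }))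
                (*-congˡ (hom-sym-swap zero (2 ℕ.+ n) b l z)) ⟩
    hom-sym (suc n) (suc b) (z ∘ punch 1) + z 1 * hom-sym (2 ℕ.+ n) b z
      ≈⟨ hom-sym-punch (suc n) b 1 (s≤s z≤n) z ⟨
    hom-sym (2 ℕ.+ n) (suc b) z ∎
  hom-sym-swap zero    (suc zero)    (suc b) (s≤s ()) z
  hom-sym-swap (suc i) (suc n)       (suc b) (s≤s i<n) z =
    +-cong (hom-sym-swap i n (suc b) i<n (z ∘ suc)) (*-congˡ (hom-sym-swap (suc i) (suc n) b (s≤s i<n) z))

  sgn : ℕ → Carrier
  sgn zero    = 1#
  sgn (suc s) = - sgn s

  module _ (n : ℕ) (z : ℕ → Carrier) where
    private
      P : Carrier → ℕ → Carrier
      P w s = prod n (λ j → z (suc (punch s j)) - w)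
      Π : Carrier → Carrier
      Π w = prod (suc n) (λ j → z (suc j) - w)
      D : ℕ → Carrier
      D s = vdm n (z ∘ suc ∘ punch s)

    -- (z₀ - w) = (zₛ - w) - (zₛ - z₀) completes one of the two products over j ≠ s.
    lagrange-step : ∀ w s → s ℕ.≤ n →
      sgn (suc s) * (((z 0 - w) * P w s) * (P (z 0) s * D s))
      ≈ Π (z 0) * (sgn s * (P w s * D s)) - Π w * (sgn s * (P (z 0) s * D s))
    lagrange-step w s s≤n = begin
      - sgn s * (((z 0 - w) * P w s) * (P (z 0) s * D s))
        ≈⟨ solve 7 (λ e z0 zs w p q d →
             :- e :* (((z0 :- w) :* p) :* (q :* d)) :=
             ((zs :- z0) :* q) :* (e :* (p :* d)) :- ((zs :- w) :* p) :* (e :* (q :* d)))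
             refl (sgn s) (z 0) (z (suc s)) w (P w s) (P (z 0) s) (D s) ⟩
      ((z (suc s) - z 0) * P (z 0) s) * (sgn s * (P w s * D s))
        - ((z (suc s) - w) * P w s) * (sgn s * (P (z 0) s * D s))
        ≈⟨ +-cong (*-congʳ (prod-punch n s s≤n (λ j → z (suc j) - z 0)))
                  (-‿cong (*-congʳ (prod-punch n s s≤n (λ j → z (suc j) - w)))) ⟨
      Π (z 0) * (sgn s * (P w s * D s)) - Π w * (sgn s * (P (z 0) s * D s)) ∎

  -- Lagrange interpolation of the constant 1 at the nodes z_s, with denominators cleared: up to the
  -- sign, `vdm (suc n) z` is `vdm n (z ∘ punch s)` times the product of z_j - z_s over j ≠ s. The
  -- free point w is needed in the induction and later specialised.
  lagrange : ∀ n w (z : ℕ → Carrier) →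
    sum (suc n) (λ s → sgn s * (prod n (λ j → z (punch s j) - w) * vdm n (z ∘ punch s))) ≈ vdm (suc n) z
  lagrange zero    w z = trans (+-identityʳ _) (*-identityˡ _)
  lagrange (suc n) w z = begin
    1# * (prod (suc n) (λ j → z′ j - w) * vdm (suc n) z′) + sum (suc n) c
      ≈⟨ +-cong (*-identityˡ _) (sum-cong (suc n) {c} {λ s → Π0 * a s + - (Πw * b s)} (λ s s<n → lagrange-step n z w s (ℕ.s≤s⁻¹ s<n))) ⟩
    Πw * V + sum (suc n) (λ s → Π0 * a s + - (Πw * b s))
      ≈⟨ +-congˡ (trans (sum-+ (suc n) (λ s → Π0 * a s) (λ s → - (Πw * b s)))
           (+-cong (sym (*-sum (suc n) Π0 a)) (trans (sum-neg (suc n) (λ s → Πw * b s)) (-‿cong (sym (*-sum (suc n) Πw b)))))) ⟩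
    Πw * V + (Π0 * sum (suc n) a - Πw * sum (suc n) b)
      -- The induction hypothesis gives the same value V at w and at z 0, so the contributions with
      -- Πw cancel.
      ≈⟨ +-congˡ (+-cong (*-congˡ (lagrange n w z′)) (-‿cong (*-congˡ (lagrange n (z 0) z′)))) ⟩
    Πw * V + (Π0 * V - Πw * V)
      ≈⟨ solve 3 (λ a b v → a :* v :+ (b :* v :- a :* v) := b :* v) refl Πw Π0 V ⟩
    Π0 * V ∎
    where
    z′ = z ∘ suc
    V = vdm (suc n) z′
    Πw = prod (suc n) (λ j → z′ j - w)
    Π0 = prod (suc n) (λ j → z′ j - z 0)
    a b c : ℕ → Carrier
    c s = sgn (suc s) * (prod (suc n) (λ j → z (punch (suc s) j) - w) * vdm (suc n) (z ∘ punch (suc s)))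
    a s = sgn s * (prod n (λ j → z′ (punch s j) - w) * vdm n (z′ ∘ punch s))
    b s = sgn s * (prod n (λ j → z′ (punch s j) - z 0) * vdm n (z′ ∘ punch s))

  -- Expansion of a determinant with two equal rows of ones. Omitting variable s+1 keeps z 0 in
  -- front, so the terms after the first are those of `lagrange` for the remaining variables with w
  -- = z 0.
  vdm-alternating : ∀ n (z : ℕ → Carrier) →
    sum (2 ℕ.+ n) (λ s → sgn s * vdm (suc n) (z ∘ punch s)) ≈ 0#
  vdm-alternating n z = begin
    1# * V + sum (suc n) (λ s → - sgn s * vdm (suc n) (z ∘ punch (suc s)))
      ≈⟨ +-cong (*-identityˡ V) (sum-cong′ (suc n) {λ s → - sgn s * D s} {λ s → - (sgn s * D s)}
                                              (λ s → sym (-‿distribˡ-* (sgn s) (D s)))) ⟩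
    V + sum (suc n) (λ s → - (sgn s * vdm (suc n) (z ∘ punch (suc s))))
      ≈⟨ +-congˡ (trans (sum-neg (suc n) (λ s → sgn s * D s)) (-‿cong (lagrange n (z 0) (z ∘ suc)))) ⟩
    V - V ≈⟨ -‿inverseʳ V ⟩
    0# ∎
    where
    V = vdm (suc n) (z ∘ suc)
    D : ℕ → Carrier
    D s = vdm (suc n) (z ∘ punch (suc s))

  vdm-laplace : ∀ n (z : ℕ → Carrier) →
    sum (suc n) (λ s → sgn s * (prod n (z ∘ punch s) * vdm n (z ∘ punch s))) ≈ vdm (suc n) z
  vdm-laplace n z = trans
    (sum-cong′ (suc n) {λ s → sgn s * (prod n (z ∘ punch s) * D s)}
                       {λ s → sgn s * (prod n (λ j → z (punch s j) - 0#) * D s)}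
      (λ s → *-congˡ {sgn s} (*-congʳ {D s} (prod-cong′ n
        (λ j → sym (trans (+-congˡ -0#≈0#) (+-identityʳ (z (punch s j)))))))))
    (lagrange n 0# z)
    where
    D : ℕ → Carrier
    D s = vdm n (z ∘ punch s)

  -- h_b(z without zₛ) = h_b(z) - zₛ h_{b-1}(z), and the second part contributes a multiple of vdm-alternating.
  laplace : ∀ n b (z : ℕ → Carrier) →
    sum (2 ℕ.+ n) (λ s → sgn s * (prod (suc n) (z ∘ punch s)
      * (vdm (suc n) (z ∘ punch s) * hom-sym (suc n) b (z ∘ punch s))))
    ≈ vdm (2 ℕ.+ n) z * hom-sym (2 ℕ.+ n) b z
  laplace n zero z = begin
    sum (2 ℕ.+ n) (λ s → sgn s * (p s * (v s * 1#)))
      ≈⟨ sum-cong′ (2 ℕ.+ n) {λ s → sgn s * (p s * (v s * 1#))} (λ s → *-congˡ (*-congˡ (*-identityʳ (v s)))) ⟩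
    sum (2 ℕ.+ n) (λ s → sgn s * (p s * v s)) ≈⟨ vdm-laplace (suc n) z ⟩
    vdm (2 ℕ.+ n) z    ≈⟨ *-identityʳ _ ⟨
    vdm (2 ℕ.+ n) z * 1# ∎
    where
    p v : ℕ → Carrier
    p s = prod (suc n) (z ∘ punch s)
    v s = vdm (suc n) (z ∘ punch s)
  laplace n (suc b) z = begin
    sum (2 ℕ.+ n) t
      ≈⟨ sum-cong (2 ℕ.+ n) {t} {λ s → H * f s + K * g s} (λ s s<n → step s (ℕ.s≤s⁻¹ s<n)) ⟩
    sum (2 ℕ.+ n) (λ s → H * f s + K * g s)
      ≈⟨ sum-+ (2 ℕ.+ n) (λ s → H * f s) (λ s → K * g s) ⟩
    sum (2 ℕ.+ n) (λ s → H * f s) + sum (2 ℕ.+ n) (λ s → K * g s)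
      ≈⟨ +-cong (*-sum (2 ℕ.+ n) H f) (*-sum (2 ℕ.+ n) K g) ⟨
    H * sum (2 ℕ.+ n) f + K * sum (2 ℕ.+ n) g
      ≈⟨ +-cong (*-congˡ (vdm-laplace (suc n) z)) (*-congˡ (vdm-alternating n z)) ⟩
    H * vdm (2 ℕ.+ n) z + K * 0#
      ≈⟨ +-cong (*-comm _ _) (zeroʳ K) ⟩
    vdm (2 ℕ.+ n) z * H + 0# ≈⟨ +-identityʳ _ ⟩
    vdm (2 ℕ.+ n) z * H ∎
    where
    H = hom-sym (2 ℕ.+ n) (suc b) z
    K = - (prod (2 ℕ.+ n) z * hom-sym (2 ℕ.+ n) b z)
    t f g : ℕ → Carrier
    t s = sgn s * (prod (suc n) (z ∘ punch s)
      * (vdm (suc n) (z ∘ punch s) * hom-sym (suc n) (suc b) (z ∘ punch s)))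
    f s = sgn s * (prod (suc n) (z ∘ punch s) * vdm (suc n) (z ∘ punch s))
    g s = sgn s * vdm (suc n) (z ∘ punch s)
    step : ∀ s → s ℕ.≤ suc n → t s ≈ H * f s + K * g s
    step s s≤n = begin
      e * (p * (v * k))
        -- The factor z s completes the product over the other variables to the full product, so the
        -- correction has a coefficient K independent of s.
        ≈⟨ solve 6 (λ e p v k x h → e :* (p :* (v :* k)) :=
             (k :+ x :* h) :* (e :* (p :* v)) :+ (:- ((x :* p) :* h)) :* (e :* v)) refl e p v k (z s) h ⟩
      (k + z s * h) * f s + - ((z s * p) * h) * g s
        ≈⟨ +-cong (*-congʳ (hom-sym-punch (suc n) b s s≤n z))
                  (*-congʳ (-‿cong (*-congʳ (prod-punch (suc n) s s≤n z)))) ⟨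
      H * f s + K * g s ∎
      where
      e = sgn s
      p = prod (suc n) (z ∘ punch s)
      v = vdm (suc n) (z ∘ punch s)
      k = hom-sym (suc n) (suc b) (z ∘ punch s)
      h = hom-sym (2 ℕ.+ n) b z

-- Weights of interlacing rows

at : ∀ {n} → Vec ℕ n → ℕ → ℕ
at []       j       = 0
at (k ∷ ks) zero    = k
at (k ∷ ks) (suc j) = at ks j

module RowWeights (R : CommutativeRing 0ℓ 0ℓ) (u v : CommutativeRing.Carrier R) (D : ℕ) where
  open RingKit R
  open import Relation.Binary.Reasoning.Setoid setoid

  if-dec : ∀ {P : Set} → Dec P → Carrier → Carrier → Carrier
  if-dec d x y = if does d then x else y

  if-true : ∀ {P : Set} (d : Dec P) {x y} → P → if-dec d x y ≈ x
  if-true d p rewrite dec-true d p = refl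

  if-false : ∀ {P : Set} (d : Dec P) {x y} → ¬ P → if-dec d x y ≈ y
  if-false d ¬p rewrite dec-false d ¬p = refl

  [_] : ∀ {P : Set} → Dec P → Carrier
  [ d ] = if-dec d 1# 0#

  -- The factor that one upper entry r between the lower neighbours k and k′ contributes: u records
  -- r = k′, as in `inv`, and v records r = k, as in `inv'`.
  seg : ℕ → ℕ → ℕ → Carrier
  seg k k′ r = ([ k ≤? r ] * [ r ≤? k′ ]) * (if-dec (r ≟ k′) u 1# * if-dec (r ≟ k) v 1#)

  seg-below : ∀ {k k′ r} → r < k → seg k k′ r ≈ 0#
  seg-below {k} {k′} {r} r<k =
    trans (*-congʳ (trans (*-congʳ (if-false (k ≤? r) (<⇒≱ r<k))) (zeroˡ _))) (zeroˡ _)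

  seg-above : ∀ {k k′ r} → k′ < r → seg k k′ r ≈ 0#
  seg-above {k} {k′} {r} k′<r =
    trans (*-congʳ (trans (*-congˡ (if-false (r ≤? k′) (<⇒≱ k′<r))) (zeroʳ _))) (zeroˡ _)

  seg-within : ∀ {k k′ r} → k ℕ.≤ r → r ℕ.≤ k′ →
    seg k k′ r ≈ if-dec (r ≟ k′) u 1# * if-dec (r ≟ k) v 1#
  seg-within {k} {k′} {r} k≤r r≤k′ =
    trans (*-congʳ (trans (*-cong (if-true (k ≤? r) k≤r) (if-true (r ≤? k′) r≤k′)) (*-identityˡ 1#)))
          (*-identityˡ _)

  Unital : Set
  Unital = (u ≈ 1#) × (v ≈ 1#)

  -- An interval may degenerate to a point only for u = v = 1, where its weight u + v - 1 is 1.
  Step : ℕ → ℕ → Set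
  Step k k′ = (k < k′) ⊎ (k ≡ k′ × Unital)

  Chain : ∀ {l} → Vec ℕ (suc l) → Set
  Chain (k ∷ [])           = k ℕ.≤ D
  Chain (k ∷ ks@(k′ ∷ _)) = Step k k′ × Chain ks

  step⇒≤ : ∀ {k k′} → Step k k′ → k ℕ.≤ k′
  step⇒≤ (inj₁ k<k′)       = <⇒≤ k<k′
  step⇒≤ (inj₂ (≡.refl , _)) = ≤-refl

  chain⇒≤ : ∀ {l} k (ks : Vec ℕ l) → Chain (k ∷ ks) → k ℕ.≤ D
  chain⇒≤ k []        k≤D     = k≤D
  chain⇒≤ k (k′ ∷ ks) (s , c) = ≤-trans (step⇒≤ s) (chain⇒≤ k′ ks c)

  seg-upper : ∀ {k k′} → Step k k′ → seg k k′ k′ ≈ u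
  seg-upper {k} {k′} s = begin
    seg k k′ k′                                     ≈⟨ seg-within (step⇒≤ s) ≤-refl ⟩
    if-dec (k′ ≟ k′) u 1# * if-dec (k′ ≟ k) v 1#   ≈⟨ *-cong (if-true (k′ ≟ k′) ≡.refl) (other s) ⟩
    u * 1#                                          ≈⟨ *-identityʳ u ⟩
    u                                               ∎
    where
    other : Step k k′ → if-dec (k′ ≟ k) v 1# ≈ 1#
    other (inj₁ k<k′)             = if-false (k′ ≟ k) (>⇒≢ k<k′)
    other (inj₂ (eq , _ , v≈1)) = trans (if-true (k′ ≟ k) (≡.sym eq)) v≈1

  seg-lower : ∀ {k k′} → Step k k′ → seg k k′ k ≈ v
  seg-lower {k} {k′} s = begin
    seg k k′ k                                     ≈⟨ seg-within ≤-refl (step⇒≤ s) ⟩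
    if-dec (k ≟ k′) u 1# * if-dec (k ≟ k) v 1#    ≈⟨ *-cong (other s) (if-true (k ≟ k) ≡.refl) ⟩
    1# * v                                         ≈⟨ *-identityˡ v ⟩
    v                                              ∎
    where
    other : Step k k′ → if-dec (k ≟ k′) u 1# ≈ 1#
    other (inj₁ k<k′)           = if-false (k ≟ k′) (<⇒≢ k<k′)
    other (inj₂ (eq , u≈1 , _)) = trans (if-true (k ≟ k′) eq) u≈1

  combine : Carrier → Carrier → Carrier → Carrier → Carrier
  combine a b c d = (a - b) + ((v - 1#) * c + u * d)

  combine-cong : ∀ {a b c d a′ b′ c′ d′} → a ≈ a′ → b ≈ b′ → c ≈ c′ → d ≈ d′ →
    combine a b c d ≈ combine a′ b′ c′ d′
  combine-cong a b c d = +-cong (+-cong a (-‿cong b)) (+-cong (*-congˡ c) (*-congˡ d))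

  -- The interval is taken half-open, as [0, k′) minus [0, k); then the weight at k is corrected
  -- from 1 to v and u is added at k′. This form makes the sum of powers of X a difference of two
  -- geometric sums. For k = k′ the corrections give u + v - 1, which agrees with the weight u v
  -- when u = v = 1.
  seg-indicators : ∀ {k k′} → Step k k′ → ∀ r →
    seg k k′ r ≈ combine [ r <? k′ ] [ r <? k ] [ r ≟ k ] [ r ≟ k′ ]
  seg-indicators {k} {k′} s r with <-cmp r k | <-cmp r k′
  ... | tri< r<k r≢k _ | _ = trans (seg-below r<k) (trans
    (solve 2 (λ u v → :0 := (:1 :- :1) :+ ((v :- :1) :* :0 :+ u :* :0)) refl u v)
    (sym (combine-cong (if-true (r <? k′) (ℕₚ.<-≤-trans r<k (step⇒≤ s))) (if-true (r <? k) r<k)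
      (if-false (r ≟ k) r≢k) (if-false (r ≟ k′) (<⇒≢ (ℕₚ.<-≤-trans r<k (step⇒≤ s)))))))
  ... | tri> _ r≢k k<r | tri< r<k′ r≢k′ _ = trans
    (trans (seg-within (<⇒≤ k<r) (<⇒≤ r<k′)) (*-cong (if-false (r ≟ k′) r≢k′) (if-false (r ≟ k) r≢k)))
    (trans (solve 2 (λ u v → :1 :* :1 := (:1 :- :0) :+ ((v :- :1) :* :0 :+ u :* :0)) refl u v)
    (sym (combine-cong (if-true (r <? k′) r<k′) (if-false (r <? k) (ℕₚ.<⇒≯ k<r))
      (if-false (r ≟ k) r≢k) (if-false (r ≟ k′) r≢k′))))
  ... | tri> _ r≢k k<r | tri> r≮k′ r≢k′ k′<r = trans (seg-above k′<r) (trans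
    (solve 2 (λ u v → :0 := (:0 :- :0) :+ ((v :- :1) :* :0 :+ u :* :0)) refl u v)
    (sym (combine-cong (if-false (r <? k′) r≮k′) (if-false (r <? k) (ℕₚ.<⇒≯ k<r))
      (if-false (r ≟ k) r≢k) (if-false (r ≟ k′) r≢k′))))
  ... | tri> _ r≢k k<r | tri≈ r≮k′ ≡.refl _ = trans (seg-upper s) (trans
    (solve 2 (λ u v → u := (:0 :- :0) :+ ((v :- :1) :* :0 :+ u :* :1)) refl u v)
    (sym (combine-cong (if-false (r <? k′) r≮k′) (if-false (r <? k) (ℕₚ.<⇒≯ k<r))
      (if-false (r ≟ k) r≢k) (if-true (r ≟ k′) ≡.refl))))
  ... | tri≈ r≮k ≡.refl _ | tri< r<k′ r≢k′ _ = trans (seg-lower s) (trans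
    (solve 2 (λ u v → v := (:1 :- :0) :+ ((v :- :1) :* :1 :+ u :* :0)) refl u v)
    (sym (combine-cong (if-true (r <? k′) r<k′) (if-false (r <? k) r≮k)
      (if-true (r ≟ k) ≡.refl) (if-false (r ≟ k′) r≢k′))))
  ... | tri≈ r≮k ≡.refl _ | tri≈ r≮k′ ≡.refl _ = trans (seg-upper s) (trans
    (unital s)
    (sym (combine-cong (if-false (r <? k′) r≮k′) (if-false (r <? k) r≮k)
      (if-true (r ≟ k) ≡.refl) (if-true (r ≟ k′) ≡.refl))))
    where
    unital : Step r r → u ≈ combine 0# 0# 1# 1#
    unital (inj₁ r<r)           = ⊥-elim (<-irrefl ≡.refl r<r)
    unital (inj₂ (_ , _ , v≈1)) = trans
      (solve 1 (λ u → u := (:0 :- :0) :+ ((:1 :- :1) :* :1 :+ u :* :1)) refl u)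
      (+-congˡ (+-congʳ (*-congʳ (+-congʳ (sym v≈1)))))
  ... | tri≈ r≮k ≡.refl _ | tri> _ _ k′<r = ⊥-elim (≤⇒≯ (step⇒≤ s) k′<r)

  -- The bound p ≤ r carries strictness of the upper row: after an entry r it is reset to suc r.
  rowWeight : ∀ {l} → ℕ → Vec ℕ l → Vec ℕ (suc l) → Carrier
  rowWeight p []       (k ∷ [])           = 1#
  rowWeight p (r ∷ rs) (k ∷ ks@(k′ ∷ _)) = ([ p ≤? r ] * seg k k′ r) * rowWeight (suc r) rs ks

  rows : (l : ℕ) → (Vec ℕ l → Carrier) → Carrier
  rows zero    F = F []
  rows (suc l) F = sum (suc D) (λ r → rows l (λ rs → F (r ∷ rs)))

  rows-cong : ∀ l {F G : Vec ℕ l → Carrier} → (∀ r → F r ≈ G r) → rows l F ≈ rows l G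
  rows-cong zero    eq = eq []
  rows-cong (suc l) {F} eq = sum-cong′ (suc D) {λ r → rows l (λ rs → F (r ∷ rs))} (λ r → rows-cong l (λ rs → eq (r ∷ rs)))

  *-rows : ∀ l x (F : Vec ℕ l → Carrier) → x * rows l F ≈ rows l (λ r → x * F r)
  *-rows zero    x F = refl
  *-rows (suc l) x F =
    trans (*-sum (suc D) x (λ r → rows l (λ rs → F (r ∷ rs))))
          (sum-cong′ (suc D) {λ r → x * rows l (λ rs → F (r ∷ rs))} (λ r → *-rows l x (λ rs → F (r ∷ rs))))

-- The weighted sum over the row above

IsHom : (R S : CommutativeRing 0ℓ 0ℓ) → (CommutativeRing.Carrier R → CommutativeRing.Carrier S) → Set
IsHom R S = RingMorphisms.IsRingHomomorphism (CommutativeRing.rawRing R) (CommutativeRing.rawRing S)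

module Interlacing
  (Rˢ Sˢ : CommutativeRing 0ℓ 0ℓ)
  (κ : CommutativeRing.Carrier Rˢ → CommutativeRing.Carrier Sˢ) (κ-hom : IsHom Rˢ Sˢ κ)
  (u v : CommutativeRing.Carrier Rˢ) (D : ℕ)
  (y z : ℕ → CommutativeRing.Carrier Sˢ)
  (zy≈1 : ∀ i → CommutativeRing._≈_ Sˢ (CommutativeRing._*_ Sˢ (z i) (y i)) (CommutativeRing.1# Sˢ))
  where
  private module R = RingKit Rˢ
  open RingKit Sˢ
  open Vandermonde Sˢ using (sgn)
  open RowWeights Rˢ u v D
  open RingMorphisms.IsRingHomomorphism κ-hom
    renaming (⟦⟧-cong to κ-cong; +-homo to κ-+; *-homo to κ-*; 0#-homo to κ-0; 1#-homo to κ-1; -‿homo to κ-neg)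
    using ()
  open import Relation.Binary.Reasoning.Setoid setoid

  X p q : ℕ → Carrier
  X i = 1# + y i
  p i = 1# + (1# - κ v) * y i
  q i = 1# + κ u * y i

  Q : Carrier → Carrier → Carrier
  Q a b = 1# + ((1# - κ v) * a + κ u * (b + a * b))

  A B : ℕ → ℕ → Carrier
  A i k = (z i * X i ^ k) * q i
  B i k = - ((z i * X i ^ k) * p i)

  C : ℕ → ℕ → Carrier
  C i k = - ((z i * z (suc i)) * (X i ^ k * X (suc i) ^ k)) * Q (y (suc i)) (y i)

  sum-indicator : ∀ n k → k < n → (f : ℕ → Carrier) → sum n (λ r → κ [ r ≟ k ] * f r) ≈ f k
  sum-indicator (suc n) zero    _         f = begin
    κ R.1# * f 0 + sum n (λ r → κ R.0# * f (suc r))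
      ≈⟨ +-cong (trans (*-congʳ κ-1) (*-identityˡ _))
                (trans (sum-cong′ n {λ r → κ R.0# * f (suc r)} (λ r → trans (*-congʳ κ-0) (zeroˡ _))) (sum-0 n)) ⟩
    f 0 + 0# ≈⟨ +-identityʳ _ ⟩
    f 0      ∎
  sum-indicator (suc n) (suc k) (s≤s k<n) f = begin
    κ R.0# * f 0 + sum n (λ r → κ [ r ≟ k ] * f (suc r))
      ≈⟨ +-cong (trans (*-congʳ κ-0) (zeroˡ _)) (sum-indicator n k k<n (f ∘ suc)) ⟩
    0# + f (suc k) ≈⟨ +-identityˡ _ ⟩
    f (suc k) ∎

  geometric : ∀ n k → k ℕ.≤ n → ∀ i → y i * sum n (λ r → κ [ r <? k ] * X i ^ r) ≈ X i ^ k - 1#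
  geometric n       zero    _         i = begin
    y i * sum n (λ r → κ R.0# * X i ^ r)
      ≈⟨ *-congˡ (trans (sum-cong′ n {λ r → κ R.0# * X i ^ r} (λ r → trans (*-congʳ κ-0) (zeroˡ _))) (sum-0 n)) ⟩
    y i * 0#  ≈⟨ zeroʳ _ ⟩
    0#        ≈⟨ -‿inverseʳ 1# ⟨
    1# - 1#   ∎
  geometric (suc n) (suc k) (s≤s k≤n) i = begin
    y i * (κ R.1# * 1# + sum n (λ r → κ [ r <? k ] * (X i * X i ^ r)))
      ≈⟨ *-congˡ (+-cong (trans (*-identityʳ _) κ-1) (trans
           (sum-cong′ n {λ r → κ [ r <? k ] * (X i * X i ^ r)} (λ r →
             solve 3 (λ a b c → a :* (b :* c) := b :* (a :* c)) refl (κ [ r <? k ]) (X i) (X i ^ r)))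
           (sym (*-sum n (X i) (λ r → κ [ r <? k ] * X i ^ r))))) ⟩
    y i * (1# + X i * Σk)
      ≈⟨ solve 3 (λ y x s → y :* (:1 :+ x :* s) := y :+ x :* (y :* s)) refl (y i) (X i) Σk ⟩
    y i + X i * (y i * Σk)
      ≈⟨ +-congˡ (*-congˡ (geometric n k k≤n i)) ⟩
    y i + X i * (X i ^ k - 1#)
      ≈⟨ solve 2 (λ y xᵏ → y :+ (:1 :+ y) :* (xᵏ :- :1) := (:1 :+ y) :* xᵏ :- :1) refl (y i) (X i ^ k) ⟩
    X i * X i ^ k - 1# ∎
    where Σk = sum n (λ r → κ [ r <? k ] * X i ^ r)

  -- Division by X i - 1 = y i is multiplication by z i.
  geometric′ : ∀ n k → k ℕ.≤ n → ∀ i → sum n (λ r → κ [ r <? k ] * X i ^ r) ≈ z i * (X i ^ k - 1#)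
  geometric′ n k k≤n i = begin
    Σk               ≈⟨ *-identityˡ Σk ⟨
    1# * Σk          ≈⟨ *-congʳ (zy≈1 i) ⟨
    (z i * y i) * Σk ≈⟨ *-assoc _ _ _ ⟩
    z i * (y i * Σk) ≈⟨ *-congˡ (geometric n k k≤n i) ⟩
    z i * (X i ^ k - 1#) ∎
    where Σk = sum n (λ r → κ [ r <? k ] * X i ^ r)

  κ-combine : ∀ a b c d →
    κ (combine a b c d) ≈ (κ a - κ b) + ((κ v - 1#) * κ c + κ u * κ d)
  κ-combine a b c d = begin
    κ (combine a b c d) ≈⟨ κ-+ _ _ ⟩
    κ (a R.- b) + κ ((v R.- R.1#) R.* c R.+ u R.* d)
      ≈⟨ +-cong (trans (κ-+ _ _) (+-congˡ (κ-neg b)))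
           (trans (κ-+ _ _) (+-cong (trans (κ-* _ _) (*-congʳ
             (trans (κ-+ _ _) (+-congˡ (trans (κ-neg _) (-‿cong κ-1)))))) (κ-* _ _))) ⟩
    (κ a - κ b) + ((κ v - 1#) * κ c + κ u * κ d) ∎

  segment-sum : ∀ {k k′} → Step k k′ → k′ ℕ.≤ D → ∀ i →
    sum (suc D) (λ r → κ (seg k k′ r) * X i ^ r) ≈ A i k′ + B i k
  segment-sum {k} {k′} s k′≤D i = begin
    sum N (λ r → κ (seg k k′ r) * x r)
      ≈⟨ sum-cong′ N {λ r → κ (seg k k′ r) * x r} {λ r → (a r + - b r) + ((κ v - 1#) * c r + κ u * d r)} (λ r → trans
           (*-congʳ (trans (κ-cong (seg-indicators s r)) (κ-combine _ _ _ _)))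
           (solve 7 (λ a b c d v u x → ((a :- b) :+ ((v :- :1) :* c :+ u :* d)) :* x :=
             (a :* x :+ :- (b :* x)) :+ ((v :- :1) :* (c :* x) :+ u :* (d :* x))) refl
             (κ [ r <? k′ ]) (κ [ r <? k ]) (κ [ r ≟ k ]) (κ [ r ≟ k′ ]) (κ v) (κ u) (x r))) ⟩
    sum N (λ r → (a r + - b r) + ((κ v - 1#) * c r + κ u * d r))
      ≈⟨ trans (sum-+ N (λ r → a r + - b r) (λ r → (κ v - 1#) * c r + κ u * d r))
          (+-cong (trans (sum-+ N a (λ r → - b r)) (+-congˡ (sum-neg N b)))
                  (trans (sum-+ N (λ r → (κ v - 1#) * c r) (λ r → κ u * d r))
                         (sym (+-cong (*-sum N _ c) (*-sum N _ d))))) ⟩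
    (sum N a - sum N b) + ((κ v - 1#) * sum N c + κ u * sum N d)
      ≈⟨ +-cong (+-cong (geometric′ N k′ (ℕₚ.m≤n⇒m≤1+n k′≤D) i) (-‿cong (geometric′ N k (ℕₚ.m≤n⇒m≤1+n k≤D) i)))
                (+-cong (*-congˡ (sum-indicator N k (s≤s k≤D) x)) (*-congˡ (sum-indicator N k′ (s≤s k′≤D) x))) ⟩
    (z i * (x k′ - 1#) - z i * (x k - 1#)) + ((κ v - 1#) * x k + κ u * x k′)
      -- The two constants - z i of the geometric sums cancel.
      ≈⟨ solve 5 (λ z x′ x v u →
           (z :* (x′ :- :1) :- z :* (x :- :1)) :+ ((v :- :1) :* x :+ u :* x′) :=
           (z :* x′ :+ (:1 :* x′) :* u) :+ :- (z :* x :+ (:1 :* x) :* (:1 :- v)))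
           refl (z i) (x k′) (x k) (κ v) (κ u) ⟩
    (z i * x k′ + (1# * x k′) * κ u) + - (z i * x k + (1# * x k) * (1# - κ v))
      -- Writing 1 as z i * y i gives the end-point terms the same factor z i as the geometric
      -- terms; this is how q i and p i arise.
      ≈⟨ +-cong (+-congˡ (*-congʳ (*-congʳ (zy≈1 i)))) (-‿cong (+-congˡ (*-congʳ (*-congʳ (zy≈1 i))))) ⟨
    (z i * x k′ + ((z i * y i) * x k′) * κ u) + - (z i * x k + ((z i * y i) * x k) * (1# - κ v))
      ≈⟨ solve 6 (λ z x′ x v u y →
           (z :* x′ :+ ((z :* y) :* x′) :* u) :+ :- (z :* x :+ ((z :* y) :* x) :* (:1 :- v)) :=
           (z :* x′) :* (:1 :+ u :* y) :+ :- ((z :* x) :* (:1 :+ (:1 :- v) :* y)))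
           refl (z i) (x k′) (x k) (κ v) (κ u) (y i) ⟩
    A i k′ + B i k ∎
    where
    N = suc D
    k≤D = ≤-trans (step⇒≤ s) k′≤D
    x a b c d : ℕ → Carrier
    x r = X i ^ r
    a r = κ [ r <? k′ ] * x r
    b r = κ [ r <? k ] * x r
    c r = κ [ r ≟ k ] * x r
    d r = κ [ r ≟ k′ ] * x r

  -- C is what remains when both neighbours r, r′ of an entry k′ equal k′, after
  -- removing the configuration forbidden by strictness of the row.
  A*B-collision : ∀ i k → A i k * B (suc i) k - κ u * (κ v * (X i ^ k * X (suc i) ^ k)) ≈ C i k
  A*B-collision i k = begin
    A i k * B (suc i) k - κ u * (κ v * (a * b))
      ≈⟨ +-congˡ (-‿cong (trans (sym (*-identityˡ _)) (trans (sym (*-identityˡ _))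
           (*-cong (sym (zy≈1 i)) (*-congʳ (sym (zy≈1 (suc i)))))))) ⟩
    A i k * B (suc i) k - (z i * y i) * ((z (suc i) * y (suc i)) * (κ u * (κ v * (a * b))))
      ≈⟨ solve 8 (λ z z′ y y′ u v a b →
          ((z :* a) :* (:1 :+ u :* y)) :* (:- ((z′ :* b) :* (:1 :+ (:1 :- v) :* y′)))
            :- (z :* y) :* ((z′ :* y′) :* (u :* (v :* (a :* b)))) :=
          (:- ((z :* z′) :* (a :* b))) :* (:1 :+ ((:1 :- v) :* y′ :+ u :* (y :+ y′ :* y))))
          refl (z i) (z (suc i)) (y i) (y (suc i)) (κ u) (κ v) a b ⟩
    C i k ∎
    where
    a = X i ^ k
    b = X (suc i) ^ k

  monomial : ∀ {l} → ℕ → Vec ℕ l → Carrier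
  monomial i []       = 1#
  monomial i (r ∷ rs) = X i ^ r * monomial (suc i) rs

  rowSum : ∀ {l} → ℕ → ℕ → Vec ℕ (suc l) → Carrier
  rowSum p i (k ∷ [])           = 1#
  rowSum p i (k ∷ ks@(k′ ∷ _)) =
    sum (suc D) (λ r → κ ([ p ≤? r ] R.* seg k k′ r) * (X i ^ r * rowSum (suc r) (suc i) ks))

  κ[true] : ∀ {P : Set} (d : Dec P) {x} → P → κ ([ d ] R.* x) ≈ κ x
  κ[true] d pr = κ-cong (R.trans (R.*-congʳ (if-true d pr)) (R.*-identityˡ _))

  κ[false] : ∀ {P : Set} (d : Dec P) {x} → ¬ P → κ ([ d ] R.* x) ≈ 0#
  κ[false] d ¬pr = trans (κ-cong (R.trans (R.*-congʳ (if-false d ¬pr)) (R.zeroˡ _))) κ-0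

  -- Entries below k have weight 0 in any case, so a bound up to k excludes nothing.
  rowSum-low : ∀ {l} {p k} → p ℕ.≤ k → ∀ i (ks : Vec ℕ l) → rowSum p i (k ∷ ks) ≈ rowSum 0 i (k ∷ ks)
  rowSum-low p≤k i [] = refl
  rowSum-low {p = p} {k} p≤k i (k′ ∷ ks) = sum-cong′ (suc D)
    {λ r → κ ([ p ≤? r ] R.* seg k k′ r) * (X i ^ r * rowSum (suc r) (suc i) (k′ ∷ ks))} (λ r → *-congʳ (same r))
    where
    same : ∀ r → κ ([ p ≤? r ] R.* seg k k′ r) ≈ κ ([ 0 ≤? r ] R.* seg k k′ r)
    same r with p ≤? r
    ... | yes p≤r = trans (κ[true] (p ≤? r) p≤r) (sym (κ[true] (0 ≤? r) z≤n))
    ... | no  p≰r = κ-cong (R.trans (R.*-congˡ below) (R.trans (R.zeroʳ _)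
                      (R.sym (R.trans (R.*-congˡ below) (R.zeroʳ _)))))
      where below = seg-below {k} {k′} {r} (ℕₚ.<-≤-trans (ℕₚ.≰⇒> p≰r) p≤k)

  -- the part of rowSum 0 in which the first upper entry equals k
  rowSum-tied : ∀ {l} → ℕ → Vec ℕ (suc l) → Carrier
  rowSum-tied i (k ∷ [])           = 0#
  rowSum-tied i (k ∷ ks@(k′ ∷ _)) = κ (seg k k′ k) * (X i ^ k * rowSum (suc k) (suc i) ks)

  rowSum-strict : ∀ {l} i k (ks : Vec ℕ l) → k ℕ.≤ D →
    rowSum (suc k) i (k ∷ ks) ≈ rowSum 0 i (k ∷ ks) - rowSum-tied i (k ∷ ks)
  rowSum-strict i k []        k≤D = sym (trans (+-congˡ -0#≈0#) (+-identityʳ _))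
  rowSum-strict i k (k′ ∷ ks) k≤D = begin
    sum (suc D) a ≈⟨ sum-cong′ (suc D) {a} {λ r → b r + - c r} split ⟩
    sum (suc D) (λ r → b r + - c r) ≈⟨ trans (sum-+ (suc D) b (λ r → - c r)) (+-congˡ (sum-neg (suc D) c)) ⟩
    sum (suc D) b - sum (suc D) c
      ≈⟨ +-congˡ (-‿cong (sum-indicator (suc D) k (s≤s k≤D) (λ r → κ (seg k k′ k) * g r))) ⟩
    sum (suc D) b - κ (seg k k′ k) * g k ∎
    where
    g a b c : ℕ → Carrier
    g r = X i ^ r * rowSum (suc r) (suc i) (k′ ∷ ks)
    a r = κ ([ suc k ≤? r ] R.* seg k k′ r) * g r
    b r = κ ([ 0 ≤? r ] R.* seg k k′ r) * g r
    c r = κ [ r ≟ k ] * (κ (seg k k′ k) * g r)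
    split : ∀ r → a r ≈ b r - c r
    split r with <-cmp r k
    ... | tri< r<k r≢k _ = begin
      a r ≈⟨ *-congʳ (κ[false] (suc k ≤? r) (ℕₚ.<⇒≯ r<k)) ⟩
      0# * g r ≈⟨ solve 2 (λ g s → :0 :* g := :0 :* g :- :0 :* s) refl (g r) (κ (seg k k′ k) * g r) ⟩
      0# * g r - 0# * (κ (seg k k′ k) * g r)
        ≈⟨ +-cong (*-congʳ (trans (κ[true] (0 ≤? r) z≤n) (trans (κ-cong (seg-below r<k)) κ-0)))
                  (-‿cong (*-congʳ (trans (κ-cong (if-false (r ≟ k) r≢k)) κ-0))) ⟨
      b r - c r ∎
    ... | tri≈ _ ≡.refl _ = begin
      a r ≈⟨ *-congʳ (κ[false] (suc k ≤? r) (<-irrefl ≡.refl)) ⟩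
      0# * g r ≈⟨ solve 2 (λ g s → :0 :* g := s :* g :- :1 :* (s :* g)) refl (g r) (κ (seg k k′ k)) ⟩
      κ (seg k k′ k) * g r - 1# * (κ (seg k k′ k) * g r)
        ≈⟨ +-cong (*-congʳ (κ[true] (0 ≤? r) z≤n))
                  (-‿cong (*-congʳ (trans (κ-cong (if-true (r ≟ k) ≡.refl)) κ-1))) ⟨
      b r - c r ∎
    ... | tri> _ r≢k k<r = begin
      a r ≈⟨ *-congʳ (κ[true] (suc k ≤? r) k<r) ⟩
      κ (seg k k′ r) * g r
        ≈⟨ solve 3 (λ g s t → t :* g := t :* g :- :0 :* (s :* g)) refl (g r) (κ (seg k k′ k)) (κ (seg k k′ r)) ⟩
      κ (seg k k′ r) * g r - 0# * (κ (seg k k′ k) * g r)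
        ≈⟨ +-cong (*-congʳ (κ[true] (0 ≤? r) z≤n))
                  (-‿cong (*-congʳ (trans (κ-cong (if-false (r ≟ k) r≢k)) κ-0))) ⟨
      b r - c r ∎

  -- The first entry r affects the rest of the row only if r = k′: for r < k′ the next entry exceeds
  -- r automatically, while for r = k′ it must not equal k′ as well. The weight of r = k′ is u,
  -- hence the subtracted term.
  rowSum-step : ∀ {l} i k k′ (ks : Vec ℕ l) → Step k k′ → k′ ℕ.≤ D →
    rowSum 0 i (k ∷ k′ ∷ ks) ≈
    (A i k′ + B i k) * rowSum 0 (suc i) (k′ ∷ ks) - κ u * (X i ^ k′ * rowSum-tied (suc i) (k′ ∷ ks))
  rowSum-step i k k′ ks s k′≤D = begin
    sum N a ≈⟨ sum-cong′ N {a} {λ r → T * b r + - c r} split ⟩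
    sum N (λ r → T * b r + - c r)
      ≈⟨ trans (sum-+ N (λ r → T * b r) (λ r → - c r)) (+-cong (sym (*-sum N T b)) (sum-neg N c)) ⟩
    T * sum N b - sum N c
      ≈⟨ +-cong (trans (*-comm _ _) (*-congʳ (segment-sum s k′≤D i)))
                (-‿cong (sum-indicator N k′ (s≤s k′≤D) (λ r → κ u * (X i ^ r * U)))) ⟩
    (A i k′ + B i k) * T - κ u * (X i ^ k′ * U) ∎
    where
    N = suc D
    T = rowSum 0 (suc i) (k′ ∷ ks)
    U = rowSum-tied (suc i) (k′ ∷ ks)
    a b c : ℕ → Carrier
    a r = κ ([ 0 ≤? r ] R.* seg k k′ r) * (X i ^ r * rowSum (suc r) (suc i) (k′ ∷ ks))
    b r = κ (seg k k′ r) * X i ^ r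
    c r = κ [ r ≟ k′ ] * (κ u * (X i ^ r * U))
    split : ∀ r → a r ≈ T * b r - c r
    split r with <-cmp r k′
    ... | tri< r<k′ r≢k′ _ = begin
      a r ≈⟨ *-cong (κ[true] (0 ≤? r) z≤n) (*-congˡ (rowSum-low r<k′ (suc i) ks)) ⟩
      κ (seg k k′ r) * (X i ^ r * T)
        ≈⟨ solve 4 (λ s x t w → s :* (x :* t) := t :* (s :* x) :- :0 :* w) refl
             (κ (seg k k′ r)) (X i ^ r) T (κ u * (X i ^ r * U)) ⟩
      T * b r - 0# * (κ u * (X i ^ r * U))
        ≈⟨ +-congˡ (-‿cong (*-congʳ (trans (κ-cong (if-false (r ≟ k′) r≢k′)) κ-0))) ⟨
      T * b r - c r ∎
    ... | tri≈ _ ≡.refl _ = begin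
      a r ≈⟨ *-cong (trans (κ[true] (0 ≤? r) z≤n) (κ-cong (seg-upper s)))
                    (*-congˡ (rowSum-strict (suc i) k′ ks k′≤D)) ⟩
      κ u * (X i ^ r * (T - U))
        ≈⟨ solve 4 (λ s x t w → s :* (x :* (t :- w)) := t :* (s :* x) :- :1 :* (s :* (x :* w))) refl
             (κ u) (X i ^ r) T U ⟩
      T * (κ u * X i ^ r) - 1# * (κ u * (X i ^ r * U))
        ≈⟨ +-cong (*-congˡ (*-congʳ (κ-cong (seg-upper s))))
                  (-‿cong (*-congʳ (trans (κ-cong (if-true (r ≟ k′) ≡.refl)) κ-1))) ⟨
      T * b r - c r ∎
    ... | tri> _ r≢k′ k′<r = begin
      a r ≈⟨ *-congʳ (trans (κ[true] (0 ≤? r) z≤n) seg≈0) ⟩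
      0# * (X i ^ r * rowSum (suc r) (suc i) (k′ ∷ ks))
        ≈⟨ solve 4 (λ s x t w → :0 :* s := t :* (:0 :* x) :- :0 :* w) refl
             (X i ^ r * rowSum (suc r) (suc i) (k′ ∷ ks)) (X i ^ r) T (κ u * (X i ^ r * U)) ⟩
      T * (0# * X i ^ r) - 0# * (κ u * (X i ^ r * U))
        ≈⟨ +-cong (*-congˡ (*-congʳ seg≈0))
                  (-‿cong (*-congʳ (trans (κ-cong (if-false (r ≟ k′) r≢k′)) κ-0))) ⟨
      T * b r - c r ∎
      where seg≈0 = trans (κ-cong (seg-above {k} {k′} {r} k′<r)) κ-0

  upper : ∀ {l} → ℕ → Vec ℕ l → Carrier
  upper i []       = 1#
  upper i (k ∷ ks) = A i k * upper (suc i) ks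

  -- Σ_s B_i ⋯ B_{s-1} A_s A_{s+1} ⋯, where s is the entry of the lower row that no upper entry is attached to.
  expansion : ∀ {l} → ℕ → Vec ℕ (suc l) → Carrier
  expansion i (k ∷ [])           = 1#
  expansion i (k ∷ ks@(k′ ∷ _)) = upper i ks + B i k * expansion (suc i) ks

  -- L will be f ↦ CT of f times the Q-product and the alternant. `Early i g` stands for g free of
  -- the variables from i on, `Late i f` for f free of the variables before i. Both are abstract
  -- because only invariance under exchanges within the missing variables enters: around a collision
  -- at i, i+1 the remaining factors are then symmetric.
  module Expansion
    (m : ℕ) (L : Carrier → R.Carrier)
    (L-cong : ∀ {f g} → f ≈ g → L f R.≈ L g)
    (L-+ : ∀ f g → L (f + g) R.≈ L f R.+ L g)
    (L-κ : ∀ c f → L (κ c * f) R.≈ c R.* L f)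
    (Early Late : ℕ → Carrier → Set)
    (Early-A : ∀ {i g} k → Early i g → Early (suc i) (g * A i k))
    (Early-B : ∀ {i g} k → Early i g → Early (suc i) (g * B i k))
    (Late-cong : ∀ {i f g} → f ≈ g → Late i f → Late i g)
    (Late-κ : ∀ i c → Late i (κ c))
    (Late-+ : ∀ {i f g} → Late i f → Late i g → Late i (f + g))
    (Late-* : ∀ {i f g} → Late i f → Late i g → Late i (f * g))
    (Late-X : ∀ i → Late i (X i))
    (Late-suc : ∀ {i f} → Late (suc i) f → Late i f)
    (L-collision : ∀ i k {g f} → suc i < m → Early i g → Late (2 ℕ.+ i) f → L (g * (C i k * f)) R.≈ R.0#)
    (L-triple : Unital → ∀ i k {g f} → 2 ℕ.+ i < m → Early i g → Late (3 ℕ.+ i) f →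
      L (g * ((X i ^ k * (X (suc i) ^ k * X (2 ℕ.+ i) ^ k)) * f)) R.≈ R.0#)
    where

    L-0 : L 0# R.≈ R.0#
    L-0 = R.trans (L-cong (sym (trans (*-congʳ κ-0) (zeroˡ 0#)))) (R.trans (L-κ R.0# 0#) (R.zeroˡ _))

    L-sum : ∀ n (f : ℕ → Carrier) → L (sum n f) R.≈ R.sum n (L ∘ f)
    L-sum zero    f = L-0
    L-sum (suc n) f = R.trans (L-+ _ _) (R.+-congˡ (L-sum n (f ∘ suc)))

    L-rows : ∀ {l} p i (ks : Vec ℕ (suc l)) (g : Carrier) →
      rows l (λ r → rowWeight p r ks R.* L (g * monomial i r)) R.≈ L (g * rowSum p i ks)
    L-rows p i (k ∷ [])             g = R.*-identityˡ _
    L-rows {suc l} p i (k ∷ ks@(k′ ∷ _)) g = R.trans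
      (R.sum-cong′ (suc D) {λ r → rows l (λ rs → (W r R.* rowWeight (suc r) rs ks)
          R.* L (g * (X i ^ r * monomial (suc i) rs)))} row)
      (R.sym (R.trans (L-cong (*-sum (suc D) g (λ r → κ (W r) * (X i ^ r * rowSum (suc r) (suc i) ks))))
                      (L-sum (suc D) (λ r → g * (κ (W r) * (X i ^ r * rowSum (suc r) (suc i) ks))))))
      where
      W : ℕ → R.Carrier
      W r = [ p ≤? r ] R.* seg k k′ r
      row : ∀ r → rows l (λ rs → (W r R.* rowWeight (suc r) rs ks) R.* L (g * (X i ^ r * monomial (suc i) rs)))
        R.≈ L (g * (κ (W r) * (X i ^ r * rowSum (suc r) (suc i) ks)))
      row r = R.trans
        (R.trans (rows-cong l (λ rs → R.trans (R.*-assoc _ _ _)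
                   (R.*-congˡ (R.*-congˡ (L-cong (sym (*-assoc g (X i ^ r) (monomial (suc i) rs))))))))
          (R.sym (*-rows l (W r) (λ rs → rowWeight (suc r) rs ks R.* L ((g * X i ^ r) * monomial (suc i) rs)))))
        (R.trans (R.*-congˡ (L-rows (suc r) (suc i) ks (g * X i ^ r)))
          (R.trans (R.sym (L-κ (W r) _)) (L-cong
            (solve 4 (λ w g x t → w :* ((g :* x) :* t) := g :* (w :* (x :* t))) refl
              (κ (W r)) g (X i ^ r) (rowSum (suc r) (suc i) ks)))))

    Late-^ : ∀ {i f} k → Late i f → Late i (f ^ k)
    Late-^ zero    h = Late-cong κ-1 (Late-κ _ R.1#)
    Late-^ (suc k) h = Late-* h (Late-^ k h)

    Late-sum : ∀ {i} n {f : ℕ → Carrier} → (∀ r → Late i (f r)) → Late i (sum n f)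
    Late-sum zero    h = Late-cong κ-0 (Late-κ _ R.0#)
    Late-sum (suc n) h = Late-+ (h 0) (Late-sum n (h ∘ suc))

    Late-rowSum : ∀ {l} p i (ks : Vec ℕ (suc l)) → Late i (rowSum p i ks)
    Late-rowSum p i (k ∷ [])           = Late-cong κ-1 (Late-κ _ R.1#)
    Late-rowSum p i (k ∷ ks@(k′ ∷ _)) = Late-sum (suc D)
      {λ r → κ ([ p ≤? r ] R.* seg k k′ r) * (X i ^ r * rowSum (suc r) (suc i) ks)} (λ r →
      Late-* (Late-κ i _) (Late-* (Late-^ r (Late-X i)) (Late-suc (Late-rowSum (suc r) (suc i) ks))))

    -- The share of `rowSum-step` in which upper entry i is attached to its right neighbour k,
    -- together with the correction for a tie at k.
    residue : ∀ {l} → ℕ → Vec ℕ (suc l) → Carrier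
    residue i ks@(k ∷ _) = A i k * rowSum 0 (suc i) ks - κ u * (X i ^ k * rowSum-tied (suc i) ks)

    rowSum-residue : ∀ {l} i k k′ (ks : Vec ℕ l) → Step k k′ → k′ ℕ.≤ D →
      rowSum 0 i (k ∷ k′ ∷ ks) ≈ residue i (k′ ∷ ks) + B i k * rowSum 0 (suc i) (k′ ∷ ks)
    rowSum-residue i k k′ ks s k′≤D = trans (rowSum-step i k k′ ks s k′≤D)
      (solve 4 (λ a b t w → (a :+ b) :* t :- w := (a :* t :- w) :+ b :* t) refl _ _ _ _)

    -- The next upper entry is attached either to the right, which gives another residue, or to the
    -- left, hence also to k. The product A B of a double attachment, less the tie with weight u v,
    -- is C. Here w stands for what strictness removes from the entries after these two.
    residue-step : ∀ {l} i k k′ (ks : Vec ℕ l) (w : Carrier) → Step k k′ → k′ ℕ.≤ D →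
      rowSum (suc k) (2 ℕ.+ i) (k′ ∷ ks) ≈ rowSum 0 (2 ℕ.+ i) (k′ ∷ ks) - w →
      residue i (k ∷ k′ ∷ ks) ≈
      (A i k * residue (suc i) (k′ ∷ ks) + C i k * rowSum 0 (2 ℕ.+ i) (k′ ∷ ks))
        + (κ u * κ v) * ((X i ^ k * X (suc i) ^ k) * w)
    residue-step i k k′ ks w s k′≤D eq = begin
      A i k * rowSum 0 (suc i) (k ∷ k′ ∷ ks) - κ u * (x * (κ (seg k k′ k) * (x′ * rowSum (suc k) (2 ℕ.+ i) (k′ ∷ ks))))
        ≈⟨ +-cong (*-congˡ (rowSum-residue (suc i) k k′ ks s k′≤D))
             (-‿cong (*-congˡ (*-congˡ (*-cong (κ-cong (seg-lower s)) (*-congˡ eq))))) ⟩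
      A i k * (Y + B (suc i) k * T) - κ u * (x * (κ v * (x′ * (T - w))))
        ≈⟨ solve 9 (λ a y b t u x v x′ w →
             a :* (y :+ b :* t) :- u :* (x :* (v :* (x′ :* (t :- w)))) :=
             (a :* y :+ (a :* b :- u :* (v :* (x :* x′))) :* t) :+ (u :* v) :* ((x :* x′) :* w))
             refl (A i k) Y (B (suc i) k) T (κ u) x (κ v) x′ w ⟩
      (A i k * Y + (A i k * B (suc i) k - κ u * (κ v * (x * x′))) * T) + (κ u * κ v) * ((x * x′) * w)
        ≈⟨ +-congʳ (+-congˡ (*-congʳ (A*B-collision i k))) ⟩
      (A i k * Y + C i k * T) + (κ u * κ v) * ((x * x′) * w) ∎
      where
      x = X i ^ k
      x′ = X (suc i) ^ k
      Y = residue (suc i) (k′ ∷ ks)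
      T = rowSum 0 (2 ℕ.+ i) (k′ ∷ ks)

    -- Three consecutive upper entries equal the same k, so the monomial is symmetric in three
    -- variables and `L-triple` applies; if there is no third entry, the tied part is 0.
    L-tied : ∀ {l} i k (ks : Vec ℕ l) {g} → Unital → 2 ℕ.+ (i ℕ.+ l) ℕ.≤ m → Early i g →
      L (g * ((κ u * κ v) * ((X i ^ k * X (suc i) ^ k) * rowSum-tied (2 ℕ.+ i) (k ∷ ks)))) R.≈ R.0#
    L-tied i k [] {g} _ _ _ = R.trans
      (L-cong (solve 3 (λ g a b → g :* (a :* (b :* :0)) := :0) refl g _ _)) L-0
    L-tied {suc l} i k ks@(k′ ∷ _) {g} unital l≤m early = R.trans
      (L-cong (solve 8 (λ g u v x x′ x″ s t →
        g :* ((u :* v) :* ((x :* x′) :* (s :* (x″ :* t)))) :=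
        g :* ((x :* (x′ :* x″)) :* ((u :* v) :* (s :* t)))) refl
        g (κ u) (κ v) (X i ^ k) (X (suc i) ^ k) (X (2 ℕ.+ i) ^ k) (κ (seg k k′ k)) (rowSum (suc k) (3 ℕ.+ i) ks)))
      (L-triple unital i k
        (≤-trans (s≤s (s≤s (≡.subst (suc i ℕ.≤_) (≡.sym (+-suc i l)) (s≤s (ℕₚ.m≤m+n i l))))) l≤m) early
        (Late-* (Late-* (Late-κ _ u) (Late-κ _ v)) (Late-* (Late-κ _ _) (Late-rowSum (suc k) (3 ℕ.+ i) ks))))

    split : ∀ g {a b c} → L (g * ((a + b) + c)) R.≈ (L (g * a) R.+ L (g * b)) R.+ L (g * c)
    split g {a} {b} {c} = R.trans (L-cong (trans (distribˡ _ _ _) (+-congʳ (distribˡ _ _ _))))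
      (R.trans (L-+ _ _) (R.+-congʳ (L-+ _ _)))

    -- Once an entry is attached to the right, all later ones are too: the first later attachment to
    -- the left would collide with the right attachment just before it and carry the factor C, which
    -- L kills.
    residue≈upper : ∀ {l} i k (ks : Vec ℕ l) {g} → i ℕ.+ suc l ℕ.≤ m → Early i g → Chain (k ∷ ks) →
      L (g * residue i (k ∷ ks)) R.≈ L (g * upper i (k ∷ ks))
    residue≈upper i k [] {g} _ _ _ = L-cong
      (solve 4 (λ g a u x → g :* (a :* :1 :- u :* (x :* :0)) := g :* (a :* :1)) refl g _ _ _)
    residue≈upper {suc l} i k ks@(k′ ∷ ks′) {g} l≤m early (s , chain) =
      R.trans (L-cong (*-congˡ (residue-step i k k′ ks′ (proj₁ tie) s k′≤D (proj₁ (proj₂ tie)))))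
        (R.trans (split g) (R.trans (R.+-cong (R.+-cong main (L-collision i k (ℕₚ.m+n≤o⇒m≤o (2 ℕ.+ i) l≤m′) early
            (Late-rowSum 0 (2 ℕ.+ i) ks))) (proj₂ (proj₂ tie)))
          (R.trans (R.+-identityʳ _) (R.+-identityʳ _))))
      where
      k′≤D = chain⇒≤ k′ ks′ chain
      l≤m′ : 2 ℕ.+ (i ℕ.+ l) ℕ.≤ m
      l≤m′ = ≡.subst (ℕ._≤ m) (≡.trans (+-suc i (suc l)) (≡.cong suc (+-suc i l))) l≤m
      -- For k < k′ the bound suc k excludes nothing, so w = 0. For k = k′, which presupposes u = v
      -- = 1, w is the part whose next entry is again k, and `L-tied` removes it.
      tie : ∃[ w ] (rowSum (suc k) (2 ℕ.+ i) (k′ ∷ ks′) ≈ rowSum 0 (2 ℕ.+ i) (k′ ∷ ks′) - w)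
            × (L (g * ((κ u * κ v) * ((X i ^ k * X (suc i) ^ k) * w))) R.≈ R.0#)
      tie = tie′ s
        where
        tie′ : Step k k′ → _
        tie′ (inj₁ k<k′) = 0#
          , trans (rowSum-low k<k′ (2 ℕ.+ i) ks′) (sym (trans (+-congˡ -0#≈0#) (+-identityʳ _)))
          , R.trans (L-cong (solve 3 (λ g a b → g :* (a :* (b :* :0)) := :0) refl g _ _)) L-0
        tie′ (inj₂ (≡.refl , unital)) = rowSum-tied (2 ℕ.+ i) (k′ ∷ ks′)
          , rowSum-strict (2 ℕ.+ i) k′ ks′ k′≤D
          , L-tied i k′ ks′ unital l≤m′ early
      main : L (g * (A i k * residue (suc i) (k′ ∷ ks′))) R.≈ L (g * (A i k * upper (suc i) (k′ ∷ ks′)))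
      main = R.trans (L-cong (sym (*-assoc _ _ _))) (R.trans
        (residue≈upper (suc i) k′ ks′ (≡.subst (ℕ._≤ m) (+-suc i (suc l)) l≤m) (Early-A k early) chain)
        (L-cong (*-assoc _ _ _)))

    -- A left attachment contributes B and leaves the same problem one place further on; the first
    -- right attachment settles the rest of the row by `residue≈upper`.
    rowSum≈expansion : ∀ {l} i (ks : Vec ℕ (suc l)) {g} → i ℕ.+ l ℕ.≤ m → Early i g → Chain ks →
      L (g * rowSum 0 i ks) R.≈ L (g * expansion i ks)
    rowSum≈expansion i (k ∷ [])           _   _     _           = R.refl
    rowSum≈expansion {suc l} i (k ∷ ks@(k′ ∷ ks′)) {g} l≤m early (s , chain) =
      R.trans (L-cong (trans (*-congˡ (rowSum-residue i k k′ ks′ s (chain⇒≤ k′ ks′ chain))) (distribˡ _ _ _)))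
        (R.trans (L-+ _ _) (R.trans (R.+-cong (residue≈upper i k′ ks′ l≤m early chain) tail)
          (R.sym (R.trans (L-cong (distribˡ _ _ _)) (L-+ _ _)))))
      where
      tail : L (g * (B i k * rowSum 0 (suc i) ks)) R.≈ L (g * (B i k * expansion (suc i) ks))
      tail = R.trans (L-cong (sym (*-assoc _ _ _))) (R.trans
        (rowSum≈expansion (suc i) ks (≡.subst (ℕ._≤ m) (+-suc i l) l≤m) (Early-B k early) chain)
        (L-cong (*-assoc _ _ _)))

  upper-prod : ∀ {l} i (ks : Vec ℕ l) → upper i ks ≈ prod l (λ j → A (j ℕ.+ i) (at ks j))
  upper-prod i []               = refl
  upper-prod {suc l} i (k ∷ ks) = *-congˡ (trans (upper-prod (suc i) ks)
    (prod-cong′ l (λ j → reflexive (≡.cong (λ r → A r (at ks j)) (+-suc j i)))))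

  monomial-prod : ∀ {l} i (ks : Vec ℕ l) → monomial i ks ≈ prod l (λ j → X (j ℕ.+ i) ^ at ks j)
  monomial-prod i []               = refl
  monomial-prod {suc l} i (k ∷ ks) = *-congˡ (trans (monomial-prod (suc i) ks)
    (prod-cong′ l (λ j → reflexive (≡.cong (λ r → X r ^ at ks j) (+-suc j i)))))

  gapTerm : ∀ {l} → ℕ → Vec ℕ (suc l) → ℕ → ℕ → Carrier
  gapTerm i ks s j = (z (j ℕ.+ i) * X (j ℕ.+ i) ^ at ks (punch s j)) * side s j (p (j ℕ.+ i)) (q (j ℕ.+ i))

  expansion-sum : ∀ {l} i (ks : Vec ℕ (suc l)) →
    expansion i ks ≈ sum (suc l) (λ s → sgn s * prod l (gapTerm i ks s))
  expansion-sum i (k ∷ []) = sym (trans (+-identityʳ _) (*-identityˡ _))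
  expansion-sum {suc l} i (k ∷ ks@(_ ∷ _)) = +-cong
    (trans (upper-prod i ks) (sym (*-identityˡ _)))
    (begin
      B i k * expansion (suc i) ks                                  ≈⟨ *-congˡ (expansion-sum (suc i) ks) ⟩
      B i k * sum (suc l) (λ s → sgn s * t s)                       ≈⟨ *-sum (suc l) (B i k) (λ s → sgn s * t s) ⟩
      sum (suc l) (λ s → B i k * (sgn s * t s))
        ≈⟨ sum-cong′ (suc l) {λ s → B i k * (sgn s * t s)} {λ s → - sgn s * (((z i * X i ^ k) * p i) * t′ s)}
             (λ s → trans (*-congˡ (*-congˡ (shift s)))
               (solve 3 (λ b e t → (:- b) :* (e :* t) := (:- e) :* (b :* t)) refl ((z i * X i ^ k) * p i) (sgn s) (t′ s))) ⟩
      sum (suc l) (λ s → - sgn s * (((z i * X i ^ k) * p i) * t′ s)) ∎)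
    where
    t t′ : ℕ → Carrier
    t s = prod l (gapTerm (suc i) ks s)
    t′ s = prod l (gapTerm i (k ∷ ks) (suc s) ∘ suc)
    shift : ∀ s → t s ≈ t′ s
    shift s = prod-cong′ l (λ j → reflexive (≡.cong
      (λ r → (z r * X r ^ at ks (punch s j)) * side s j (p r) (q r)) (+-suc j i)))

-- Laurent polynomials as a group ring

infixl 6 _⊕_
_⊕_ : ∀ {n} → Vec ℤ n → Vec ℤ n → Vec ℤ n
_⊕_ = zipWith ℤ._+_

0⃗ : ∀ {n} → Vec ℤ n
0⃗ = replicate _ ℤ.0ℤ

negVec : ∀ {n} → Vec ℤ n → Vec ℤ n
negVec = Vec.map (λ x → ℤ.- x)

⊕-assoc : ∀ {n} (e f g : Vec ℤ n) → (e ⊕ f) ⊕ g ≡ e ⊕ (f ⊕ g)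
⊕-assoc = Vecₚ.zipWith-assoc ℤₚ.+-assoc

⊕-comm : ∀ {n} (e f : Vec ℤ n) → e ⊕ f ≡ f ⊕ e
⊕-comm = Vecₚ.zipWith-comm ℤₚ.+-comm

⊕-identityˡ : ∀ {n} (e : Vec ℤ n) → 0⃗ ⊕ e ≡ e
⊕-identityˡ = Vecₚ.zipWith-identityˡ ℤₚ.+-identityˡ

makeHom : (R S : CommutativeRing 0ℓ 0ℓ) (f : CommutativeRing.Carrier R → CommutativeRing.Carrier S) →
  (let module R = CommutativeRing R; module S = CommutativeRing S) →
  (∀ {x y} → x R.≈ y → f x S.≈ f y) →
  (∀ x y → f (x R.+ y) S.≈ f x S.+ f y) →
  (∀ x y → f (x R.* y) S.≈ f x S.* f y) →
  f R.0# S.≈ S.0# → f R.1# S.≈ S.1# → (∀ x → f (R.- x) S.≈ S.- f x) → IsHom R S f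
makeHom R S f f-cong f-+ f-* f-0 f-1 f-neg = record
  { isSemiringHomomorphism = record
    { isNearSemiringHomomorphism = record
      { +-isMonoidHomomorphism = record
        { isMagmaHomomorphism = record
          { isRelHomomorphism = record { cong = f-cong } ; homo = f-+ }
        ; ε-homo = f-0 }
      ; *-homo = f-* }
    ; 1#-homo = f-1 }
  ; -‿homo = f-neg }

module Laurent (R : CommutativeRing 0ℓ 0ℓ) where
  private module R = RingKit R
  open R using (Carrier; _≈_; _+_; _*_; -_; 0#; 1#; +-cong; +-congˡ; +-congʳ; *-cong; *-congˡ; *-congʳ;
    refl; sym; trans; solve; _:=_; _:+_; _:*_; :-_; :0; :1)
  open import Relation.Binary.Reasoning.Setoid R.setoid

  -- The integral of φ against P, read as a finitely supported measure on exponent vectors. The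
  -- constant term is the case φ = δ, and multiplication of Laurent polynomials is convolution of
  -- measures.
  eval : ∀ {n} → LPoly R n → (Vec ℤ n → Carrier) → Carrier
  eval []            φ = 0#
  eval ((c , e) ∷ P) φ = c * φ e + eval P φ

  eval-cong : ∀ {n} (P : LPoly R n) {φ ψ : Vec ℤ n → Carrier} → (∀ e → φ e ≈ ψ e) → eval P φ ≈ eval P ψ
  eval-cong []            eq = refl
  eval-cong ((c , e) ∷ P) eq = +-cong (*-congˡ (eq e)) (eval-cong P eq)

  eval-+ : ∀ {n} (P : LPoly R n) (φ ψ : Vec ℤ n → Carrier) →
    eval P (λ e → φ e + ψ e) ≈ eval P φ + eval P ψ
  eval-+ []            φ ψ = sym (R.+-identityʳ 0#)
  eval-+ ((c , e) ∷ P) φ ψ = trans (+-congˡ (eval-+ P φ ψ))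
    (solve 5 (λ c a b x y → c :* (a :+ b) :+ (x :+ y) := (c :* a :+ x) :+ (c :* b :+ y)) refl _ _ _ _ _)

  eval-* : ∀ {n} (P : LPoly R n) c (φ : Vec ℤ n → Carrier) → eval P (λ e → c * φ e) ≈ c * eval P φ
  eval-* []            c φ = sym (R.zeroʳ c)
  eval-* ((d , e) ∷ P) c φ = trans (+-congˡ (eval-* P c φ))
    (solve 4 (λ c d a x → d :* (c :* a) :+ c :* x := c :* (d :* a :+ x)) refl _ _ _ _)

  eval-0 : ∀ {n} (P : LPoly R n) → eval P (λ _ → 0#) ≈ 0#
  eval-0 []            = refl
  eval-0 ((c , e) ∷ P) = trans (+-cong (R.zeroʳ c) (eval-0 P)) (R.+-identityʳ 0#)

  -- Fubini for finite sums; with `⊕-comm` it makes the convolution commutative.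
  eval-comm : ∀ {n m} (P : LPoly R n) (Q : LPoly R m) (φ : Vec ℤ n → Vec ℤ m → Carrier) →
    eval P (λ e → eval Q (φ e)) ≈ eval Q (λ f → eval P (λ e → φ e f))
  eval-comm []            Q φ = sym (eval-0 Q)
  eval-comm ((c , e) ∷ P) Q φ = begin
    c * eval Q (φ e) + eval P (λ e → eval Q (φ e))
      ≈⟨ +-cong (sym (eval-* Q c (φ e))) (eval-comm P Q φ) ⟩
    eval Q (λ f → c * φ e f) + eval Q (λ f → eval P (λ e → φ e f))
      ≈⟨ eval-+ Q _ _ ⟨
    eval Q (λ f → c * φ e f + eval P (λ e → φ e f)) ∎

  eval-++ : ∀ {n} (P Q : LPoly R n) φ → eval (P ++ Q) φ ≈ eval P φ + eval Q φ
  eval-++ []            Q φ = sym (R.+-identityˡ _)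
  eval-++ ((c , e) ∷ P) Q φ = trans (+-congˡ (eval-++ P Q φ)) (sym (R.+-assoc _ _ _))

  eval-map : ∀ {n m} (g : Carrier × Vec ℤ n → Carrier × Vec ℤ m) (c : Carrier) (θ : Vec ℤ n → Vec ℤ m) →
    (∀ d f → g (d , f) ≡ (c * d , θ f)) → ∀ (Q : LPoly R n) φ → eval (map g Q) φ ≈ c * eval Q (φ ∘ θ)
  eval-map g c θ eq []            φ = sym (R.zeroʳ c)
  eval-map g c θ eq ((d , f) ∷ Q) φ rewrite eq d f = trans (+-congˡ (eval-map g c θ eq Q φ))
    (solve 4 (λ c d a x → (c :* d) :* a :+ c :* x := c :* (d :* a :+ x)) refl _ _ _ _)

  eval-⊗ : ∀ {n} (P Q : LPoly R n) φ → eval (_⊗_ R P Q) φ ≈ eval P (λ e → eval Q (λ f → φ (e ⊕ f)))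
  eval-⊗ []            Q φ = refl
  eval-⊗ ((c , e) ∷ P) Q φ = trans (eval-++ (map (λ t → c * proj₁ t , e ⊕ proj₂ t) Q) (_⊗_ R P Q) φ)
    (+-cong (eval-map _ c (e ⊕_) (λ _ _ → ≡.refl) Q φ) (eval-⊗ P Q φ))

  negate : ∀ {n} → LPoly R n → LPoly R n
  negate = map (λ { (c , e) → (- c , e) })

  eval-negate : ∀ {n} (P : LPoly R n) φ → eval (negate P) φ ≈ - eval P φ
  eval-negate []            φ = sym R.-0#≈0#
  eval-negate ((c , e) ∷ P) φ = trans (+-congˡ (eval-negate P φ))
    (solve 3 (λ c a x → (:- c) :* a :+ :- x := :- (c :* a :+ x)) refl _ _ _)

  eval-single : ∀ {n} c (e : Vec ℤ n) φ → eval ((c , e) ∷ []) φ ≈ c * φ e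
  eval-single c e φ = R.+-identityʳ _

  -- Formal sums are compared by their values under all weightings of the exponent vectors.
  infix 4 _≋_
  record _≋_ {n} (P Q : LPoly R n) : Set where
    constructor evals
    field eval-≈ : ∀ φ → eval P φ ≈ eval Q φ
  open _≋_ public

  ⊗-cong : ∀ {n} {P P′ Q Q′ : LPoly R n} → P ≋ P′ → Q ≋ Q′ → _⊗_ R P Q ≋ _⊗_ R P′ Q′
  ⊗-cong {P = P} {P′} {Q} {Q′} p q .eval-≈ φ = begin
    eval (_⊗_ R P Q) φ                        ≈⟨ eval-⊗ P Q φ ⟩
    eval P (λ e → eval Q (λ f → φ (e ⊕ f)))   ≈⟨ eval-cong P (λ e → eval-≈ q _) ⟩
    eval P (λ e → eval Q′ (λ f → φ (e ⊕ f)))  ≈⟨ eval-≈ p _ ⟩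
    eval P′ (λ e → eval Q′ (λ f → φ (e ⊕ f))) ≈⟨ eval-⊗ P′ Q′ φ ⟨
    eval (_⊗_ R P′ Q′) φ                      ∎

  ⊗-assoc : ∀ {n} (P Q T : LPoly R n) → _⊗_ R (_⊗_ R P Q) T ≋ _⊗_ R P (_⊗_ R Q T)
  ⊗-assoc P Q T .eval-≈ φ = begin
    eval (_⊗_ R (_⊗_ R P Q) T) φ ≈⟨ trans (eval-⊗ (_⊗_ R P Q) T φ) (eval-⊗ P Q _) ⟩
    eval P (λ e → eval Q (λ f → eval T (λ g → φ ((e ⊕ f) ⊕ g))))
      ≈⟨ eval-cong P (λ e → eval-cong Q (λ f → eval-cong T (λ g → R.reflexive (≡.cong φ (⊕-assoc e f g))))) ⟩
    eval P (λ e → eval Q (λ f → eval T (λ g → φ (e ⊕ (f ⊕ g)))))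
      ≈⟨ trans (eval-⊗ P (_⊗_ R Q T) φ) (eval-cong P (λ e → eval-⊗ Q T _)) ⟨
    eval (_⊗_ R P (_⊗_ R Q T)) φ ∎

  ⊗-comm : ∀ {n} (P Q : LPoly R n) → _⊗_ R P Q ≋ _⊗_ R Q P
  ⊗-comm P Q .eval-≈ φ = begin
    eval (_⊗_ R P Q) φ                      ≈⟨ eval-⊗ P Q φ ⟩
    eval P (λ e → eval Q (λ f → φ (e ⊕ f))) ≈⟨ eval-comm P Q _ ⟩
    eval Q (λ f → eval P (λ e → φ (e ⊕ f)))
      ≈⟨ eval-cong Q (λ f → eval-cong P (λ e → R.reflexive (≡.cong φ (⊕-comm e f)))) ⟩
    eval Q (λ f → eval P (λ e → φ (f ⊕ e))) ≈⟨ eval-⊗ Q P φ ⟨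
    eval (_⊗_ R Q P) φ                      ∎

  ⊗-identityˡ : ∀ {n} (P : LPoly R n) → _⊗_ R (one R) P ≋ P
  ⊗-identityˡ P .eval-≈ φ = begin
    eval (_⊗_ R (one R) P) φ                  ≈⟨ trans (eval-⊗ (one R) P φ) (eval-single 1# 0⃗ (λ e → eval P (λ f → φ (e ⊕ f)))) ⟩
    1# * eval P (λ f → φ (0⃗ ⊕ f))            ≈⟨ R.*-identityˡ _ ⟩
    eval P (λ f → φ (0⃗ ⊕ f))
      ≈⟨ eval-cong P (λ f → R.reflexive (≡.cong φ (⊕-identityˡ f))) ⟩
    eval P φ                                  ∎

  ⊗-distribˡ : ∀ {n} (P Q T : LPoly R n) → _⊗_ R P (Q ++ T) ≋ _⊗_ R P Q ++ _⊗_ R P T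
  ⊗-distribˡ P Q T .eval-≈ φ = begin
    eval (_⊗_ R P (Q ++ T)) φ ≈⟨ trans (eval-⊗ P (Q ++ T) φ) (eval-cong P (λ e → eval-++ Q T _)) ⟩
    eval P (λ e → eval Q (λ f → φ (e ⊕ f)) + eval T (λ f → φ (e ⊕ f))) ≈⟨ eval-+ P _ _ ⟩
    _ + _ ≈⟨ trans (eval-++ (_⊗_ R P Q) (_⊗_ R P T) φ) (+-cong (eval-⊗ P Q φ) (eval-⊗ P T φ)) ⟨
    eval (_⊗_ R P Q ++ _⊗_ R P T) φ ∎

  ring : ℕ → CommutativeRing 0ℓ 0ℓ
  ring n = record
    { Carrier = LPoly R n
    ; _≈_ = _≋_
    ; _+_ = _++_
    ; _*_ = _⊗_ R
    ; -_ = negate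
    ; 0# = []
    ; 1# = one R
    ; isCommutativeRing = record
      { isRing = record
        { +-isAbelianGroup = record
          { isGroup = record
            { isMonoid = record
              { isSemigroup = record
                { isMagma = record
                  { isEquivalence = record
                    { refl = evals (λ φ → refl)
                    ; sym = λ p → evals (λ φ → sym (eval-≈ p φ))
                    ; trans = λ p q → evals (λ φ → trans (eval-≈ p φ) (eval-≈ q φ)) }
                  ; ∙-cong = λ {P} {P′} {Q} {Q′} p q → evals (λ φ → trans (eval-++ P Q φ)
                      (trans (+-cong (eval-≈ p φ) (eval-≈ q φ)) (sym (eval-++ P′ Q′ φ)))) }
                ; assoc = λ P Q T → evals (λ φ → trans (trans (eval-++ (P ++ Q) T φ) (+-congʳ (eval-++ P Q φ)))
                    (trans (R.+-assoc _ _ _) (sym (trans (eval-++ P (Q ++ T) φ) (+-congˡ (eval-++ Q T φ)))))) }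
              ; identity = (λ P → evals (λ φ → refl))
                         , (λ P → evals (λ φ → trans (eval-++ P [] φ) (R.+-identityʳ _))) }
            ; inverse = (λ P → evals (λ φ → trans (eval-++ (negate P) P φ)
                            (trans (+-congʳ (eval-negate P φ)) (R.-‿inverseˡ _))))
                      , (λ P → evals (λ φ → trans (eval-++ P (negate P) φ)
                            (trans (+-congˡ (eval-negate P φ)) (R.-‿inverseʳ _))))
            ; ⁻¹-cong = λ {P} {Q} p → evals (λ φ → trans (eval-negate P φ)
                            (trans (R.-‿cong (eval-≈ p φ)) (sym (eval-negate Q φ)))) }
          ; comm = λ P Q → evals (λ φ → trans (eval-++ P Q φ) (trans (R.+-comm _ _) (sym (eval-++ Q P φ)))) }
        ; *-cong = ⊗-cong
        ; *-assoc = ⊗-assoc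
        ; *-identity = ⊗-identityˡ
                     , (λ P → evals (λ φ → trans (eval-≈ (⊗-comm P (one R)) φ) (eval-≈ (⊗-identityˡ P) φ)))
        ; distrib = ⊗-distribˡ
                  , (λ P Q T → evals (λ φ → trans (eval-≈ (⊗-comm (Q ++ T) P) φ) (trans (eval-≈ (⊗-distribˡ P Q T) φ)
                      (trans (eval-++ (_⊗_ R P Q) (_⊗_ R P T) φ) (trans
                        (+-cong (eval-≈ (⊗-comm P Q) φ) (eval-≈ (⊗-comm P T) φ))
                        (sym (eval-++ (_⊗_ R Q P) (_⊗_ R T P) φ))))))) }
      ; *-comm = ⊗-comm } }

  κ : ∀ {n} → Carrier → LPoly R n
  κ c = (c , 0⃗) ∷ []

  mono : ∀ {n} → Vec ℤ n → LPoly R n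
  mono e = (1# , e) ∷ []

  single-⊗ : ∀ {n} c (e : Vec ℤ n) P φ →
    eval (_⊗_ R ((c , e) ∷ []) P) φ ≈ c * eval P (λ f → φ (e ⊕ f))
  single-⊗ c e P φ = trans (eval-⊗ ((c , e) ∷ []) P φ) (R.+-identityʳ _)

  κ-⊗ : ∀ {n} c (P : LPoly R n) φ → eval (_⊗_ R (κ c) P) φ ≈ c * eval P φ
  κ-⊗ c P φ = trans (single-⊗ c 0⃗ P φ)
    (*-congˡ (eval-cong P (λ f → R.reflexive (≡.cong φ (⊕-identityˡ f)))))

  mono-⊗ : ∀ {n} (e : Vec ℤ n) P φ → eval (_⊗_ R (mono e) P) φ ≈ eval P (λ f → φ (e ⊕ f))
  mono-⊗ e P φ = trans (single-⊗ 1# e P φ) (R.*-identityˡ _)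

  κ-hom : ∀ n → IsHom R (ring n) κ
  κ-hom n = makeHom R (ring n) κ
    (λ eq → evals (λ φ → +-congʳ (*-congʳ eq)))
    (λ x y → evals (λ φ → solve 3 (λ x y a → (x :+ y) :* a :+ :0 := x :* a :+ (y :* a :+ :0)) refl x y (φ 0⃗)))
    (λ x y → evals (λ φ → trans
      (solve 3 (λ x y a → (x :* y) :* a :+ :0 := x :* (y :* a :+ :0)) refl x y (φ 0⃗))
      (sym (κ-⊗ x (κ y) φ))))
    (evals (λ φ → trans (R.+-identityʳ _) (R.zeroˡ _)))
    (evals (λ φ → refl))
    (λ x → evals (λ φ → refl))

  mono-cong : ∀ {n} {e f : Vec ℤ n} → e ≡ f → mono e ≋ mono f
  mono-cong ≡.refl = evals (λ φ → refl)

  mono-⊕ : ∀ {n} (e f : Vec ℤ n) → mono (e ⊕ f) ≋ _⊗_ R (mono e) (mono f)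
  mono-⊕ e f .eval-≈ φ = sym (mono-⊗ e (mono f) φ)

  push : ∀ {n m} → (Vec ℤ n → Vec ℤ m) → LPoly R n → LPoly R m
  push θ = map (λ { (c , e) → (c , θ e) })

  eval-push : ∀ {n m} (θ : Vec ℤ n → Vec ℤ m) (P : LPoly R n) φ → eval (push θ P) φ ≈ eval P (φ ∘ θ)
  eval-push θ []            φ = refl
  eval-push θ ((c , e) ∷ P) φ = +-congˡ (eval-push θ P φ)

  -- Functoriality of the group ring in the exponent group. The exchange of two variables and the
  -- insertion of a new variable both have this form.
  push-hom : ∀ {n m} (θ : Vec ℤ n → Vec ℤ m) → θ 0⃗ ≡ 0⃗ → (∀ e f → θ (e ⊕ f) ≡ θ e ⊕ θ f) →
    IsHom (ring n) (ring m) (push θ)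
  push-hom {n} {m} θ θ-0 θ-⊕ = makeHom (ring n) (ring m) (push θ)
    (λ {P} {Q} eq → evals (λ φ → trans (eval-push θ P φ) (trans (eval-≈ eq _) (sym (eval-push θ Q φ)))))
    (λ P Q → evals (λ φ → trans (eval-push θ (P ++ Q) φ) (trans (eval-++ P Q _)
      (sym (trans (eval-++ (push θ P) (push θ Q) φ) (+-cong (eval-push θ P φ) (eval-push θ Q φ)))))))
    (λ P Q → evals (λ φ → trans (eval-push θ (_⊗_ R P Q) φ) (trans (eval-⊗ P Q _)
      (trans (eval-cong P (λ e → trans (eval-cong Q (λ f → R.reflexive (≡.cong φ (θ-⊕ e f))))
                                       (sym (eval-push θ Q _))))
        (sym (trans (eval-⊗ (push θ P) (push θ Q) φ) (eval-push θ P _)))))))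
    (evals (λ φ → refl))
    (evals (λ φ → +-congʳ (*-congˡ (R.reflexive (≡.cong φ θ-0)))))
    (λ P → evals (λ φ → trans (eval-push θ (negate P) φ) (trans (eval-negate P _)
      (trans (R.-‿cong (sym (eval-push θ P φ))) (sym (eval-negate (push θ P) φ))))))

  δ₁ : ℤ → Carrier
  δ₁ (+ zero)  = 1#
  δ₁ (+ suc _) = 0#
  δ₁ -[1+ _ ]  = 0#

  δ : ∀ {n} → Vec ℤ n → Carrier
  δ []      = 1#
  δ (e ∷ f) = δ₁ e * δ f

  CT : ∀ {n} → LPoly R n → Carrier
  CT P = eval P δ

  unitVec : ∀ n → ℕ → Vec ℤ n
  unitVec zero    i       = []
  unitVec (suc n) zero    = ℤ.1ℤ ∷ 0⃗
  unitVec (suc n) (suc i) = ℤ.0ℤ ∷ unitVec n i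

  -- For i ≥ n these are both 1.
  y z : ∀ n → ℕ → LPoly R n
  y n i = mono (unitVec n i)
  z n i = mono (negVec (unitVec n i))

  ⊕-inverseˡ : ∀ {n} (e : Vec ℤ n) → negVec e ⊕ e ≡ 0⃗
  ⊕-inverseˡ []      = ≡.refl
  ⊕-inverseˡ (x ∷ e) = ≡.cong₂ _∷_ (ℤₚ.+-inverseˡ x) (⊕-inverseˡ e)

  zy≋1 : ∀ n i → _⊗_ R (z n i) (y n i) ≋ one R
  zy≋1 n i .eval-≈ φ = trans (sym (eval-≈ (mono-⊕ (negVec (unitVec n i)) (unitVec n i)) φ))
    (eval-≈ (mono-cong (⊕-inverseˡ (unitVec n i))) φ)

-- Naturality under ring homomorphisms

module Naturality (S T : CommutativeRing 0ℓ 0ℓ)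
  (h : CommutativeRing.Carrier S → CommutativeRing.Carrier T) (h-hom : IsHom S T h) where
  private
    module S = RingKit S
    module SV = Vandermonde S
    module TV = Vandermonde T
  open RingKit T
  open RingMorphisms.IsRingHomomorphism h-hom public
    renaming (⟦⟧-cong to h-cong; +-homo to h-+; *-homo to h-*; 0#-homo to h-0; 1#-homo to h-1; -‿homo to h-neg)
    using ()

  h-minus : ∀ a b → h (a S.- b) ≈ h a - h b
  h-minus a b = trans (h-+ a (S.- b)) (+-congˡ (h-neg b))

  h-^ : ∀ k a → h (a S.^ k) ≈ h a ^ k
  h-^ zero    a = h-1
  h-^ (suc k) a = trans (h-* a (a S.^ k)) (*-congˡ (h-^ k a))

  h-prod : ∀ n (f : ℕ → S.Carrier) → h (S.prod n f) ≈ prod n (h ∘ f)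
  h-prod zero    f = h-1
  h-prod (suc n) f = trans (h-* (f 0) (S.prod n (f ∘ suc))) (*-congˡ (h-prod n (f ∘ suc)))

  h-pairProd : ∀ n (F : ℕ → ℕ → S.Carrier) → h (SV.pairProd n F) ≈ TV.pairProd n (λ i j → h (F i j))
  h-pairProd zero    F = h-1
  h-pairProd (suc n) F = trans (h-* _ _)
    (*-cong (h-prod n (F 0 ∘ suc)) (h-pairProd n (λ i j → F (suc i) (suc j))))

  h-rest₂ : ∀ i n (F : ℕ → ℕ → S.Carrier) → h (SV.rest₂ i n F) ≈ TV.rest₂ i n (λ i j → h (F i j))
  h-rest₂ zero    zero          F = h-1
  h-rest₂ zero    (suc zero)    F = h-1
  h-rest₂ zero    (suc (suc n)) F = trans (h-* _ _) (*-cong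
    (trans (h-* _ _) (*-cong (h-prod n _) (h-prod n _))) (h-pairProd n _))
  h-rest₂ (suc i) zero          F = h-1
  h-rest₂ (suc i) (suc n)       F = trans (h-* _ _) (*-cong (h-prod n _) (h-rest₂ i n _))

  h-rest₃ : ∀ i n (F : ℕ → ℕ → S.Carrier) → h (SV.rest₃ i n F) ≈ TV.rest₃ i n (λ i j → h (F i j))
  h-rest₃ zero    zero                F = h-1
  h-rest₃ zero    (suc zero)          F = h-1
  h-rest₃ zero    (suc (suc zero))    F = h-1
  h-rest₃ zero    (suc (suc (suc n))) F = trans (h-* _ _) (*-cong
    (trans (h-* _ _) (*-cong (trans (h-* _ _) (*-cong (h-prod n _) (h-prod n _))) (h-prod n _)))
    (h-pairProd n _))
  h-rest₃ (suc i) zero                F = h-1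
  h-rest₃ (suc i) (suc n)             F = trans (h-* _ _) (*-cong (h-prod n _) (h-rest₃ i n _))

  h-vdm : ∀ n z → h (SV.vdm n z) ≈ TV.vdm n (h ∘ z)
  h-vdm n z = trans (h-pairProd n (λ i j → z j S.- z i))
    (TV.pairProd-cong n (λ i j → h-minus (z j) (z i)))

  h-hom-sym : ∀ n b z → h (SV.hom-sym n b z) ≈ TV.hom-sym n b (h ∘ z)
  h-hom-sym n       zero    z = h-1
  h-hom-sym zero    (suc b) z = h-0
  h-hom-sym (suc n) (suc b) z = trans (h-+ _ _) (+-cong (h-hom-sym n (suc b) (z ∘ suc))
    (trans (h-* _ _) (*-congˡ (h-hom-sym (suc n) b z))))

-- Vanishing of constant terms by antisymmetry

-- For u = v = 1, with Q(x, y) = 1 - X + XY, the product of the three factors is a sum of a polynomial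
-- symmetric in the first two and one symmetric in the last two variables.
module Triple (S : CommutativeRing 0ℓ 0ℓ) where
  open RingKit S

  Q₁ : Carrier → Carrier → Carrier
  Q₁ a b = 1# - a + a * b

  -- The symmetry is visible from the form: `sym₁₂` is built from Q₁ a b * Q₁ b a, a * b, a + b and
  -- c, and `sym₂₃` from Q₁ b c * Q₁ c b, b * c, b + c and a.
  sym₁₂ sym₂₃ : Carrier → Carrier → Carrier → Carrier
  sym₁₂ a b c = (Q₁ a b * Q₁ b a) * c + (c - c * c) * (a * b + (a * b) * (a * b))
    + (a * b - (a * b) * (a + b) + (a * b) * (a * b) - (a * b) * (a * b) * (c + c + c))
  sym₂₃ a b c = (Q₁ b c * Q₁ c b) * ((1# - a) * (1# - a)) - (a - a * a) * (b * c + (b * c) * (b * c))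
    - (b * c - (b * c) * (b + c) + (b * c) * (b * c) - (b * c) * (b * c) * (a + a + a))

  Q-triple : ∀ a b c → Q₁ a b * (Q₁ a c * Q₁ b c) ≈ sym₁₂ a b c + sym₂₃ a b c
  Q-triple = solve 3 (λ a b c →
    let q = λ x y → (:1 :- x) :+ x :* y
        s = λ x y w → (((x :* y) :- (x :* y) :* (x :+ y)) :+ (x :* y) :* (x :* y))
              :- ((x :* y) :* (x :* y)) :* (w :+ w :+ w)
    in q a b :* (q a c :* q b c) :=
       (((q a b :* q b a) :* c :+ (c :- c :* c) :* (a :* b :+ (a :* b) :* (a :* b))) :+ s a b c)
       :+ (((q b c :* q c b) :* ((:1 :- a) :* (:1 :- a)) :- (a :- a :* a) :* (b :* c :+ (b :* c) :* (b :* c)))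
          :- s b c a)) refl

module Antisymmetry
  (Rˢ Sˢ : CommutativeRing 0ℓ 0ℓ)
  (κ : CommutativeRing.Carrier Rˢ → CommutativeRing.Carrier Sˢ) (κ-hom : IsHom Rˢ Sˢ κ)
  (u v : CommutativeRing.Carrier Rˢ) (D : ℕ)
  (y z : ℕ → CommutativeRing.Carrier Sˢ)
  (zy≈1 : ∀ i → CommutativeRing._≈_ Sˢ (CommutativeRing._*_ Sˢ (z i) (y i)) (CommutativeRing.1# Sˢ))
  where
  private module R = RingKit Rˢ
  open RingKit Sˢ

  -- τ s is the exchange of the variables s and s+1. The constant term enters only through its
  -- linearity and its invariance `CT-τ`.
  module ConstantTerm
    (CT : Carrier → R.Carrier)
    (CT-cong : ∀ {f g} → f ≈ g → CT f R.≈ CT g)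
    (CT-+ : ∀ f g → CT (f + g) R.≈ CT f R.+ CT g)
    (CT-neg : ∀ f → CT (- f) R.≈ R.- CT f)
    (CT-κ : ∀ c f → CT (κ c * f) R.≈ c R.* CT f)
    (n : ℕ) (τ : ℕ → Carrier → Carrier) (τ-hom : ∀ s → IsHom Sˢ Sˢ (τ s))
    (τ-y : ∀ s i → suc s < n → τ s (y i) ≈ y (swapIx s i))
    (τ-z : ∀ s i → suc s < n → τ s (z i) ≈ z (swapIx s i))
    (τ-κ : ∀ s c → τ s (κ c) ≈ κ c)
    (CT-τ : ∀ s f → CT (τ s f) R.≈ CT f)
    (b : ℕ)
    where
    open Vandermonde Sˢ
    open Interlacing Rˢ Sˢ κ κ-hom u v D y z zy≈1
      using (X; p; q; Q; A; B; C; rowSum; expansion; monomial; module Expansion)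
    open RowWeights Rˢ u v D
    open Triple Sˢ
    module τ s = Naturality Sˢ Sˢ (τ s) (τ-hom s)
    open import Relation.Binary.Reasoning.Setoid setoid

    Fixed : ℕ → Carrier → Set
    Fixed s f = τ s f ≈ f

    fixed-cong : ∀ {s f g} → f ≈ g → Fixed s f → Fixed s g
    fixed-cong {s} eq h = trans (τ.h-cong s (sym eq)) (trans h eq)

    fixed-+ : ∀ {s f g} → Fixed s f → Fixed s g → Fixed s (f + g)
    fixed-+ {s} hf hg = trans (τ.h-+ s _ _) (+-cong hf hg)

    fixed-* : ∀ {s f g} → Fixed s f → Fixed s g → Fixed s (f * g)
    fixed-* {s} hf hg = trans (τ.h-* s _ _) (*-cong hf hg)

    fixed-neg : ∀ {s f} → Fixed s f → Fixed s (- f)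
    fixed-neg {s} hf = trans (τ.h-neg s _) (-‿cong hf)

    fixed-1 : ∀ {s} → Fixed s 1#
    fixed-1 {s} = τ.h-1 s

    fixed-^ : ∀ {s f} k → Fixed s f → Fixed s (f ^ k)
    fixed-^ {s} k hf = trans (τ.h-^ s k _) (^-cong k hf)

    fixed-swapped : ∀ {s f g} → τ s f ≈ g → τ s g ≈ f → Fixed s (f * g)
    fixed-swapped {s} hf hg = trans (τ.h-* s _ _) (trans (*-cong hf hg) (*-comm _ _))

    fixed-swapped-+ : ∀ {s f g} → τ s f ≈ g → τ s g ≈ f → Fixed s (f + g)
    fixed-swapped-+ {s} hf hg = trans (τ.h-+ s _ _) (trans (+-cong hf hg) (+-comm _ _))

    fixed-y : ∀ {s i} → suc s < n → swapIx s i ≡ i → Fixed s (y i)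
    fixed-y {s} {i} l eq = trans (τ-y s i l) (reflexive (≡.cong y eq))

    fixed-z : ∀ {s i} → suc s < n → swapIx s i ≡ i → Fixed s (z i)
    fixed-z {s} {i} l eq = trans (τ-z s i l) (reflexive (≡.cong z eq))

    fixed-X : ∀ {s i} → suc s < n → swapIx s i ≡ i → Fixed s (X i)
    fixed-X l eq = fixed-+ fixed-1 (fixed-y l eq)

    τ-X : ∀ s i → suc s < n → τ s (X i) ≈ X (swapIx s i)
    τ-X s i l = trans (τ.h-+ s _ _) (+-cong (τ.h-1 s) (τ-y s i l))

    τ-Q : ∀ s a b → τ s (Q a b) ≈ Q (τ s a) (τ s b)
    τ-Q s a b = trans (τ.h-+ s _ _) (+-cong (τ.h-1 s) (trans (τ.h-+ s _ _) (+-cong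
      (trans (τ.h-* s _ _) (*-congʳ (trans (τ.h-minus s _ _) (+-cong (τ.h-1 s) (-‿cong (τ-κ s v))))))
      (trans (τ.h-* s _ _) (*-cong (τ-κ s u) (trans (τ.h-+ s _ _) (+-congˡ (τ.h-* s _ _))))))))

    Q-cong : ∀ {a a′ b b′} → a ≈ a′ → b ≈ b′ → Q a b ≈ Q a′ b′
    Q-cong a b = +-congˡ (+-cong (*-congˡ a) (*-congˡ (+-cong b (*-cong a b))))

    F G : ℕ → ℕ → Carrier
    F i j = Q (y i) (y j)
    G i j = z j - z i

    τ-F : ∀ s i j → suc s < n → τ s (F i j) ≈ swapF s F i j
    τ-F s i j l = trans (τ-Q s (y i) (y j)) (Q-cong (τ-y s i l) (τ-y s j l))

    τ-G : ∀ s i j → suc s < n → τ s (G i j) ≈ swapF s G i j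
    τ-G s i j l = trans (τ.h-minus s (z j) (z i)) (+-cong (τ-z s j l) (-‿cong (τ-z s i l)))

    pairs-Q V : Carrier
    pairs-Q = pairProd n F
    V = vdm n z * hom-sym n b z

    L : Carrier → R.Carrier
    L f = CT (f * (pairs-Q * V))

    -- V has the factor z (suc s) - z s with a cofactor fixed by the exchange. The exchange carries
    -- z s * W to z (suc s) * W, so these have equal constant terms and their difference has
    -- constant term 0, over any ring and without dividing by 2.
    CT-alternant : ∀ s {f} → suc s < n → Fixed s f → CT (f * V) R.≈ R.0#
    CT-alternant s {f} l hf = R.trans (CT-cong (begin
        f * (vdm n z * H)
          ≈⟨ *-congˡ (*-congʳ (pairProd-rest₂ s n l G)) ⟩
        f * (((z (suc s) - z s) * rest₂ s n G) * H)
          ≈⟨ solve 5 (λ f a b r h → f :* (((a :- b) :* r) :* h) := a :* (f :* (r :* h)) :+ :- (b :* (f :* (r :* h))))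
               refl f (z (suc s)) (z s) (rest₂ s n G) H ⟩
        z (suc s) * W + - (z s * W) ∎))
      (R.trans (CT-+ _ _) (R.trans (R.+-cong same (CT-neg _)) (R.-‿inverseʳ _)))
      where
      H W : Carrier
      H = hom-sym n b z
      W = f * (rest₂ s n G * H)
      fixed-W : Fixed s W
      fixed-W = fixed-* hf (fixed-*
        (trans (τ.h-rest₂ s s n G) (trans (rest₂-cong s n (λ i j → τ-G s i j l)) (rest₂-swap s n l G)))
        (trans (τ.h-hom-sym s n b z) (trans (hom-sym-cong n b (λ i → τ-z s i l)) (hom-sym-swap s n b l z))))
      same : CT (z (suc s) * W) R.≈ CT (z s * W)
      same = R.trans (CT-cong (sym (trans (τ.h-* s _ _)
        (*-cong (trans (τ-z s s l) (reflexive (≡.cong z (swapIx-left s)))) fixed-W)))) (CT-τ s (z s * W))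

    Early Late : ℕ → Carrier → Set
    Early i g = ∀ s → suc s < n → i ℕ.≤ s → Fixed s g
    Late i f = ∀ s → suc s < n → suc s < i → Fixed s f

    fixed-p : ∀ {s i} → suc s < n → swapIx s i ≡ i → Fixed s (p i)
    fixed-p {s} l eq = fixed-+ fixed-1 (fixed-* (fixed-+ fixed-1 (fixed-neg (τ-κ s v))) (fixed-y l eq))

    fixed-q : ∀ {s i} → suc s < n → swapIx s i ≡ i → Fixed s (q i)
    fixed-q {s} l eq = fixed-+ fixed-1 (fixed-* (τ-κ s u) (fixed-y l eq))

    fixed-zX : ∀ {s i} k → suc s < n → swapIx s i ≡ i → Fixed s (z i * X i ^ k)
    fixed-zX k l eq = fixed-* (fixed-z l eq) (fixed-^ k (fixed-X l eq))

    Early-A : ∀ {i g} k → Early i g → Early (suc i) (g * A i k)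
    Early-A k early s l i<s = fixed-* (early s l (<⇒≤ i<s))
      (fixed-* (fixed-zX k l (swapIx-< i<s)) (fixed-q l (swapIx-< i<s)))

    Early-B : ∀ {i g} k → Early i g → Early (suc i) (g * B i k)
    Early-B k early s l i<s = fixed-* (early s l (<⇒≤ i<s))
      (fixed-neg (fixed-* (fixed-zX k l (swapIx-< i<s)) (fixed-p l (swapIx-< i<s))))

    -- C contains Q with the arguments in reversed order, exactly the factor that `pairProd-swap`
    -- requires to make the Q-product symmetric in the two variables of the collision.
    L-collision : ∀ i k {g f} → suc i < n → Early i g → Late (2 ℕ.+ i) f → L (g * (C i k * f)) R.≈ R.0#
    L-collision i k {g} {f} l early late = R.trans
      (CT-cong (solve 6 (λ g c q f p v → (g :* ((c :* q) :* f)) :* (p :* v) := ((g :* (c :* f)) :* (q :* p)) :* v)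
        refl g c (F (suc i) i) f pairs-Q V))
      (CT-alternant i l (fixed-* (fixed-* (early i l ≤-refl) (fixed-* fixed-c (late i l ≤-refl))) fixed-pairs))
      where
      open ℕₚ using (≤-refl)
      c : Carrier
      c = - ((z i * z (suc i)) * (X i ^ k * X (suc i) ^ k))
      fixed-c : Fixed i c
      fixed-c = fixed-neg (fixed-*
        (fixed-swapped (trans (τ-z i i l) (reflexive (≡.cong z (swapIx-left i))))
                       (trans (τ-z i (suc i) l) (reflexive (≡.cong z (swapIx-right i)))))
        (fixed-swapped (trans (τ.h-^ i k _) (^-cong k (trans (τ-X i i l) (reflexive (≡.cong X (swapIx-left i))))))
                       (trans (τ.h-^ i k _) (^-cong k (trans (τ-X i (suc i) l) (reflexive (≡.cong X (swapIx-right i))))))))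
      fixed-pairs : Fixed i (F (suc i) i * pairs-Q)
      fixed-pairs = trans (τ.h-* i _ _) (trans
        (*-cong (trans (τ-F i (suc i) i l) (reflexive (≡.cong₂ F (swapIx-right i) (swapIx-left i))))
                (trans (τ.h-pairProd i n F) (pairProd-cong n (λ a b → τ-F i a b l))))
        (sym (pairProd-swap i n l F)))

    τ-Q₁ : ∀ s a b → τ s (Q₁ a b) ≈ Q₁ (τ s a) (τ s b)
    τ-Q₁ s a b = trans (τ.h-+ s _ _) (+-cong (trans (τ.h-minus s _ _) (+-congʳ (τ.h-1 s))) (τ.h-* s a b))

    Q₁-cong : ∀ {a a′ b b′} → a ≈ a′ → b ≈ b′ → Q₁ a b ≈ Q₁ a′ b′
    Q₁-cong a b = +-cong (+-congˡ (-‿cong a)) (*-cong a b)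

    module _ {s a b c} (τa : τ s a ≈ b) (τb : τ s b ≈ a) (τc : τ s c ≈ c) where
      private
        QQ : Fixed s (Q₁ a b * Q₁ b a)
        QQ = fixed-swapped (trans (τ-Q₁ s a b) (Q₁-cong τa τb)) (trans (τ-Q₁ s b a) (Q₁-cong τb τa))
        ab : Fixed s (a * b)
        ab = fixed-swapped τa τb
        abab : Fixed s ((a * b) * (a * b))
        abab = fixed-* ab ab
        lower : Fixed s (a * b - (a * b) * (a + b) + (a * b) * (a * b) - (a * b) * (a * b) * (c + c + c))
        lower = fixed-+ (fixed-+ (fixed-+ ab (fixed-neg (fixed-* ab (fixed-swapped-+ τa τb)))) abab)
          (fixed-neg (fixed-* abab (fixed-+ (fixed-+ τc τc) τc)))

      fixed-sym₁₂ : Fixed s (sym₁₂ a b c)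
      fixed-sym₁₂ = fixed-+ (fixed-+ (fixed-* QQ τc)
        (fixed-* (fixed-+ τc (fixed-neg (fixed-* τc τc))) (fixed-+ ab abab))) lower

      fixed-sym₂₃ : Fixed s (sym₂₃ c a b)
      fixed-sym₂₃ = fixed-+ (fixed-+ (fixed-* QQ (fixed-* 1-c 1-c))
        (fixed-neg (fixed-* (fixed-+ τc (fixed-neg (fixed-* τc τc))) (fixed-+ ab abab)))) (fixed-neg lower)
        where
        1-c : Fixed s (1# - c)
        1-c = fixed-+ fixed-1 (fixed-neg τc)

    -- No reversed factor Q is present here. Instead `Q-triple` splits the three factors among these
    -- variables into two summands; the first is annihilated through the exchange i, the second
    -- through the exchange i+1.
    L-triple : Unital → ∀ i k {g f} → 2 ℕ.+ i < n → Early i g → Late (3 ℕ.+ i) f →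
      L (g * ((X i ^ k * (X (suc i) ^ k * X (2 ℕ.+ i) ^ k)) * f)) R.≈ R.0#
    L-triple (u≈1 , v≈1) i k {g} {f} l early late = R.trans
      (CT-cong (begin
        (g * (XXX * f)) * (pairs-Q * V)
          ≈⟨ *-congˡ (*-congʳ (trans (pairProd-rest₃ i n l F) (*-congʳ (trans
               (*-cong (F≈Q₁ _ _) (*-cong (F≈Q₁ _ _) (F≈Q₁ _ _))) (Q-triple (X i) (X (suc i)) (X (2 ℕ.+ i))))))) ⟩
        (g * (XXX * f)) * (((s₁ + s₂) * r) * V)
          ≈⟨ solve 7 (λ g x f s t r v → (g :* (x :* f)) :* (((s :+ t) :* r) :* v) :=
               ((g :* (x :* f)) :* (s :* r)) :* v :+ ((g :* (x :* f)) :* (t :* r)) :* v)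
               refl g XXX f s₁ s₂ r V ⟩
        ((g * (XXX * f)) * (s₁ * r)) * V + ((g * (XXX * f)) * (s₂ * r)) * V ∎))
      (R.trans (CT-+ _ _) (R.trans (R.+-cong
        (CT-alternant i l₁ (fixed-* (fixed-* (early i l₁ ≤-refl) (fixed-* XXX₁ (late i l₁ (s≤s (s≤s (ℕₚ.n≤1+n i))))))
          (fixed-* (fixed-sym₁₂ (τX l₁ (swapIx-left i)) (τX l₁ (swapIx-right i)) (τX l₁ (swapIx-> ≤-refl))) r₁)))
        (CT-alternant (suc i) l (fixed-* (fixed-* (early (suc i) l (ℕₚ.n≤1+n i)) (fixed-* XXX₂ (late (suc i) l ≤-refl)))
          (fixed-* (fixed-sym₂₃ (τX l (swapIx-left (suc i))) (τX l (swapIx-right (suc i))) (τX l (swapIx-< ≤-refl))) r₂))))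
        (R.+-identityʳ _)))
      where
      open ℕₚ using (≤-refl)
      l₁ : suc i < n
      l₁ = <⇒≤ l
      XXX r s₁ s₂ : Carrier
      XXX = X i ^ k * (X (suc i) ^ k * X (2 ℕ.+ i) ^ k)
      r = rest₃ i n F
      s₁ = sym₁₂ (X i) (X (suc i)) (X (2 ℕ.+ i))
      s₂ = sym₂₃ (X i) (X (suc i)) (X (2 ℕ.+ i))
      F≈Q₁ : ∀ a b → F a b ≈ Q₁ (X a) (X b)
      F≈Q₁ a b = trans (+-congˡ (+-cong (*-congʳ (+-congˡ (-‿cong κv≈1))) (*-congʳ κu≈1)))
        (solve 2 (λ a b → :1 :+ ((:1 :- :1) :* a :+ :1 :* (b :+ a :* b)) :=
          (:1 :- (:1 :+ a)) :+ (:1 :+ a) :* (:1 :+ b)) refl (y a) (y b))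
        where
        open RingMorphisms.IsRingHomomorphism κ-hom using (⟦⟧-cong; 1#-homo)
        κu≈1 = trans (⟦⟧-cong u≈1) 1#-homo
        κv≈1 = trans (⟦⟧-cong v≈1) 1#-homo
      τX : ∀ {s a b} → suc s < n → swapIx s a ≡ b → τ s (X a) ≈ X b
      τX {s} {a} l eq = trans (τ-X s a l) (reflexive (≡.cong X eq))
      τX^ : ∀ {s a b} → suc s < n → swapIx s a ≡ b → τ s (X a ^ k) ≈ X b ^ k
      τX^ {s} {a} l eq = trans (τ.h-^ s k (X a)) (^-cong k (τX l eq))
      XXX₁ : Fixed i XXX
      XXX₁ = fixed-cong (*-assoc _ _ _) (fixed-*
        (fixed-swapped (τX^ l₁ (swapIx-left i)) (τX^ l₁ (swapIx-right i))) (τX^ l₁ (swapIx-> ≤-refl)))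
      XXX₂ : Fixed (suc i) XXX
      XXX₂ = fixed-* (τX^ l (swapIx-< ≤-refl))
        (fixed-swapped (τX^ l (swapIx-left (suc i))) (τX^ l (swapIx-right (suc i))))
      r₁ : Fixed i r
      r₁ = trans (τ.h-rest₃ i i n F) (trans (rest₃-cong i n (λ a b → τ-F i a b l₁)) (rest₃-swapˡ i n l F))
      r₂ : Fixed (suc i) r
      r₂ = trans (τ.h-rest₃ (suc i) i n F)
        (trans (rest₃-cong i n (λ a b → τ-F (suc i) a b l)) (rest₃-swapʳ i n l F))

    module E = Expansion n L
      (λ eq → CT-cong (*-congʳ eq))
      (λ f g → R.trans (CT-cong (distribʳ _ _ _)) (CT-+ _ _))
      (λ c f → R.trans (CT-cong (*-assoc _ _ _)) (CT-κ _ _))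
      Early Late Early-A Early-B
      (λ eq h s l i<s → fixed-cong eq (h s l i<s))
      (λ i c s l i<s → τ-κ s c)
      (λ hf hg s l i<s → fixed-+ (hf s l i<s) (hg s l i<s))
      (λ hf hg s l i<s → fixed-* (hf s l i<s) (hg s l i<s))
      (λ i s l s<i → fixed-X l (swapIx-> s<i))
      (λ h s l s<i → h s l (ℕₚ.m≤n⇒m≤1+n s<i))
      L-collision L-triple

    row-expansion : ∀ (ks : Vec ℕ (suc n)) → Chain ks →
      rows n (λ r → rowWeight 0 r ks R.* CT (monomial 0 r * (pairs-Q * V)))
        R.≈ CT (expansion 0 ks * (pairs-Q * V))
    row-expansion ks chain = R.trans
      (rows-cong n (λ r → R.*-congˡ (CT-cong (*-congʳ (sym (*-identityˡ _))))))
      (R.trans (E.L-rows 0 0 ks 1#) (R.trans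
        (E.rowSum≈expansion 0 ks ℕₚ.≤-refl (λ s l i≤s → fixed-1) chain)
        (CT-cong (*-congʳ (*-identityˡ _)))))

module Elimination
  (Rˢ Sˢ Tˢ : CommutativeRing 0ℓ 0ℓ)
  (κS : CommutativeRing.Carrier Rˢ → CommutativeRing.Carrier Sˢ) (κS-hom : IsHom Rˢ Sˢ κS)
  (κT : CommutativeRing.Carrier Rˢ → CommutativeRing.Carrier Tˢ) (κT-hom : IsHom Rˢ Tˢ κT)
  (u v : CommutativeRing.Carrier Rˢ) (D : ℕ)
  (yS zS : ℕ → CommutativeRing.Carrier Sˢ)
  (zyS : ∀ i → CommutativeRing._≈_ Sˢ (CommutativeRing._*_ Sˢ (zS i) (yS i)) (CommutativeRing.1# Sˢ))
  (yT zT : ℕ → CommutativeRing.Carrier Tˢ)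
  (zyT : ∀ i → CommutativeRing._≈_ Tˢ (CommutativeRing._*_ Tˢ (zT i) (yT i)) (CommutativeRing.1# Tˢ))
  where
  private
    module R = RingKit Rˢ
    module S = RingKit Sˢ
    module T = RingKit Tˢ
    module SV = Vandermonde Sˢ
    module TV = Vandermonde Tˢ
    module SI = Interlacing Rˢ Sˢ κS κS-hom u v D yS zS zyS
    module TI = Interlacing Rˢ Tˢ κT κT-hom u v D yT zT zyT

  -- S has one variable more than T, and ι s renames the variables of T around a new one at place s.
  -- The relation f ↝[ s ] g expresses substitution of 0 for this variable, and `CT-↝` says that
  -- this substitution computes the constant term in x_s when the other factor is free of x_s.
  module Step
    (n : ℕ)
    (CT-S : S.Carrier → R.Carrier) (CT-T : T.Carrier → R.Carrier)
    (CT-S-cong : ∀ {f g} → f S.≈ g → CT-S f R.≈ CT-S g)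
    (CT-T-cong : ∀ {f g} → f T.≈ g → CT-T f R.≈ CT-T g)
    (CT-S-+ : ∀ f g → CT-S (f S.+ g) R.≈ CT-S f R.+ CT-S g)
    (CT-T-+ : ∀ f g → CT-T (f T.+ g) R.≈ CT-T f R.+ CT-T g)
    (CT-S-0 : CT-S S.0# R.≈ R.0#) (CT-T-0 : CT-T T.0# R.≈ R.0#)
    (ι : ℕ → T.Carrier → S.Carrier) (ι-hom : ∀ s → IsHom Tˢ Sˢ (ι s))
    (ι-y : ∀ s i → s ℕ.≤ n → ι s (yT i) S.≈ yS (punch s i))
    (ι-z : ∀ s i → s ℕ.≤ n → ι s (zT i) S.≈ zS (punch s i))
    (ι-κ : ∀ s c → ι s (κT c) S.≈ κS c)
    (_↝[_]_ : S.Carrier → ℕ → T.Carrier → Set)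
    (↝-cong : ∀ {s f f′ g g′} → f S.≈ f′ → g T.≈ g′ → f ↝[ s ] g → f′ ↝[ s ] g′)
    (↝-+ : ∀ {s f f′ g g′} → f ↝[ s ] g → f′ ↝[ s ] g′ → (f S.+ f′) ↝[ s ] (g T.+ g′))
    (↝-* : ∀ {s} → s ℕ.≤ n → ∀ {f f′ g g′} → f ↝[ s ] g → f′ ↝[ s ] g′ → (f S.* f′) ↝[ s ] (g T.* g′))
    (↝-ι : ∀ {s} g → s ℕ.≤ n → ι s g ↝[ s ] g)
    (↝-y : ∀ {s} → s ℕ.≤ n → yS s ↝[ s ] T.0#)
    (CT-↝ : ∀ {s f f₀} g → s ℕ.≤ n → f ↝[ s ] f₀ → CT-S (f S.* ι s g) R.≈ CT-T (f₀ T.* g))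
    where
    private module ι s = Naturality Tˢ Sˢ (ι s) (ι-hom s)

    ι-sgn : ∀ s e → ι s (TV.sgn e) S.≈ SV.sgn e
    ι-sgn s zero    = ι.h-1 s
    ι-sgn s (suc e) = S.trans (ι.h-neg s _) (S.-‿cong (ι-sgn s e))

    ι-X : ∀ s i → s ℕ.≤ n → ι s (TI.X i) S.≈ SI.X (punch s i)
    ι-X s i s≤n = S.trans (ι.h-+ s _ _) (S.+-cong (ι.h-1 s) (ι-y s i s≤n))

    ι-Q : ∀ s i j → s ℕ.≤ n → ι s (TI.Q (yT i) (yT j)) S.≈ SI.Q (yS (punch s i)) (yS (punch s j))
    ι-Q s i j s≤n = S.trans (ι.h-+ s _ _) (S.+-cong (ι.h-1 s) (S.trans (ι.h-+ s _ _) (S.+-cong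
      (S.trans (ι.h-* s _ _) (S.*-cong (S.trans (ι.h-minus s _ _) (S.+-cong (ι.h-1 s) (S.-‿cong (ι-κ s v)))) (ι-y s i s≤n)))
      (S.trans (ι.h-* s _ _) (S.*-cong (ι-κ s u) (S.trans (ι.h-+ s _ _)
        (S.+-cong (ι-y s j s≤n) (S.trans (ι.h-* s _ _) (S.*-cong (ι-y s i s≤n) (ι-y s j s≤n))))))))))

    module _ {s} (s≤n : s ℕ.≤ n) where
      ↝-1 : S.1# ↝[ s ] T.1#
      ↝-1 = ↝-cong (ι.h-1 s) T.refl (↝-ι T.1# s≤n)

      ↝-κ : ∀ c → κS c ↝[ s ] κT c
      ↝-κ c = ↝-cong (ι-κ s c) T.refl (↝-ι (κT c) s≤n)

      ↝-other : ∀ j → yS (punch s j) ↝[ s ] yT j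
      ↝-other j = ↝-cong (ι-y s j s≤n) T.refl (↝-ι (yT j) s≤n)

      ↝-1-v : (S.1# S.- κS v) ↝[ s ] (T.1# T.- κT v)
      ↝-1-v = ↝-cong (S.trans (ι.h-minus s _ _) (S.+-cong (ι.h-1 s) (S.-‿cong (ι-κ s v)))) T.refl
        (↝-ι (T.1# T.- κT v) s≤n)

      ↝-Q : ∀ {a b a₀ b₀} → a ↝[ s ] a₀ → b ↝[ s ] b₀ → SI.Q a b ↝[ s ] TI.Q a₀ b₀
      ↝-Q a b = ↝-+ ↝-1 (↝-+ (↝-* s≤n ↝-1-v a) (↝-* s≤n (↝-κ u) (↝-+ b (↝-* s≤n a b))))

      ↝-X^ : ∀ k → (SI.X s S.^ k) ↝[ s ] T.1#
      ↝-X^ zero    = ↝-1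
      ↝-X^ (suc k) = ↝-cong S.refl (T.trans (T.*-congʳ (T.+-identityʳ T.1#)) (T.*-identityˡ T.1#))
        (↝-* s≤n (↝-+ ↝-1 (↝-y s≤n)) (↝-X^ k))

      ↝-prod : ∀ l {f : ℕ → S.Carrier} {g : ℕ → T.Carrier} → (∀ i → f i ↝[ s ] g i) → S.prod l f ↝[ s ] T.prod l g
      ↝-prod zero    h = ↝-1
      ↝-prod (suc l) h = ↝-* s≤n (h 0) (↝-prod l (h ∘ suc))

      ↝-side : ∀ e j {a a′ b b′} → a ↝[ s ] a′ → b ↝[ s ] b′ → side e j a b ↝[ s ] side e j a′ b′
      ↝-side zero    j       a b = b
      ↝-side (suc e) zero    a b = a
      ↝-side (suc e) (suc j) a b = ↝-side e j a b

      ↝-p : ∀ j → SI.Q (yS (punch s j)) (yS s) ↝[ s ] TI.p j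
      ↝-p j = ↝-cong S.refl
        (T.solve 3 (λ v u y → T.:1 T.:+ ((T.:1 T.:- v) T.:* y T.:+ u T.:* (T.:0 T.:+ y T.:* T.:0))
          T.:= T.:1 T.:+ (T.:1 T.:- v) T.:* y) T.refl (κT v) (κT u) (yT j))
        (↝-Q (↝-other j) (↝-y s≤n))

      ↝-q : ∀ j → SI.Q (yS s) (yS (punch s j)) ↝[ s ] TI.q j
      ↝-q j = ↝-cong S.refl
        (T.solve 3 (λ v u y → T.:1 T.:+ ((T.:1 T.:- v) T.:* T.:0 T.:+ u T.:* (y T.:+ T.:0 T.:* y))
          T.:= T.:1 T.:+ u T.:* y) T.refl (κT v) (κT u) (yT j))
        (↝-Q (↝-y s≤n) (↝-other j))

    FS : ℕ → ℕ → S.Carrier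
    FS i j = SI.Q (yS i) (yS j)

    FT : ℕ → ℕ → T.Carrier
    FT i j = TI.Q (yT i) (yT j)

    module _ (b : ℕ) (ks : Vec ℕ (suc n)) where
      VT PT : T.Carrier
      VT = TV.vdm n zT T.* TV.hom-sym n b zT
      PT = TV.pairProd n FT
      M PS : S.Carrier
      M = SI.monomial 0 ks
      PS = SV.pairProd (suc n) FS
      laplaceTerm : ℕ → S.Carrier
      laplaceTerm s = SV.sgn s S.* (S.prod n (zS ∘ punch s)
        S.* (SV.vdm n (zS ∘ punch s) S.* SV.hom-sym n b (zS ∘ punch s)))
      rowTerm : ℕ → T.Carrier
      rowTerm s = TV.sgn s T.* T.prod n (TI.gapTerm 0 ks s)

      eliminate : ∀ s → s ℕ.≤ n → CT-S (M S.* (PS S.* laplaceTerm s)) R.≈ CT-T (rowTerm s T.* (PT T.* VT))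
      eliminate s s≤n = R.trans (CT-S-cong (begin
          M S.* (PS S.* laplaceTerm s)
            -- Each factor is divided into a part containing the variable s, namely Xs and Qs, and
            -- the image under ι s of a part in the other variables. The Laplace term is entirely
            -- such an image, so no negative power of x_s occurs outside it.
            ≈⟨ S.*-cong splitM (S.*-cong splitP ιV) ⟩
          (Xs S.* ι s mT) S.* ((ι s PT S.* Qs) S.* ι s wT)
            ≈⟨ S.solve 5 (λ x m p q w → (x S.:* m) S.:* ((p S.:* q) S.:* w) S.:= (x S.:* q) S.:* (m S.:* (p S.:* w)))
                 S.refl Xs (ι s mT) (ι s PT) Qs (ι s wT) ⟩
          (Xs S.* Qs) S.* (ι s mT S.* (ι s PT S.* ι s wT))
            ≈⟨ S.*-congˡ (S.trans (ι.h-* s _ _) (S.*-congˡ (ι.h-* s _ _))) ⟨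
          (Xs S.* Qs) S.* ι s (mT T.* (PT T.* wT)) ∎))
        (R.trans (CT-↝ (mT T.* (PT T.* wT)) s≤n (↝-* s≤n (↝-X^ s≤n (at ks s))
                   (↝-prod s≤n n (λ j → ↝-side s≤n s j (↝-p s≤n j) (↝-q s≤n j)))))
          (CT-T-cong (T.trans
            (T.solve 6 (λ q m p e z w → (T.:1 T.:* q) T.:* (m T.:* (p T.:* (e T.:* (z T.:* w)))) T.:=
              (e T.:* ((z T.:* m) T.:* q)) T.:* (p T.:* w)) T.refl qT mT PT (TV.sgn s) (T.prod n zT) VT)
            (T.*-congʳ (T.*-congˡ (T.sym gap))))))
        where
        open import Relation.Binary.Reasoning.Setoid S.setoid
        Xs Qs : S.Carrier
        Xs = SI.X s S.^ at ks s
        Qs = S.prod n (λ j → side s j (FS (punch s j) s) (FS s (punch s j)))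
        mT wT qT : T.Carrier
        mT = T.prod n (λ j → TI.X j T.^ at ks (punch s j))
        wT = TV.sgn s T.* (T.prod n zT T.* VT)
        qT = T.prod n (λ j → side s j (TI.p j) (TI.q j))
        splitM : M S.≈ Xs S.* ι s mT
        splitM = S.trans (SI.monomial-prod 0 ks) (S.trans
          (S.prod-cong′ (suc n) (λ j → S.reflexive (≡.cong (λ r → SI.X r S.^ at ks j) (ℕₚ.+-identityʳ j))))
          (S.trans (S.prod-punch n s s≤n (λ j → SI.X j S.^ at ks j)) (S.*-congˡ (S.sym
            (S.trans (ι.h-prod s n _) (S.prod-cong′ n (λ j →
              S.trans (ι.h-^ s (at ks (punch s j)) (TI.X j)) (S.^-cong (at ks (punch s j)) (ι-X s j s≤n)))))))))
        splitP : PS S.≈ ι s PT S.* Qs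
        splitP = S.trans (SV.pairProd-punch n s s≤n FS) (S.*-congʳ (S.sym
          (S.trans (ι.h-pairProd s n FT) (SV.pairProd-cong n (λ i j → ι-Q s i j s≤n)))))
        ιV : laplaceTerm s S.≈ ι s wT
        ιV = S.sym (S.trans (ι.h-* s _ _) (S.*-cong (ι-sgn s s) (S.trans (ι.h-* s _ _) (S.*-cong
          (S.trans (ι.h-prod s n zT) (S.prod-cong′ n (λ j → ι-z s j s≤n)))
          (S.trans (ι.h-* s _ _) (S.*-cong
            (S.trans (ι.h-vdm s n zT) (SV.vdm-cong n (λ j → ι-z s j s≤n)))
            (S.trans (ι.h-hom-sym s n b zT) (SV.hom-sym-cong n b (λ j → ι-z s j s≤n)))))))))
        gap : T.prod n (TI.gapTerm 0 ks s) T.≈ (T.prod n zT T.* mT) T.* qT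
        gap = T.trans (T.prod-cong′ n (λ j → T.reflexive (≡.cong
            (λ r → (zT r T.* TI.X r T.^ at ks (punch s j)) T.* side s j (TI.p r) (TI.q r)) (ℕₚ.+-identityʳ j))))
          (T.trans (T.prod-* n _ _) (T.*-congʳ (T.prod-* n _ _)))

      CT-S-sum : ∀ l (f : ℕ → S.Carrier) → CT-S (S.sum l f) R.≈ R.sum l (CT-S ∘ f)
      CT-S-sum zero    f = CT-S-0
      CT-S-sum (suc l) f = R.trans (CT-S-+ _ _) (R.+-congˡ (CT-S-sum l (f ∘ suc)))

      CT-T-sum : ∀ l (f : ℕ → T.Carrier) → CT-T (T.sum l f) R.≈ R.sum l (CT-T ∘ f)
      CT-T-sum zero    f = CT-T-0
      CT-T-sum (suc l) f = R.trans (CT-T-+ _ _) (R.+-congˡ (CT-T-sum l (f ∘ suc)))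

    -- At least two variables are required for the Laplace expansion: for a single variable and b >
    -- 0 its left side would be h_b of no variables, which is 0, while its right side would be z^b.
    eliminate-variable : ∀ b n′ → n ≡ suc n′ → (ks : Vec ℕ (suc n)) →
      CT-S (SI.monomial 0 ks S.* (SV.pairProd (suc n) FS S.* (SV.vdm (suc n) zS S.* SV.hom-sym (suc n) b zS)))
      R.≈ CT-T (TI.expansion 0 ks T.* (TV.pairProd n FT T.* (TV.vdm n zT T.* TV.hom-sym n b zT)))
    eliminate-variable b n′ ≡.refl ks = begin
      CT-S (M b ks S.* (PS b ks S.* (SV.vdm (suc n) zS S.* SV.hom-sym (suc n) b zS)))
        ≈⟨ CT-S-cong (S.trans (S.*-congˡ (S.trans (S.*-congˡ (S.sym (SV.laplace n′ b zS)))
             (S.*-sum (suc n) (PS b ks) (laplaceTerm b ks))))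
             (S.*-sum (suc n) (M b ks) (λ s → PS b ks S.* laplaceTerm b ks s))) ⟩
      CT-S (S.sum (suc n) (λ s → M b ks S.* (PS b ks S.* laplaceTerm b ks s)))
        ≈⟨ CT-S-sum b ks (suc n) (λ s → M b ks S.* (PS b ks S.* laplaceTerm b ks s)) ⟩
      R.sum (suc n) (λ s → CT-S (M b ks S.* (PS b ks S.* laplaceTerm b ks s)))
        ≈⟨ R.sum-cong (suc n) {λ s → CT-S (M b ks S.* (PS b ks S.* laplaceTerm b ks s))}
             (λ s s<n → eliminate b ks s (ℕ.s≤s⁻¹ s<n)) ⟩
      R.sum (suc n) (λ s → CT-T (rowTerm b ks s T.* (PT b ks T.* VT b ks)))
        ≈⟨ CT-T-sum b ks (suc n) (λ s → rowTerm b ks s T.* (PT b ks T.* VT b ks)) ⟨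
      CT-T (T.sum (suc n) (λ s → rowTerm b ks s T.* (PT b ks T.* VT b ks)))
        ≈⟨ CT-T-cong (T.trans (T.*-congʳ (TI.expansion-sum 0 ks))
             (T.trans (T.*-comm _ _) (T.trans (T.*-sum (suc n) _ (rowTerm b ks))
               (T.sum-cong′ (suc n) {λ s → (PT b ks T.* VT b ks) T.* rowTerm b ks s} (λ s → T.*-comm _ _))))) ⟨
      CT-T (TI.expansion 0 ks T.* (PT b ks T.* VT b ks)) ∎
      where open import Relation.Binary.Reasoning.Setoid R.setoid

-- Exchange and insertion of variables

-- The identity when place s+1 is out of range, so that it is additive for every s and induces a
-- ring homomorphism without side conditions.
swapVec : ∀ {n} → ℕ → Vec ℤ n → Vec ℤ n
swapVec s       []          = []
swapVec zero    (a ∷ [])    = a ∷ []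
swapVec zero    (a ∷ b ∷ e) = b ∷ a ∷ e
swapVec (suc s) (a ∷ e)     = a ∷ swapVec s e

swapVec-0 : ∀ {n} s → swapVec s (0⃗ {n}) ≡ 0⃗
swapVec-0 {zero}        s       = ≡.refl
swapVec-0 {suc zero}    zero    = ≡.refl
swapVec-0 {suc (suc n)} zero    = ≡.refl
swapVec-0 {suc n}       (suc s) = ≡.cong (_ ∷_) (swapVec-0 s)

swapVec-⊕ : ∀ {n} s (e f : Vec ℤ n) → swapVec s (e ⊕ f) ≡ swapVec s e ⊕ swapVec s f
swapVec-⊕ s       []          []          = ≡.refl
swapVec-⊕ zero    (a ∷ [])    (b ∷ [])    = ≡.refl
swapVec-⊕ zero    (a ∷ _ ∷ e) (b ∷ _ ∷ f) = ≡.refl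
swapVec-⊕ (suc s) (a ∷ e)     (b ∷ f)     = ≡.cong (_ ∷_) (swapVec-⊕ s e f)

swapVec-map : ∀ {n} (h : ℤ → ℤ) s (e : Vec ℤ n) → swapVec s (Vec.map h e) ≡ Vec.map h (swapVec s e)
swapVec-map h s       []          = ≡.refl
swapVec-map h zero    (a ∷ [])    = ≡.refl
swapVec-map h zero    (a ∷ b ∷ e) = ≡.refl
swapVec-map h (suc s) (a ∷ e)     = ≡.cong (_ ∷_) (swapVec-map h s e)

-- For s beyond the length the zero is appended at the end, which keeps the map additive for every
-- s.
insert0 : ∀ {n} → ℕ → Vec ℤ n → Vec ℤ (suc n)
insert0 zero    e       = ℤ.0ℤ ∷ e
insert0 (suc s) []      = ℤ.0ℤ ∷ []
insert0 (suc s) (x ∷ e) = x ∷ insert0 s e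

insert0-0 : ∀ {n} s → insert0 s (0⃗ {n}) ≡ 0⃗
insert0-0         zero    = ≡.refl
insert0-0 {zero}  (suc s) = ≡.refl
insert0-0 {suc n} (suc s) = ≡.cong (_ ∷_) (insert0-0 s)

insert0-⊕ : ∀ {n} s (e f : Vec ℤ n) → insert0 s (e ⊕ f) ≡ insert0 s e ⊕ insert0 s f
insert0-⊕ zero    e       f       = ≡.refl
insert0-⊕ (suc s) []      []      = ≡.refl
insert0-⊕ (suc s) (a ∷ e) (b ∷ f) = ≡.cong (_ ∷_) (insert0-⊕ s e f)

insert0-neg : ∀ {n} s (e : Vec ℤ n) → insert0 s (negVec e) ≡ negVec (insert0 s e)
insert0-neg zero    e       = ≡.refl
insert0-neg (suc s) []      = ≡.refl
insert0-neg (suc s) (a ∷ e) = ≡.cong (_ ∷_) (insert0-neg s e)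

exponent : ∀ {n} → ℕ → Vec ℤ n → ℤ
exponent s       []      = ℤ.0ℤ
exponent zero    (a ∷ e) = a
exponent (suc s) (a ∷ e) = exponent s e

exponent-⊕ : ∀ {n} s (e f : Vec ℤ n) → exponent s (e ⊕ f) ≡ exponent s e ℤ.+ exponent s f
exponent-⊕ s       []      []      = ≡.refl
exponent-⊕ zero    (a ∷ e) (b ∷ f) = ≡.refl
exponent-⊕ (suc s) (a ∷ e) (b ∷ f) = exponent-⊕ s e f

exponent-insert0 : ∀ {n} s (e : Vec ℤ n) → s ℕ.≤ n → exponent s (insert0 s e) ≡ ℤ.0ℤ
exponent-insert0 zero    e       _         = ≡.refl
exponent-insert0 (suc s) (a ∷ e) (s≤s s≤n) = exponent-insert0 s e s≤n

module LaurentMaps (R : CommutativeRing 0ℓ 0ℓ) where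
  private module R = RingKit R
  open R using (Carrier; _≈_; _+_; _*_; -_; 0#; 1#; +-cong; +-congˡ; +-congʳ; *-cong; *-congˡ; *-congʳ;
    refl; sym; trans)
  open Laurent R

  swapVec-unit : ∀ n s i → suc s < n → swapVec s (unitVec n i) ≡ unitVec n (swapIx s i)
  swapVec-unit (suc (suc n)) zero    zero          _ = ≡.refl
  swapVec-unit (suc (suc n)) zero    (suc zero)    _ = ≡.refl
  swapVec-unit (suc (suc n)) zero    (suc (suc i)) _ = ≡.refl
  swapVec-unit (suc zero)    zero    i             (s≤s ())
  swapVec-unit (suc n)       (suc s) zero          (s≤s l) = ≡.cong (_ ∷_) (swapVec-0 s)
  swapVec-unit (suc n)       (suc s) (suc i)       (s≤s l) = ≡.cong (_ ∷_) (swapVec-unit n s i l)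

  insert0-unit : ∀ n s i → s ℕ.≤ n → insert0 s (unitVec n i) ≡ unitVec (suc n) (punch s i)
  insert0-unit n       zero    i       _         = ≡.refl
  insert0-unit (suc n) (suc s) zero    (s≤s s≤n) = ≡.cong (_ ∷_) (insert0-0 s)
  insert0-unit (suc n) (suc s) (suc i) (s≤s s≤n) = ≡.cong (_ ∷_) (insert0-unit n s i s≤n)

  exponent-unit : ∀ n s → s ℕ.≤ n → exponent s (unitVec (suc n) s) ≡ ℤ.1ℤ
  exponent-unit n       zero    _         = ≡.refl
  exponent-unit (suc n) (suc s) (s≤s s≤n) = exponent-unit n s s≤n

  δ-swapVec : ∀ {n} s (e : Vec ℤ n) → δ (swapVec s e) ≈ δ e
  δ-swapVec s       []          = refl
  δ-swapVec zero    (a ∷ [])    = refl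
  δ-swapVec zero    (a ∷ b ∷ e) =
    R.solve 3 (λ a b e → b R.:* (a R.:* e) R.:= a R.:* (b R.:* e)) refl (δ₁ a) (δ₁ b) (δ e)
  δ-swapVec (suc s) (a ∷ e)     = *-congˡ (δ-swapVec s e)

  δ-insert0 : ∀ {n} s (e : Vec ℤ n) → δ (insert0 s e) ≈ δ e
  δ-insert0 zero    e       = R.*-identityˡ _
  δ-insert0 (suc s) []      = R.*-identityˡ _
  δ-insert0 (suc s) (a ∷ e) = *-congˡ (δ-insert0 s e)

  swap-hom : ∀ {n} s → IsHom (ring n) (ring n) (push (swapVec s))
  swap-hom s = push-hom (swapVec s) (swapVec-0 s) (swapVec-⊕ s)

  insert-hom : ∀ {n} s → IsHom (ring n) (ring (suc n)) (push (insert0 s))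
  insert-hom s = push-hom (insert0 s) (insert0-0 s) (insert0-⊕ s)

  push-κ : ∀ {n m} (θ : Vec ℤ n → Vec ℤ m) → θ 0⃗ ≡ 0⃗ → ∀ c → push θ (κ c) ≋ κ c
  push-κ θ θ-0 c = evals (λ φ → +-congʳ (*-congˡ (R.reflexive (≡.cong φ θ-0))))

  -- The weightings that cannot see positive powers of the variable s. Against a Laurent polynomial
  -- without negative powers of this variable they see only its value at 0; δ is one of them.
  Vanishing : ∀ {n} → ℕ → (Vec ℤ n → Carrier) → Set
  Vanishing s φ = ∀ e → ℤ.0ℤ ℤ.< exponent s e → φ e ≈ 0#

  δ-vanishing : ∀ {n} s → Vanishing s (δ {n})
  δ-vanishing s       []          (ℤ.+<+ ())
  δ-vanishing zero    (+ suc a ∷ e) _ = R.zeroˡ _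
  δ-vanishing zero    (+ zero ∷ e) (ℤ.+<+ ())
  δ-vanishing (suc s) (a ∷ e)     l = trans (*-congˡ (δ-vanishing s e l)) (R.zeroʳ _)

  vanishing-shift : ∀ {n} s {φ : Vec ℤ n → Carrier} → Vanishing s φ → ∀ f → ℤ.0ℤ ℤ.≤ exponent s f →
    Vanishing s (λ e → φ (f ⊕ e))
  vanishing-shift s v f 0≤f e 0<e = v (f ⊕ e)
    (≡.subst (ℤ.0ℤ ℤ.<_) (≡.sym (exponent-⊕ s f e)) (ℤₚ.+-mono-≤-< 0≤f 0<e))

  vanishing-cong : ∀ {n} s {φ ψ : Vec ℤ n → Carrier} → (∀ e → φ e ≈ ψ e) → Vanishing s φ → Vanishing s ψ
  vanishing-cong s eq v e l = trans (sym (eq e)) (v e l)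

  -- f has no negative powers of the variable number s, and setting this variable to 0 turns f into g.
  infix 4 _↝[_]_
  record _↝[_]_ {n} (f : LPoly R (suc n)) (s : ℕ) (g : LPoly R n) : Set where
    constructor specialise
    field
      ↝-nonneg : ∀ φ → Vanishing s φ → Vanishing s (λ e → eval f (λ e′ → φ (e ⊕ e′)))
      ↝-eval   : ∀ φ → Vanishing s φ → eval f φ ≈ eval g (φ ∘ insert0 s)
  open _↝[_]_

  ↝-cong : ∀ {n s} {f f′ : LPoly R (suc n)} {g g′} → f ≋ f′ → g ≋ g′ → f ↝[ s ] g → f′ ↝[ s ] g′
  ↝-cong p q h = specialise
    (λ φ v → vanishing-cong _ (λ e → eval-≈ p _) (↝-nonneg h φ v))
    (λ φ v → trans (sym (eval-≈ p φ)) (trans (↝-eval h φ v) (eval-≈ q _)))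

  ↝-+ : ∀ {n s} {f f′ : LPoly R (suc n)} {g g′} → f ↝[ s ] g → f′ ↝[ s ] g′ → f ++ f′ ↝[ s ] g ++ g′
  ↝-+ {f = f} {f′} {g} {g′} h h′ = specialise
    (λ φ v e l → trans (eval-++ f f′ _)
      (trans (+-cong (↝-nonneg h φ v e l) (↝-nonneg h′ φ v e l)) (R.+-identityʳ 0#)))
    (λ φ v → trans (eval-++ f f′ φ) (trans (+-cong (↝-eval h φ v) (↝-eval h′ φ v)) (sym (eval-++ g g′ _))))

  -- By `↝-nonneg` the average of φ over the translates by f′ vanishes on positive powers again, so
  -- f may be specialised against it. The exponents of g are then inserted with entry 0 at s, and
  -- translation by them leaves φ vanishing, so f′ can be specialised as well.
  ↝-* : ∀ {n s} → s ℕ.≤ n → {f f′ : LPoly R (suc n)} {g g′ : LPoly R n} →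
    f ↝[ s ] g → f′ ↝[ s ] g′ → _⊗_ R f f′ ↝[ s ] _⊗_ R g g′
  ↝-* {s = s} s≤n {f} {f′} {g} {g′} h h′ = specialise
    (λ φ v → vanishing-cong s
      (λ e → sym (trans (eval-⊗ f f′ _) (eval-cong f (λ e′ → eval-cong f′ (λ e″ →
        R.reflexive (≡.cong φ (≡.sym (⊕-assoc e e′ e″))))))))
      (↝-nonneg h (λ e → eval f′ (λ e′ → φ (e ⊕ e′))) (↝-nonneg h′ φ v)))
    (λ φ v → trans (eval-⊗ f f′ φ) (trans (↝-eval h _ (↝-nonneg h′ φ v)) (trans
      (eval-cong g (λ e → trans
        (↝-eval h′ _ (vanishing-shift s v (insert0 s e) (ℤₚ.≤-reflexive (≡.sym (exponent-insert0 s e s≤n)))))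
        (eval-cong g′ (λ e′ → R.reflexive (≡.cong φ (≡.sym (insert0-⊕ s e e′)))))))
      (sym (eval-⊗ g g′ _)))))

  ↝-ι : ∀ {n s} (g : LPoly R n) → s ℕ.≤ n → push (insert0 s) g ↝[ s ] g
  ↝-ι {s = s} g s≤n = specialise
    (λ φ v e l → trans (eval-push (insert0 s) g _) (trans
      (eval-cong g (λ e′ → v (e ⊕ insert0 s e′) (≡.subst (ℤ.0ℤ ℤ.<_) (≡.sym
        (≡.trans (exponent-⊕ s e _) (≡.trans (≡.cong (λ t → exponent s e ℤ.+ t) (exponent-insert0 s e′ s≤n))
          (ℤₚ.+-identityʳ _)))) l))) (eval-0 g)))
    (λ φ v → eval-push (insert0 s) g φ)

  ↝-y : ∀ {n s} → s ℕ.≤ n → y (suc n) s ↝[ s ] []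
  ↝-y {n} {s} s≤n = specialise
    (λ φ v e l → zero-at φ v (e ⊕ unitVec (suc n) s) (≡.subst (ℤ.0ℤ ℤ.<_) (≡.sym
       (≡.trans (exponent-⊕ s e _) (≡.cong (λ t → exponent s e ℤ.+ t) (exponent-unit n s s≤n))))
       (ℤₚ.+-mono-<-≤ l (ℤ.+≤+ z≤n))))
    (λ φ v → zero-at φ v (unitVec (suc n) s) (≡.subst (ℤ.0ℤ ℤ.<_) (≡.sym (exponent-unit n s s≤n)) (ℤ.+<+ (s≤s z≤n))))
    where
    zero-at : ∀ φ → Vanishing s φ → ∀ e → ℤ.0ℤ ℤ.< exponent s e → 1# * φ e + 0# ≈ 0#
    zero-at φ v e l = trans (R.+-identityʳ _) (trans (*-congˡ (v e l)) (R.zeroʳ 1#))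

  CT-↝ : ∀ {n s} {f : LPoly R (suc n)} {f₀ : LPoly R n} (g : LPoly R n) → s ℕ.≤ n → f ↝[ s ] f₀ →
    CT (_⊗_ R f (push (insert0 s) g)) ≈ CT (_⊗_ R f₀ g)
  CT-↝ {s = s} {f} {f₀} g s≤n h = trans (↝-eval (↝-* s≤n h (↝-ι g s≤n)) δ (δ-vanishing s))
    (eval-cong (_⊗_ R f₀ g) (δ-insert0 s))

-- The recursion for constant terms

module MonotoneRows (R : CommutativeRing 0ℓ 0ℓ) (u v : CommutativeRing.Carrier R) (D : ℕ) where
  private module R = RingKit R
  open Laurent R
  open LaurentMaps R
  open RowWeights R u v D
  module S n = RingKit (ring n)
  module SV n = Vandermonde (ring n)
  module I n = Interlacing R (ring n) κ (κ-hom n) u v D (y n) (z n) (zy≋1 n)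

  -- the constant term for one fixed b; for n ≥ 2 the parts involving z alone form the alternant
  -- with exponents 0, 1, …, n-2, b+n-1
  ctRow : ∀ n → ℕ → Vec ℕ n → R.Carrier
  ctRow n b ks = CT (_⊗_ R (I.monomial n 0 ks)
    (_⊗_ R (SV.pairProd n n (λ i j → I.Q n (y n i) (y n j)))
      (_⊗_ R (SV.vdm n n (z n)) (SV.hom-sym n n b (z n)))))

  module Ant n = Antisymmetry R (ring n) κ (κ-hom n) u v D (y n) (z n) (zy≋1 n)

  module Alt n = Ant.ConstantTerm n CT (λ p → eval-≈ p δ) (λ f g → eval-++ f g δ) (λ f → eval-negate f δ)
    (λ c f → κ-⊗ c f δ) n (λ s → push (swapVec s)) swap-hom
    (λ s i l → mono-cong (swapVec-unit n s i l))
    (λ s i l → mono-cong (≡.trans (swapVec-map (λ x → ℤ.- x) s (unitVec n i)) (≡.cong negVec (swapVec-unit n s i l))))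
    (λ s → push-κ (swapVec s) (swapVec-0 s))
    (λ s f → R.trans (eval-push (swapVec s) f δ) (eval-cong f (δ-swapVec s)))

  module Elim n = Elimination R (ring (suc n)) (ring n) κ (κ-hom (suc n)) κ (κ-hom n) u v D
    (y (suc n)) (z (suc n)) (zy≋1 (suc n)) (y n) (z n) (zy≋1 n)

  module Subst n = Elim.Step n n CT CT (λ p → eval-≈ p δ) (λ p → eval-≈ p δ)
    (λ f g → eval-++ f g δ) (λ f g → eval-++ f g δ) R.refl R.refl
    (λ s → push (insert0 s)) insert-hom
    (λ s i s≤n → mono-cong (insert0-unit n s i s≤n))
    (λ s i s≤n → mono-cong (≡.trans (insert0-neg s (unitVec n i)) (≡.cong negVec (insert0-unit n s i s≤n))))
    (λ s → push-κ (insert0 s) (insert0-0 s))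
    _↝[_]_ ↝-cong ↝-+ ↝-* ↝-ι ↝-y CT-↝

  -- Both sides become the constant term of `expansion 0 ks` against the Q-product and the alternant
  -- in one variable fewer: the left by antisymmetry, the right by eliminating a variable from each
  -- Laplace term.
  ctRow-step : ∀ n b (ks : Vec ℕ (2 ℕ.+ n)) → Chain ks →
    rows (suc n) (λ r → rowWeight 0 r ks R.* ctRow (suc n) b r) R.≈ ctRow (2 ℕ.+ n) b ks
  ctRow-step n b ks chain = R.trans (Alt.row-expansion (suc n) b ks chain)
    (R.sym (Subst.eliminate-variable (suc n) b n ≡.refl ks))

-- The triangle sum, row by row

[i+j]-i≡j : ∀ i j → (i ℤ.+ j) ℤ.- i ≡ j
[i+j]-i≡j i j = ≡.trans (≡.cong (ℤ._- i) (ℤₚ.+-comm i j))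
  (≡.trans (ℤₚ.+-assoc j i (ℤ.- i)) (≡.trans (≡.cong (λ t → j ℤ.+ t) (ℤₚ.+-inverseʳ i)) (ℤₚ.+-identityʳ j)))

shiftBy : ∀ {l} → ℤ → Vec ℕ l → Vec ℤ l
shiftBy α = Vec.map (λ k → α ℤ.+ + k)

module ListSums (R : CommutativeRing 0ℓ 0ℓ) where
  open RingKit R

  Σ-cong : ∀ {A : Set} (xs : List A) {f g : A → Carrier} → (∀ x → f x ≈ g x) → Σ R xs f ≈ Σ R xs g
  Σ-cong []       eq = refl
  Σ-cong (x ∷ xs) eq = +-cong (eq x) (Σ-cong xs eq)

  Σ-++ : ∀ {A : Set} (xs ys : List A) (f : A → Carrier) → Σ R (xs ++ ys) f ≈ Σ R xs f + Σ R ys f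
  Σ-++ []       ys f = sym (+-identityˡ _)
  Σ-++ (x ∷ xs) ys f = trans (+-congˡ (Σ-++ xs ys f)) (sym (+-assoc _ _ _))

  Σ-map : ∀ {A B : Set} (g : A → B) (xs : List A) (f : B → Carrier) → Σ R (map g xs) f ≈ Σ R xs (f ∘ g)
  Σ-map g []       f = refl
  Σ-map g (x ∷ xs) f = +-congˡ (Σ-map g xs f)

  Σ-concatMap : ∀ {A B : Set} (g : A → List B) (xs : List A) (f : B → Carrier) →
    Σ R (concatMap g xs) f ≈ Σ R xs (λ x → Σ R (g x) f)
  Σ-concatMap g []       f = refl
  Σ-concatMap g (x ∷ xs) f = trans (Σ-++ (g x) (concatMap g xs) f) (+-congˡ (Σ-concatMap g xs f))

  Σ-applyUpTo : ∀ n (g : ℕ → ℕ) (f : ℕ → Carrier) → Σ R (applyUpTo g n) f ≈ sum n (f ∘ g)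
  Σ-applyUpTo zero    g f = refl
  Σ-applyUpTo (suc n) g f = +-congˡ (Σ-applyUpTo n (g ∘ suc) f)

  *-Σ : ∀ {A : Set} c (xs : List A) (f : A → Carrier) → c * Σ R xs f ≈ Σ R xs (λ x → c * f x)
  *-Σ c []       f = zeroʳ c
  *-Σ c (x ∷ xs) f = trans (distribˡ _ _ _) (+-congˡ (*-Σ c xs f))

  Σ-range : ∀ lo d (f : ℤ → Carrier) → Σ R (range lo (lo ℤ.+ + d)) f ≈ sum (suc d) (λ i → f (lo ℤ.+ + i))
  Σ-range lo d f rewrite [i+j]-i≡j lo (+ d) =
    trans (Σ-map (λ i → lo ℤ.+ + i) (upTo (suc d)) f) (Σ-applyUpTo (suc d) (λ i → i) (λ i → f (lo ℤ.+ + i)))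

module TriangleSum (R : CommutativeRing 0ℓ 0ℓ) (u v : CommutativeRing.Carrier R) (α : ℤ) (D a : ℕ) where
  open RingKit R
  open ListSums R
  open RowWeights R u v D
  open import Relation.Binary.Reasoning.Setoid setoid

  shift : ∀ {l} → Vec ℕ l → Vec ℤ l
  shift = shiftBy α

  β : ℤ
  β = α ℤ.+ + D

  triangles : ∀ {m} → Vec ℕ (suc m) → Carrier
  triangles {zero}  (k ∷ []) = [ k ≟ a ]
  triangles {suc m} ks       = rows (suc m) (λ r → rowWeight 0 r ks * triangles r)

  Σ-vecs : ∀ l (f : Vec ℤ l → Carrier) → Σ R (vecs α β l) f ≈ rows l (f ∘ shift)
  Σ-vecs zero    f = +-identityʳ _
  Σ-vecs (suc l) f = begin
    Σ R (vecs α β (suc l)) f ≈⟨ Σ-concatMap (λ x → map (x ∷_) (vecs α β l)) (range α β) f ⟩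
    Σ R (range α β) (λ x → Σ R (map (x ∷_) (vecs α β l)) f)
      ≈⟨ Σ-cong (range α β) (λ x → trans (Σ-map (x ∷_) (vecs α β l) f) (Σ-vecs l (λ r → f (x ∷ r)))) ⟩
    Σ R (range α β) (λ x → rows l (λ r → f (x ∷ shift r))) ≈⟨ Σ-range α D _ ⟩
    rows (suc l) (f ∘ shift) ∎

  rows-+ : ∀ l (F G : Vec ℕ l → Carrier) → rows l (λ r → F r + G r) ≈ rows l F + rows l G
  rows-+ zero    F G = refl
  rows-+ (suc l) F G = trans
    (sum-cong′ (suc D) {λ x → rows l (λ r → F (x ∷ r) + G (x ∷ r))} (λ x → rows-+ l _ _))
    (sum-+ (suc D) (λ x → rows l (λ r → F (x ∷ r))) (λ x → rows l (λ r → G (x ∷ r))))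

  rows-0 : ∀ l → rows l (λ _ → 0#) ≈ 0#
  rows-0 zero    = refl
  rows-0 (suc l) = trans (sum-cong′ (suc D) {λ _ → rows l (λ _ → 0#)} (λ _ → rows-0 l)) (sum-0 (suc D))

  Σ-rows : ∀ {A : Set} (xs : List A) l (F : A → Vec ℕ l → Carrier) →
    Σ R xs (λ x → rows l (F x)) ≈ rows l (λ r → Σ R xs (λ x → F x r))
  Σ-rows []       l F = sym (rows-0 l)
  Σ-rows (x ∷ xs) l F = trans (+-congˡ (Σ-rows xs l F)) (sym (rows-+ l (F x) _))

  pow-+ : ∀ x m n → pow R x (m ℕ.+ n) ≈ pow R x m * pow R x n
  pow-+ x zero    n = sym (*-identityˡ _)
  pow-+ x (suc m) n = trans (*-congˡ (pow-+ x m n)) (sym (*-assoc _ _ _))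

  -- Strictness of a row is charged to the pair in which it is the upper row, in agreement with
  -- `isMTᵇ`.
  pairWeight : ∀ {l} → Vec ℤ l → Vec ℤ (suc l) → Carrier
  pairWeight r s = if interlaceᵇ r s ∧ strictᵇ r then pow R u (invPair r s) * pow R v (inv'Pair r s) else 0#

  topWeight : ∀ {m} → Tri m → Vec ℤ (suc m) → Carrier
  topWeight t b = if isMTᵇ (t ▹ b) ∧ ⌊ top (t ▹ b) ℤ.≟ (α ℤ.+ + a) ⌋
    then pow R u (inv (t ▹ b)) * pow R v (inv' (t ▹ b)) else 0#

  if-split : ∀ (x y z : Bool) (p p′ q q′ : ℕ) →
    (if (x ∧ y) ∧ z then pow R u (p ℕ.+ p′) * pow R v (q ℕ.+ q′) else 0#)
    ≈ (if y then pow R u p′ * pow R v q′ else 0#) * (if x ∧ z then pow R u p * pow R v q else 0#)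
  if-split false y     z     p p′ q q′ = sym (zeroʳ _)
  if-split true  false z     p p′ q q′ = sym (zeroˡ _)
  if-split true  true  false p p′ q q′ = sym (zeroʳ _)
  if-split true  true  true  p p′ q q′ = trans (*-cong (pow-+ u p p′) (pow-+ v q q′))
    (solve 4 (λ a b c d → (a :* b) :* (c :* d) := (b :* d) :* (a :* c)) refl _ _ _ _)

  topWeight-▹ : ∀ {m} (t : Tri m) (r : Vec ℤ (suc m)) (b : Vec ℤ (2 ℕ.+ m)) →
    topWeight (t ▹ r) b ≈ pairWeight r b * topWeight t r
  topWeight-▹ t r b = if-split (isMTᵇ (t ▹ r)) (interlaceᵇ r b ∧ strictᵇ r) ⌊ top (t ▹ r) ℤ.≟ (α ℤ.+ + a) ⌋
    (inv (t ▹ r)) (invPair r b) (inv' (t ▹ r)) (inv'Pair r b)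

  shift-cancel-≤ : ∀ {k r} → α ℤ.+ + k ℤ.≤ α ℤ.+ + r → k ℕ.≤ r
  shift-cancel-≤ p = ℕₚ.≮⇒≥ (λ r<k → ℤₚ.<⇒≱ (ℤₚ.+-monoʳ-< α (ℤ.+<+ r<k)) p)

  shift-cancel-< : ∀ {k r} → α ℤ.+ + k ℤ.< α ℤ.+ + r → k < r
  shift-cancel-< p = ℕₚ.≰⇒> (λ r≤k → ℤₚ.≤⇒≯ (ℤₚ.+-monoʳ-≤ α (ℤ.+≤+ r≤k)) p)

  shift-≤ : ∀ k r → ((α ℤ.+ + k) ℤ.≤ᵇ (α ℤ.+ + r)) ≡ does (k ≤? r)
  shift-≤ k r = does-⇔ (mk⇔ shift-cancel-≤ (λ p → ℤₚ.+-monoʳ-≤ α (ℤ.+≤+ p)))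
    (map′ ℤₚ.≤ᵇ⇒≤ ℤₚ.≤⇒≤ᵇ (T? ((α ℤ.+ + k) ℤ.≤ᵇ (α ℤ.+ + r)))) (k ≤? r)

  shift-< : ∀ k r → ⌊ (α ℤ.+ + k) ℤ.<? (α ℤ.+ + r) ⌋ ≡ does (k <? r)
  shift-< k r = ≡.trans (isYes≗does ((α ℤ.+ + k) ℤ.<? (α ℤ.+ + r)))
    (does-⇔ (mk⇔ shift-cancel-< (λ p → ℤₚ.+-monoʳ-< α (ℤ.+<+ p))) ((α ℤ.+ + k) ℤ.<? (α ℤ.+ + r)) (k <? r))

  shift-≟ : ∀ k r → ⌊ (α ℤ.+ + k) ℤ.≟ (α ℤ.+ + r) ⌋ ≡ does (k ≟ r)
  shift-≟ k r = ≡.trans (isYes≗does ((α ℤ.+ + k) ℤ.≟ (α ℤ.+ + r)))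
    (does-⇔ (mk⇔ (λ p → ℤₚ.+-injective (∙-cancelˡ α (+ k) (+ r) p)) (≡.cong (λ t → α ℤ.+ + t)))
      ((α ℤ.+ + k) ℤ.≟ (α ℤ.+ + r)) (k ≟ r))
    where open import Algebra.Properties.AbelianGroup ℤₚ.+-0-abelianGroup using (∙-cancelˡ)

  above : ∀ {l} → ℕ → Vec ℕ l → Bool
  above p []       = true
  above p (r ∷ rs) = does (p ≤? r)

  strictᵇ-shift : ∀ {l} r (rs : Vec ℕ l) →
    strictᵇ (shift (r ∷ rs)) ≡ above (suc r) rs ∧ strictᵇ (shift rs)
  strictᵇ-shift r []        = ≡.refl
  strictᵇ-shift r (r′ ∷ rs) = ≡.cong (_∧ strictᵇ (shift (r′ ∷ rs))) (shift-< r r′)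

  pow-if : ∀ x (c : Bool) n → pow R x ((if c then 1 else 0) ℕ.+ n) ≈ (if c then x else 1#) * pow R x n
  pow-if x true  n = refl
  pow-if x false n = sym (*-identityˡ _)

  indicator : Bool → Carrier
  indicator c = if c then 1# else 0#

  weight-∷ : ∀ (p k k′ s i t : Bool) {x x′ y y′ z z′ : Carrier} → x ≈ y * z → x′ ≈ y′ * z′ →
    indicator p * (if (k ∧ (k′ ∧ i)) ∧ (s ∧ t) then x * x′ else 0#)
    ≈ (indicator p * ((indicator k * indicator k′) * (y * y′)))
      * (indicator s * (if i ∧ t then z * z′ else 0#))
  weight-∷ p false k′    s     i     t     _  _   =
    solve 4 (λ p k w r → p :* :0 := (p :* ((:0 :* k) :* w)) :* r) refl _ _ _ _
  weight-∷ p true  false s     i     t     _  _   =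
    solve 3 (λ p w r → p :* :0 := (p :* ((:1 :* :0) :* w)) :* r) refl _ _ _
  weight-∷ p true  true  s     false t     _  _   =
    solve 3 (λ p w r → p :* :0 := (p :* ((:1 :* :1) :* w)) :* (r :* :0)) refl _ _ _
  weight-∷ p true  true  false true  t     _  _   =
    solve 3 (λ p w r → p :* :0 := (p :* ((:1 :* :1) :* w)) :* (:0 :* r)) refl _ _ _
  weight-∷ p true  true  true  true  false _  _   =
    solve 2 (λ p w → p :* :0 := (p :* ((:1 :* :1) :* w)) :* (:1 :* :0)) refl _ _
  weight-∷ p true  true  true  true  true  eq eq′ = trans (*-congˡ (*-cong eq eq′))
    (solve 5 (λ p y z y′ z′ → p :* ((y :* z) :* (y′ :* z′)) :=
      (p :* ((:1 :* :1) :* (y :* y′))) :* (:1 :* (z :* z′))) refl _ _ _ _ _)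

  -- The comparisons of neighbours in `strictᵇ` are the running bounds suc r of `rowWeight`; only
  -- the initial bound p has no counterpart there and is kept as a separate indicator.
  rowWeight≈pairWeight : ∀ {l} p (r : Vec ℕ l) (ks : Vec ℕ (suc l)) →
    rowWeight p r ks ≈ indicator (above p r) * pairWeight (shift r) (shift ks)
  rowWeight≈pairWeight p []       (k ∷ [])           = solve 0 (:1 := :1 :* (:1 :* :1)) refl
  rowWeight≈pairWeight p (r ∷ rs) (k ∷ ks@(k′ ∷ _))
    rewrite shift-≤ k r | shift-≤ r k′ | strictᵇ-shift r rs | shift-≟ r k′ | shift-≟ r k =
    trans (*-congˡ (rowWeight≈pairWeight (suc r) rs ks))
      (sym (weight-∷ (does (p ≤? r)) (does (k ≤? r)) (does (r ≤? k′)) (above (suc r) rs)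
        (interlaceᵇ (shift rs) (shift ks)) (strictᵇ (shift rs))
        (pow-if u (does (r ≟ k′)) _) (pow-if v (does (r ≟ k)) _)))

  above-0 : ∀ {l} (r : Vec ℕ l) → above 0 r ≡ true
  above-0 []      = ≡.refl
  above-0 (_ ∷ _) = ≡.refl

  pairWeight≈rowWeight : ∀ {l} (r : Vec ℕ l) (ks : Vec ℕ (suc l)) →
    pairWeight (shift r) (shift ks) ≈ rowWeight 0 r ks
  pairWeight≈rowWeight r ks = sym (trans (rowWeight≈pairWeight 0 r ks)
    (trans (*-congʳ (reflexive (≡.cong indicator (above-0 r)))) (*-identityˡ _)))

  -- The weight of a triangle factors over pairs of neighbouring rows, so the lowest row of t can be
  -- split off and summed with the pair weight, leaving the same sum for a shorter triangle.
  mtSum≈triangles : ∀ m (ks : Vec ℕ (suc m)) →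
    mtSum R u v m (shift ks) (α ℤ.+ + a) α β ≈ triangles ks
  mtSum≈triangles zero (k ∷ []) = trans (+-identityʳ _) (base ⌊ (α ℤ.+ + k) ℤ.≟ (α ℤ.+ + a) ⌋ (shift-≟ k a))
    where
    base : ∀ c → c ≡ does (k ≟ a) → (if c then 1# * 1# else 0#) ≈ [ k ≟ a ]
    base false eq rewrite ≡.sym eq = refl
    base true  eq rewrite ≡.sym eq = *-identityˡ 1#
  mtSum≈triangles (suc m) ks = begin
    Σ R (tris α β (suc m)) (λ t → topWeight t (shift ks))
      ≈⟨ Σ-concatMap (λ t → map (t ▹_) (vecs α β (suc m))) (tris α β m) _ ⟩
    Σ R (tris α β m) (λ t → Σ R (map (t ▹_) (vecs α β (suc m))) (λ t → topWeight t (shift ks)))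
      ≈⟨ Σ-cong (tris α β m) (λ t → trans (Σ-map (t ▹_) (vecs α β (suc m)) _)
           (trans (Σ-vecs (suc m) _) (rows-cong (suc m) (λ r → trans (topWeight-▹ t (shift r) (shift ks))
             (*-congʳ (pairWeight≈rowWeight r ks)))))) ⟩
    Σ R (tris α β m) (λ t → rows (suc m) (λ r → rowWeight 0 r ks * topWeight t (shift r)))
      ≈⟨ Σ-rows (tris α β m) (suc m) (λ t r → rowWeight 0 r ks * topWeight t (shift r)) ⟩
    rows (suc m) (λ r → Σ R (tris α β m) (λ t → rowWeight 0 r ks * topWeight t (shift r)))
      ≈⟨ rows-cong (suc m) (λ r → trans (sym (*-Σ (rowWeight 0 r ks) (tris α β m) (λ t → topWeight t (shift r))))
           (*-congˡ (mtSum≈triangles m r))) ⟩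
    rows (suc m) (λ r → rowWeight 0 r ks * triangles r) ∎

-- Signs and generalized binomial coefficients

ℤ-ind : (P : ℤ → Set) → P ℤ.0ℤ → (∀ i → P i → P (ℤ.suc i)) → (∀ i → P (ℤ.suc i) → P i) → ∀ i → P i
ℤ-ind P z up down (+ zero)        = z
ℤ-ind P z up down (+ suc n)       = up (+ n) (ℤ-ind P z up down (+ n))
ℤ-ind P z up down -[1+ zero ]     = down -[1+ zero ] z
ℤ-ind P z up down -[1+ suc n ]    = down -[1+ suc n ] (ℤ-ind P z up down -[1+ n ])

nC0≡1 : ∀ n → n Comb.C 0 ≡ 1
nC0≡1 n = ≡.trans (nCk≡nC[n∸k] {0} {n} z≤n) (nCn≡1 n)

signℕ-suc : ∀ n → signℕ (suc n) ≡ ℤ.- signℕ n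
signℕ-suc zero          = ≡.refl
signℕ-suc (suc zero)    = ≡.refl
signℕ-suc (suc (suc n)) = signℕ-suc n

signℤ-suc : ∀ i → signℤ (ℤ.suc i) ≡ ℤ.- signℤ i
signℤ-suc (+ n)          = signℕ-suc n
signℤ-suc -[1+ zero ]    = ≡.refl
signℤ-suc -[1+ suc n ]   = signℕ-suc n

signℤ-double : ∀ i n → signℤ ((i ℤ.+ i) ℤ.+ + n) ≡ signℕ n
signℤ-double i n = ℤ-ind (λ i → signℤ ((i ℤ.+ i) ℤ.+ + n) ≡ signℕ n) ≡.refl
  (λ i p → ≡.trans (sym-suc i) p) (λ i p → ≡.trans (≡.sym (sym-suc i)) p) i
  where
  module Z = RingKit ℤₚ.+-*-commutativeRing
  sym-suc : ∀ i → signℤ ((ℤ.suc i ℤ.+ ℤ.suc i) ℤ.+ + n) ≡ signℤ ((i ℤ.+ i) ℤ.+ + n)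
  sym-suc i = ≡.trans (≡.cong signℤ (Z.solve 2 (λ i m → ((Z.:1 Z.:+ i) Z.:+ (Z.:1 Z.:+ i)) Z.:+ m Z.:=
      Z.:1 Z.:+ (Z.:1 Z.:+ ((i Z.:+ i) Z.:+ m))) ≡.refl i (+ n)))
    (≡.trans (signℤ-suc (ℤ.suc ((i ℤ.+ i) ℤ.+ + n))) (≡.trans (≡.cong ℤ.-_ (signℤ-suc ((i ℤ.+ i) ℤ.+ + n)))
      (ℤₚ.neg-involutive _)))

module GeneralizedBinomial where
  open RingKit ℤₚ.+-*-commutativeRing
  open ≡.≡-Reasoning

  gbin-0 : ∀ c → gbin c 0 ≡ ℤ.1ℤ
  gbin-0 (+ c)    = ≡.cong +_ (nC0≡1 c)
  gbin-0 -[1+ m ] = ≡.trans (ℤₚ.*-identityˡ _) (≡.cong +_ (nC0≡1 (m ℕ.+ 0)))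

  -- Multiplication of the series (1+x)^c by 1+x. The exponent -1 is a case of its own because its
  -- successor changes the clause of `gbin`.
  gbin-pascal : ∀ c k → gbin (ℤ.suc c) (suc k) ≡ gbin c (suc k) ℤ.+ gbin c k
  gbin-pascal (+ c) k = ≡.trans (≡.cong +_ (≡.sym (nCk+nC[k+1]≡[n+1]C[k+1] c k)))
    (ℤₚ.+-comm (+ (c Comb.C k)) (+ (c Comb.C suc k)))
  gbin-pascal -[1+ zero ] k = begin
    + (0 Comb.C suc k)                                     ≡⟨ ≡.cong +_ (k>n⇒nCk≡0 {0} {suc k} (s≤s z≤n)) ⟩
    ℤ.0ℤ                                              ≡⟨ solve 1 (λ s → :0 := (:- s) :* :1 :+ s :* :1) ≡.refl (signℕ k) ⟩
    (ℤ.- signℕ k) ℤ.* ℤ.1ℤ ℤ.+ signℕ k ℤ.* ℤ.1ℤ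
      ≡⟨ ≡.cong₂ ℤ._+_ (≡.cong₂ ℤ._*_ (signℕ-suc k) (≡.cong +_ (nCn≡1 (suc k))))
                       (≡.cong (λ t → signℕ k ℤ.* t) (≡.cong +_ (nCn≡1 k))) ⟨
    gbin -[1+ zero ] (suc k) ℤ.+ gbin -[1+ zero ] k ∎
  gbin-pascal -[1+ suc m ] k = begin
    signℕ (suc k) ℤ.* + ((m ℕ.+ suc k) Comb.C suc k)
      ≡⟨ ≡.cong₂ (λ s t → s ℤ.* + (t Comb.C suc k)) (signℕ-suc k) (+-suc m k) ⟩
    (ℤ.- signℕ k) ℤ.* + (N Comb.C suc k)
      ≡⟨ solve 3 (λ s a b → (:- s) :* b := (:- s) :* (a :+ b) :+ s :* a) ≡.refl (signℕ k) (+ (N Comb.C k)) (+ (N Comb.C suc k)) ⟩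
    (ℤ.- signℕ k) ℤ.* (+ (N Comb.C k ℕ.+ N Comb.C suc k)) ℤ.+ signℕ k ℤ.* + (N Comb.C k)
      ≡⟨ ≡.cong (λ t → (ℤ.- signℕ k) ℤ.* + t ℤ.+ signℕ k ℤ.* + (N Comb.C k)) (nCk+nC[k+1]≡[n+1]C[k+1] N k) ⟩
    (ℤ.- signℕ k) ℤ.* + (suc N Comb.C suc k) ℤ.+ signℕ k ℤ.* + (N Comb.C k)
      ≡⟨ ≡.cong (λ t → t ℤ.+ signℕ k ℤ.* + (N Comb.C k))
           (≡.cong₂ (λ s t → s ℤ.* + (t Comb.C suc k)) (signℕ-suc k) (≡.cong suc (+-suc m k))) ⟨
    gbin -[1+ suc m ] (suc k) ℤ.+ gbin -[1+ suc m ] k ∎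
    where N = suc (m ℕ.+ k)

  conv : ℤ → ℤ → ℕ → ℤ
  conv c d k = sum (suc k) (λ l → gbin c l ℤ.* gbin d (k ℕ.∸ l))

  coefProd≡conv : ∀ c d k → coefProd c d k ≡ conv c d k
  coefProd≡conv c d k = go (suc k) (λ l → l)
    where
    f : ℕ → ℤ
    f l = gbin c l ℤ.* gbin d (k ℕ.∸ l)
    go : ∀ n (g : ℕ → ℕ) → List.foldr ℤ._+_ ℤ.0ℤ (map f (applyUpTo g n)) ≡ sum n (f ∘ g)
    go zero    g = ≡.refl
    go (suc n) g = ≡.cong (λ t → f (g 0) ℤ.+ t) (go n (g ∘ suc))

  conv-pascal : ∀ c d k → conv (ℤ.suc c) d (suc k) ≡ conv c d (suc k) ℤ.+ conv c d k
  conv-pascal c d k = begin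
    gbin (ℤ.suc c) 0 ℤ.* gbin d (suc k) ℤ.+ sum (suc k) (λ l → gbin (ℤ.suc c) (suc l) ℤ.* gbin d (k ℕ.∸ l))
      ≡⟨ ≡.cong₂ ℤ._+_ (≡.cong (λ t → t ℤ.* gbin d (suc k)) (≡.trans (gbin-0 (ℤ.suc c)) (≡.sym (gbin-0 c))))
           (sum-cong′ (suc k) {λ l → gbin (ℤ.suc c) (suc l) ℤ.* gbin d (k ℕ.∸ l)} {λ l → f l ℤ.+ g l}
             (λ l → ≡.trans (≡.cong (λ t → t ℤ.* gbin d (k ℕ.∸ l)) (gbin-pascal c l))
               (ℤₚ.*-distribʳ-+ (gbin d (k ℕ.∸ l)) (gbin c (suc l)) (gbin c l)))) ⟩
    h ℤ.+ sum (suc k) (λ l → f l ℤ.+ g l) ≡⟨ ≡.cong (λ t → h ℤ.+ t) (sum-+ (suc k) f g) ⟩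
    h ℤ.+ (sum (suc k) f ℤ.+ sum (suc k) g) ≡⟨ ℤₚ.+-assoc h (sum (suc k) f) (sum (suc k) g) ⟨
    conv c d (suc k) ℤ.+ conv c d k ∎
    where
    h = gbin c 0 ℤ.* gbin d (suc k)
    f g : ℕ → ℤ
    f l = gbin c (suc l) ℤ.* gbin d (k ℕ.∸ l)
    g l = gbin c l ℤ.* gbin d (k ℕ.∸ l)

  conv-0 : ∀ c d → conv c d 0 ≡ ℤ.1ℤ
  conv-0 c d = ≡.cong₂ (λ s t → s ℤ.* t ℤ.+ ℤ.0ℤ) (gbin-0 c) (gbin-0 d)

  -- Both sides satisfy Pascal's rule in c and agree for c = 0. Upwards the rule determines the
  -- coefficients directly; downwards the coefficient at k+1 for c follows from those at k for c and
  -- at k+1 for c+1.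
  vandermonde : ∀ c d k → conv c d k ≡ gbin (c ℤ.+ d) k
  vandermonde = ℤ-ind _ base up down
    where
    suc-+ : ∀ c d → ℤ.suc c ℤ.+ d ≡ ℤ.suc (c ℤ.+ d)
    suc-+ c d = ℤₚ.+-assoc ℤ.1ℤ c d

    base : ∀ d k → conv ℤ.0ℤ d k ≡ gbin (ℤ.0ℤ ℤ.+ d) k
    base d k = begin
      gbin ℤ.0ℤ 0 ℤ.* gbin d k ℤ.+ sum k (λ l → gbin ℤ.0ℤ (suc l) ℤ.* gbin d (k ℕ.∸ suc l))
        ≡⟨ ≡.cong₂ (λ s t → s ℤ.* gbin d k ℤ.+ t) (gbin-0 ℤ.0ℤ) (≡.trans
             (sum-cong′ k {λ l → gbin ℤ.0ℤ (suc l) ℤ.* gbin d (k ℕ.∸ suc l)}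
               (λ l → ≡.cong (λ t → + t ℤ.* gbin d (k ℕ.∸ suc l)) (k>n⇒nCk≡0 {0} {suc l} (s≤s z≤n)))) (sum-0 k)) ⟩
      ℤ.1ℤ ℤ.* gbin d k ℤ.+ ℤ.0ℤ ≡⟨ ≡.trans (ℤₚ.+-identityʳ _) (ℤₚ.*-identityˡ _) ⟩
      gbin d k ≡⟨ ≡.cong (λ t → gbin t k) (ℤₚ.+-identityˡ d) ⟨
      gbin (ℤ.0ℤ ℤ.+ d) k ∎

    up : ∀ c → (∀ d k → conv c d k ≡ gbin (c ℤ.+ d) k) → ∀ d k → conv (ℤ.suc c) d k ≡ gbin (ℤ.suc c ℤ.+ d) k
    up c ih d zero    = ≡.trans (conv-0 (ℤ.suc c) d) (≡.sym (gbin-0 (ℤ.suc c ℤ.+ d)))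
    up c ih d (suc k) = begin
      conv (ℤ.suc c) d (suc k)                         ≡⟨ conv-pascal c d k ⟩
      conv c d (suc k) ℤ.+ conv c d k                  ≡⟨ ≡.cong₂ ℤ._+_ (ih d (suc k)) (ih d k) ⟩
      gbin (c ℤ.+ d) (suc k) ℤ.+ gbin (c ℤ.+ d) k      ≡⟨ gbin-pascal (c ℤ.+ d) k ⟨
      gbin (ℤ.suc (c ℤ.+ d)) (suc k)                   ≡⟨ ≡.cong (λ t → gbin t (suc k)) (suc-+ c d) ⟨
      gbin (ℤ.suc c ℤ.+ d) (suc k)                     ∎

    down : ∀ c → (∀ d k → conv (ℤ.suc c) d k ≡ gbin (ℤ.suc c ℤ.+ d) k) → ∀ d k → conv c d k ≡ gbin (c ℤ.+ d) k
    down c ih d zero    = ≡.trans (conv-0 c d) (≡.sym (gbin-0 (c ℤ.+ d)))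
    -- The term at k, already known for c, is added on both sides and cancelled at the end.
    down c ih d (suc k) = +-cancelʳ (gbin (c ℤ.+ d) k) _ _ (begin
      conv c d (suc k) ℤ.+ gbin (c ℤ.+ d) k            ≡⟨ ≡.cong (λ t → conv c d (suc k) ℤ.+ t) (down c ih d k) ⟨
      conv c d (suc k) ℤ.+ conv c d k                  ≡⟨ conv-pascal c d k ⟨
      conv (ℤ.suc c) d (suc k)                         ≡⟨ ih d (suc k) ⟩
      gbin (ℤ.suc c ℤ.+ d) (suc k)                     ≡⟨ ≡.cong (λ t → gbin t (suc k)) (suc-+ c d) ⟩
      gbin (ℤ.suc (c ℤ.+ d)) (suc k)                   ≡⟨ gbin-pascal (c ℤ.+ d) k ⟩
      gbin (c ℤ.+ d) (suc k) ℤ.+ gbin (c ℤ.+ d) k      ∎)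
      where open import Algebra.Properties.AbelianGroup ℤₚ.+-0-abelianGroup using () renaming (∙-cancelʳ to +-cancelʳ)

  coefProd≡gbin : ∀ c d k → coefProd c d k ≡ gbin (c ℤ.+ d) k
  coefProd≡gbin c d k = ≡.trans (coefProd≡conv c d k) (vandermonde c d k)

-- Binomial inversion

module BinomialInversion (R : CommutativeRing 0ℓ 0ℓ) where
  open RingKit R
  open Vandermonde R using (sgn)
  open import Relation.Binary.Reasoning.Setoid setoid

  binom : ℕ → ℕ → Carrier
  binom n       zero    = 1#
  binom zero    (suc k) = 0#
  binom (suc n) (suc k) = binom n k + binom n (suc k)

  fromℕ-C : ∀ n k → fromℕ R (n Comb.C k) ≈ binom n k
  fromℕ-C n       zero    = trans (reflexive (≡.cong (fromℕ R) (nC0≡1 n))) (+-identityʳ 1#)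
  fromℕ-C zero    (suc k) = reflexive (≡.cong (fromℕ R) (k>n⇒nCk≡0 {0} {suc k} (s≤s z≤n)))
  fromℕ-C (suc n) (suc k) = trans (reflexive (≡.cong (fromℕ R) (≡.sym (nCk+nC[k+1]≡[n+1]C[k+1] n k))))
    (trans (fromℕ-+ (n Comb.C k) (n Comb.C suc k)) (+-cong (fromℕ-C n k) (fromℕ-C n (suc k))))

  fromℤ-signℕ : ∀ n → fromℤ R (signℕ n) ≈ sgn n
  fromℤ-signℕ zero    = +-identityʳ 1#
  fromℤ-signℕ (suc n) = trans (reflexive (≡.cong (fromℤ R) (signℕ-suc n)))
    (trans (fromℤ-neg (signℕ n)) (-‿cong (fromℤ-signℕ n)))

  kron : ℕ → ℕ → Carrier
  kron k a = if does (k ≟ a) then 1# else 0#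

  invTerm : ℕ → ℕ → ℕ → Carrier
  invTerm k a b = (sgn (a ℕ.+ b) * binom b a) * binom k b

  -- Induction on k by Pascal's rule for binom k b, and then for binom (suc b) a. Terms with b > k
  -- vanish, so any bound N > k serves; the induction hypothesis is used both with the full range
  -- and with the range shortened by one.
  binomial-inversion : ∀ N k a → k < N → sum N (invTerm k a) ≈ kron k a
  binomial-inversion (suc N) zero a _ = begin
    (sgn (a ℕ.+ 0) * binom 0 a) * 1# + sum N (invTerm 0 a ∘ suc)
      ≈⟨ +-cong (*-identityʳ _) (trans (sum-cong′ N {invTerm 0 a ∘ suc} (λ b → zeroʳ _)) (sum-0 N)) ⟩
    sgn (a ℕ.+ 0) * binom 0 a + 0# ≈⟨ +-identityʳ _ ⟩
    sgn (a ℕ.+ 0) * binom 0 a      ≈⟨ first a ⟩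
    kron 0 a ∎
    where
    first : ∀ a → sgn (a ℕ.+ 0) * binom 0 a ≈ kron 0 a
    first zero    = *-identityʳ 1#
    first (suc a) = zeroʳ _
  binomial-inversion (suc N) (suc k) a (s≤s k<N) = begin
    first-term a + sum N (λ b → (s a b) * (binom k b + binom k (suc b)))
      ≈⟨ +-congˡ (trans (sum-cong′ N {λ b → s a b * (binom k b + binom k (suc b))}
           (λ b → distribˡ (s a b) (binom k b) (binom k (suc b)))) (sum-+ N (new a) old)) ⟩
    first-term a + (sum N (new a) + sum N old)
      ≈⟨ solve 3 (λ h n o → h :+ (n :+ o) := (h :+ o) :+ n) refl (first-term a) (sum N (new a)) (sum N old) ⟩
    (first-term a + sum N old) + sum N (new a)
      -- The first term together with the old terms is the complete sum for k.
      ≈⟨ +-cong (binomial-inversion (suc N) k a (ℕₚ.m≤n⇒m≤1+n k<N)) (news a) ⟩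
    kron k a + (kron′ a - kron k a)
      ≈⟨ solve 2 (λ x y → x :+ (y :- x) := y) refl (kron k a) (kron′ a) ⟩
    kron′ a ≈⟨ result a ⟩
    kron (suc k) a ∎
    where
    first-term : ℕ → Carrier
    first-term a = (sgn (a ℕ.+ 0) * binom 0 a) * 1#
    s new : ℕ → ℕ → Carrier
    s a b = sgn (a ℕ.+ suc b) * binom (suc b) a
    new a b = s a b * binom k b
    old : ℕ → Carrier
    old b = s a b * binom k (suc b)
    kron′ : ℕ → Carrier
    kron′ zero    = 0#
    kron′ (suc a) = kron k a
    result : ∀ a → kron′ a ≈ kron (suc k) a
    result zero    = refl
    result (suc a) = refl
    sgn-suc : ∀ a b → sgn (a ℕ.+ suc b) ≈ - sgn (a ℕ.+ b)
    sgn-suc a b = reflexive (≡.cong sgn (+-suc a b))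
    news : ∀ a → sum N (new a) ≈ kron′ a - kron k a
    news zero = begin
      sum N (new 0)
        ≈⟨ sum-cong′ N {new 0} {λ b → - invTerm k 0 b}
             (λ b → solve 2 (λ s x → ((:- s) :* :1) :* x := :- ((s :* :1) :* x)) refl (sgn b) (binom k b)) ⟩
      sum N (λ b → - invTerm k 0 b) ≈⟨ sum-neg N (invTerm k 0) ⟩
      - sum N (invTerm k 0)         ≈⟨ -‿cong (binomial-inversion N k 0 k<N) ⟩
      - kron k 0                    ≈⟨ +-identityˡ _ ⟨
      0# - kron k 0 ∎
    news (suc a) = begin
      sum N (new (suc a))
        ≈⟨ sum-cong′ N {new (suc a)} {λ b → invTerm k a b + - invTerm k (suc a) b} (λ b → trans
             (*-congʳ (*-congʳ (-‿cong (sgn-suc a b))))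
             (solve 4 (λ e x y w → (:- (:- e) :* (x :+ y)) :* w := (e :* x) :* w :+ :- (((:- e) :* y) :* w))
               refl (sgn (a ℕ.+ b)) (binom b a) (binom b (suc a)) (binom k b))) ⟩
      sum N (λ b → invTerm k a b + - invTerm k (suc a) b)
        ≈⟨ trans (sum-+ N (invTerm k a) (λ b → - invTerm k (suc a) b)) (+-congˡ (sum-neg N (invTerm k (suc a)))) ⟩
      sum N (invTerm k a) - sum N (invTerm k (suc a))
        ≈⟨ +-cong (binomial-inversion N k a k<N) (-‿cong (binomial-inversion N k (suc a) k<N)) ⟩
      kron k a - kron k (suc a) ∎

-- Products over pairs and expansion in one variable

module SymmetricProducts (S : CommutativeRing 0ℓ 0ℓ) where
  open RingKit S
  open Vandermonde S
  open import Relation.Binary.Reasoning.Setoid setoid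

  prod-const : ∀ n x → prod n (λ _ → x) ≈ x ^ n
  prod-const zero    x = refl
  prod-const (suc n) x = *-congˡ (prod-const n x)

  -- Each of the n+1 variables lies in n pairs. Hence the prefactor ∏ x_i^(-n) distributes over the
  -- pairs, one z i * z j for each.
  pairProd-separate : ∀ n (z : ℕ → Carrier) →
    pairProd (suc n) (λ i j → z i * z j) ≈ prod (suc n) (λ i → z i ^ n)
  pairProd-separate zero    z = refl
  pairProd-separate (suc n) z = begin
    prod (suc n) (λ j → z 0 * z (suc j)) * pairProd (suc n) (λ i j → z (suc i) * z (suc j))
      ≈⟨ *-cong (trans (prod-* (suc n) (λ _ → z 0) (z ∘ suc)) (*-congʳ (prod-const (suc n) (z 0))))
                (pairProd-separate n (z ∘ suc)) ⟩
    (z 0 ^ suc n * prod (suc n) (z ∘ suc)) * prod (suc n) (λ i → z (suc i) ^ n)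
      ≈⟨ trans (*-assoc _ _ _) (*-congˡ (sym (prod-* (suc n) (z ∘ suc) (λ i → z (suc i) ^ n)))) ⟩
    prod (2 ℕ.+ n) (λ i → z i ^ suc n) ∎

  vdm-inverse : ∀ n (y z : ℕ → Carrier) → (∀ i → z i * y i ≈ 1#) →
    pairProd n (λ i j → z i * z j) * pairProd n (λ i j → y i - y j) ≈ vdm n z
  vdm-inverse n y z zy≈1 = trans (sym (pairProd-* n (λ i j → z i * z j) (λ i j → y i - y j)))
    (pairProd-cong n (λ i j → begin
      (z i * z j) * (y i - y j)
        ≈⟨ solve 4 (λ a b c d → (a :* b) :* (c :- d) := (a :* c) :* b :- (b :* d) :* a) refl (z i) (z j) (y i) (y j) ⟩
      (z i * y i) * z j - (z j * y j) * z i
        ≈⟨ +-cong (trans (*-congʳ (zy≈1 i)) (*-identityˡ _)) (-‿cong (trans (*-congʳ (zy≈1 j)) (*-identityˡ _))) ⟩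
      z j - z i ∎))

  -- The recursion unrolled in the first variable, which is the form in which `compositions` lists
  -- the exponents.
  hom-sym-expand : ∀ n b (z : ℕ → Carrier) →
    hom-sym (suc n) b z ≈ sum (suc b) (λ k → z 0 ^ k * hom-sym n (b ℕ.∸ k) (z ∘ suc))
  hom-sym-expand n zero    z = sym (trans (+-identityʳ _) (*-identityˡ _))
  hom-sym-expand n (suc b) z = +-cong (sym (*-identityˡ _)) (begin
    z 0 * hom-sym (suc n) b z ≈⟨ *-congˡ (hom-sym-expand n b z) ⟩
    z 0 * sum (suc b) t       ≈⟨ *-sum (suc b) (z 0) t ⟩
    sum (suc b) (λ k → z 0 * t k)
      ≈⟨ sum-cong′ (suc b) {λ k → z 0 * t k} {λ k → (z 0 * z 0 ^ k) * hom-sym n (b ℕ.∸ k) (z ∘ suc)}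
           (λ k → sym (*-assoc _ _ _)) ⟩
    sum (suc b) (λ k → (z 0 * z 0 ^ k) * hom-sym n (b ℕ.∸ k) (z ∘ suc)) ∎)
    where
    t : ℕ → Carrier
    t k = z 0 ^ k * hom-sym n (b ℕ.∸ k) (z ∘ suc)

  hom-sym-1 : ∀ b (z : ℕ → Carrier) → hom-sym 1 b z ≈ z 0 ^ b
  hom-sym-1 zero    z = refl
  hom-sym-1 (suc b) z = trans (+-identityˡ _) (*-congˡ (hom-sym-1 b z))

  drop-units : ∀ h → (1# * 1#) * ((1# * 1#) * h) ≈ h
  drop-units = solve 1 (λ h → (:1 :* :1) :* ((:1 :* :1) :* h) := h) refl

  distribute : ∀ N m a b q (k h : ℕ → Carrier) →
    m * (a * ((b * q) * sum N (λ i → k i * h i))) ≈ sum N (λ i → k i * (m * (q * ((a * b) * h i))))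
  distribute N m a b q k h = begin
    m * (a * ((b * q) * sum N (λ i → k i * h i)))
      ≈⟨ solve 5 (λ m a b q s → m :* (a :* ((b :* q) :* s)) := (m :* (q :* (a :* b))) :* s) refl m a b q _ ⟩
    (m * (q * (a * b))) * sum N (λ i → k i * h i) ≈⟨ *-sum N _ (λ i → k i * h i) ⟩
    sum N (λ i → (m * (q * (a * b))) * (k i * h i))
      ≈⟨ sum-cong′ N (λ i → solve 6 (λ m q a b k h → (m :* (q :* (a :* b))) :* (k :* h) :=
           k :* (m :* (q :* ((a :* b) :* h)))) refl m q a b (k i) (h i)) ⟩
    sum N (λ i → k i * (m * (q * ((a * b) * h i)))) ∎

  -- The square product is the form that `pairs` takes once its filter i < j has become a default
  -- factor 1#.
  pairProd-conditional : ∀ n (F : ℕ → ℕ → Carrier) →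
    prod n (λ i → prod n (λ j → if does (i <? j) then F i j else 1#)) ≈ pairProd n F
  pairProd-conditional zero    F = refl
  pairProd-conditional (suc n) F = *-cong (*-identityˡ _)
    (trans (prod-cong′ n (λ i → *-identityˡ _)) (pairProd-conditional n (λ i j → F (suc i) (suc j))))

-- The constant term expression of the statement

module LaurentPart (R : CommutativeRing 0ℓ 0ℓ) (u v : CommutativeRing.Carrier R) (D : ℕ) where
  private module R = RingKit R
  open R using (Carrier; _≈_; _+_; _*_; -_; _-_; 0#; 1#; +-cong; +-congˡ; +-congʳ; *-cong; *-congˡ; *-congʳ;
    refl; sym; trans)
  open Laurent R
  open LaurentMaps R
  open MonotoneRows R u v D
  open ListSums R
  open BinomialInversion R using (binom; fromℕ-C)
  open import Relation.Binary.Reasoning.Setoid R.setoid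
  module SP n = SymmetricProducts (ring n)

  -- The coefficient of x^(-e) in (1+x)^k, that is, the constant term of (1+x)^k x^e. The recursion
  -- is multiplication by 1+x, and working with all integers e avoids a case distinction on the sign
  -- of the exponent.
  coef : ℕ → ℤ → Carrier
  coef zero    e = δ₁ e
  coef (suc k) e = coef k e + coef k (ℤ.suc e)

  coef-positive : ∀ k j → coef k (+ suc j) ≈ 0#
  coef-positive zero    j = refl
  coef-positive (suc k) j = trans (+-cong (coef-positive k j) (coef-positive k (suc j))) (R.+-identityʳ 0#)

  coef-negative : ∀ k j → coef k (ℤ.- (+ j)) ≈ binom k j
  coef-negative zero    zero    = refl
  coef-negative zero    (suc j) = refl
  coef-negative (suc k) zero    = trans (+-cong (coef-negative k zero) (coef-positive k 0)) (R.+-identityʳ 1#)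
  coef-negative (suc k) (suc j) = trans (+-cong (coef-negative k (suc j))
    (trans (R.reflexive (≡.cong (coef k) (suc-neg j))) (coef-negative k j))) (R.+-comm _ _)
    where
    suc-neg : ∀ j → ℤ.suc -[1+ j ] ≡ ℤ.- (+ j)
    suc-neg zero    = ≡.refl
    suc-neg (suc j) = ≡.refl

  coefs : ∀ {n} → Vec ℕ n → Vec ℤ n → Carrier
  coefs []       []      = 1#
  coefs (k ∷ ks) (x ∷ e) = coef k x * coefs ks e

  -- G is free of the first variable, so the first coordinate of the exponent meets only the power
  -- of X; each factor X leaves this coordinate unchanged or raises it by 1, as in the recursion of
  -- `coef`.
  eval-X^ : ∀ n k x (G : LPoly R n) (e : Vec ℤ n) →
    eval (_⊗_ R (S._^_ (suc n) (I.X (suc n) 0) k) (push (insert0 0) G)) (λ f → δ (f ⊕ (x ∷ e)))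
    ≈ coef k x * eval G (λ g → δ (g ⊕ e))
  eval-X^ n zero x G e = begin
    eval (_⊗_ R (one R) (push (insert0 0) G)) (λ f → δ (f ⊕ (x ∷ e))) ≈⟨ eval-≈ (⊗-identityˡ (push (insert0 0) G)) _ ⟩
    eval (push (insert0 0) G) (λ f → δ (f ⊕ (x ∷ e))) ≈⟨ eval-push (insert0 0) G _ ⟩
    eval G (λ g → δ₁ (ℤ.0ℤ ℤ.+ x) * δ (g ⊕ e))
      ≈⟨ eval-cong G (λ g → *-congʳ (R.reflexive (≡.cong δ₁ (ℤₚ.+-identityˡ x)))) ⟩
    eval G (λ g → δ₁ x * δ (g ⊕ e)) ≈⟨ eval-* G (δ₁ x) _ ⟩
    δ₁ x * eval G (λ g → δ (g ⊕ e)) ∎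
  eval-X^ n (suc k) x G e = begin
    eval (_⊗_ R (_⊗_ R X (S._^_ (suc n) X k)) P) φ ≈⟨ eval-≈ (⊗-assoc X (S._^_ (suc n) X k) P) φ ⟩
    eval (_⊗_ R (one R ++ y (suc n) 0) W) φ
      ≈⟨ eval-≈ (S.distribʳ (suc n) W (one R) (y (suc n) 0)) φ ⟩
    eval (_⊗_ R (one R) W ++ _⊗_ R (y (suc n) 0) W) φ
      ≈⟨ trans (eval-++ (_⊗_ R (one R) W) _ φ) (+-cong (eval-≈ (⊗-identityˡ W) φ) (mono-⊗ (unitVec (suc n) 0) W φ)) ⟩
    eval W φ + eval W (λ f → φ (unitVec (suc n) 0 ⊕ f))
      ≈⟨ +-congˡ (eval-cong W (λ f → R.reflexive (≡.cong δ (moved f)))) ⟩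
    eval W φ + eval W (λ f → δ (f ⊕ (ℤ.suc x ∷ e)))
      ≈⟨ +-cong (eval-X^ n k x G e) (eval-X^ n k (ℤ.suc x) G e) ⟩
    coef k x * E + coef k (ℤ.suc x) * E ≈⟨ R.distribʳ _ _ _ ⟨
    coef (suc k) x * E ∎
    where
    X P W : LPoly R (suc n)
    X = I.X (suc n) 0
    P = push (insert0 0) G
    W = _⊗_ R (S._^_ (suc n) X k) P
    φ : Vec ℤ (suc n) → Carrier
    φ f = δ (f ⊕ (x ∷ e))
    E = eval G (λ g → δ (g ⊕ e))
    moved : ∀ f → (unitVec (suc n) 0 ⊕ f) ⊕ (x ∷ e) ≡ f ⊕ (ℤ.suc x ∷ e)
    moved (t ∷ f) = ≡.cong₂ _∷_
      (≡.trans (≡.cong (ℤ._+ x) (ℤₚ.+-comm ℤ.1ℤ t)) (ℤₚ.+-assoc t ℤ.1ℤ x))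
      (≡.cong (_⊕ e) (⊕-identityˡ f))

  module N n = Naturality (ring n) (ring (suc n)) (push (insert0 0)) (insert-hom 0)

  eval-prod-X : ∀ {n} (ks : Vec ℕ n) (e : Vec ℤ n) →
    eval (S.prod n n (λ j → S._^_ n (I.X n j) (at ks j))) (λ f → δ (f ⊕ e)) ≈ coefs ks e
  eval-prod-X []               []      = trans (R.+-identityʳ _) (R.*-identityˡ _)
  eval-prod-X {suc n} (k ∷ ks) (x ∷ e) = begin
    eval (_⊗_ R (S._^_ (suc n) (I.X (suc n) 0) k) (S.prod (suc n) n (λ j → S._^_ (suc n) (I.X (suc n) (suc j)) (at ks j)))) φ
      ≈⟨ eval-≈ (S.*-congˡ (suc n) {S._^_ (suc n) (I.X (suc n) 0) k} (S.sym (suc n) (S.trans (suc n)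
           (N.h-prod n n (λ j → S._^_ n (I.X n j) (at ks j)))
           (S.prod-cong′ (suc n) n (λ j → N.h-^ n (at ks j) (I.X n j)))))) φ ⟩
    eval (_⊗_ R (S._^_ (suc n) (I.X (suc n) 0) k) (push (insert0 0) G)) φ ≈⟨ eval-X^ n k x G e ⟩
    coef k x * eval G (λ g → δ (g ⊕ e)) ≈⟨ *-congˡ (eval-prod-X ks e) ⟩
    coef k x * coefs ks e ∎
    where
    φ : Vec ℤ (suc n) → Carrier
    φ f = δ (f ⊕ (x ∷ e))
    G = S.prod n n (λ j → S._^_ n (I.X n j) (at ks j))

  eval-monomial : ∀ {n} (ks : Vec ℕ n) (e : Vec ℤ n) →
    eval (I.monomial n 0 ks) (λ f → δ (f ⊕ e)) ≈ coefs ks e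
  eval-monomial {n} ks e = trans (eval-≈ (S.trans n (I.monomial-prod n 0 ks)
    (S.prod-cong′ n n (λ j → S.reflexive n (≡.cong (λ r → S._^_ n (I.X n r) (at ks j)) (ℕₚ.+-identityʳ j))))) _)
    (eval-prod-X ks e)

  -- Turns the coefficient extraction of `ctExpr`, variable by variable, into the constant term of a
  -- product in the group ring, where the recursion applies.
  eval-coefs : ∀ {n} (ks : Vec ℕ n) (P : LPoly R n) → eval P (coefs ks) ≈ CT (_⊗_ R (I.monomial n 0 ks) P)
  eval-coefs {n} ks P = begin
    eval P (coefs ks)
      ≈⟨ eval-cong P (λ e → trans (sym (eval-monomial ks e))
           (eval-cong (I.monomial n 0 ks) (λ f → R.reflexive (≡.cong δ (⊕-comm f e))))) ⟩
    eval P (λ e → eval (I.monomial n 0 ks) (λ f → δ (e ⊕ f))) ≈⟨ eval-⊗ P (I.monomial n 0 ks) δ ⟨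
    CT (_⊗_ R P (I.monomial n 0 ks)) ≈⟨ eval-≈ (⊗-comm P (I.monomial n 0 ks)) δ ⟩
    CT (_⊗_ R (I.monomial n 0 ks) P) ∎

  -- The point where power series disappear: by the Vandermonde convolution (1+x)^(α+k) (1+x)^(-α)
  -- has the coefficients of (1+x)^k with k a natural number.
  fromℤ-coefProd : ∀ α k j → fromℤ R (coefProd (α ℤ.+ + k) (ℤ.- α) j) ≈ coef k (ℤ.- (+ j))
  fromℤ-coefProd α k j = trans (R.reflexive (≡.cong (fromℤ R) (≡.trans
      (GeneralizedBinomial.coefProd≡gbin (α ℤ.+ + k) (ℤ.- α) j) (≡.cong (λ t → gbin t j) ([i+j]-i≡j α (+ k))))))
    (trans (fromℕ-C k j) (sym (coef-negative k j)))

  seriesCoef≈coef : ∀ α k x → seriesCoef R (α ℤ.+ + k) (ℤ.- α) (ℤ.- x) ≈ coef k x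
  seriesCoef≈coef α k (+ suc x)  = sym (coef-positive k x)
  seriesCoef≈coef α k (+ zero)   = fromℤ-coefProd α k 0
  seriesCoef≈coef α k -[1+ x ]   = fromℤ-coefProd α k (suc x)

  foldr-coefs : ∀ {n N} α (ks : Vec ℕ n) (e : Vec ℤ n) (g : Fin n → Fin N) (f : Fin N → Carrier) →
    (∀ i → f (g i) ≈ seriesCoef R (lookup (shiftBy α ks) i) (ℤ.- α) (ℤ.- lookup e i)) →
    List.foldr _*_ 1# (map f (List.tabulate g)) ≈ coefs ks e
  foldr-coefs α []       []      g f eq = refl
  foldr-coefs α (k ∷ ks) (x ∷ e) g f eq = *-cong (trans (eq Fin.zero) (seriesCoef≈coef α k x))
    (foldr-coefs α ks e (g ∘ Fin.suc) f (eq ∘ Fin.suc))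

  Σ-eval : ∀ {n} (P : LPoly R n) (F : Carrier × Vec ℤ n → Carrier) (φ : Vec ℤ n → Carrier) →
    (∀ c e → F (c , e) ≈ c * φ e) → Σ R P F ≈ eval P φ
  Σ-eval []            F φ eq = refl
  Σ-eval ((c , e) ∷ P) F φ eq = +-cong (eq c e) (Σ-eval P F φ eq)

  ctExpr≈CT : ∀ m (ks : Vec ℕ (suc m)) a α β →
    ctExpr R u v m (shiftBy α ks) a α β ≈ CT (_⊗_ R (I.monomial (suc m) 0 ks) (laurentPart R u v (suc m) a α β))
  ctExpr≈CT m ks a α β = trans
    (Σ-eval (laurentPart R u v (suc m) a α β) _ (coefs ks)
      (λ c e → *-congˡ (foldr-coefs α ks e (λ i → i) _ (λ i → refl))))
    (eval-coefs ks (laurentPart R u v (suc m) a α β))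

  tabulate-0 : ∀ n → Vec.tabulate {n = n} (λ _ → ℤ.0ℤ) ≡ 0⃗
  tabulate-0 zero    = ≡.refl
  tabulate-0 (suc n) = ≡.cong (_ ∷_) (tabulate-0 n)

  unit≡unitVec : ∀ {n} (i : Fin n) → unit i ≡ unitVec n (toℕ i)
  unit≡unitVec {suc n} Fin.zero    = ≡.cong (_ ∷_) (tabulate-0 n)
  unit≡unitVec {suc n} (Fin.suc i) = ≡.cong (_ ∷_) (≡.trans
    (Vecₚ.tabulate-cong (λ j → ≡.cong (λ c → if c then ℤ.1ℤ else ℤ.0ℤ)
      (≡.trans (isYes≗does (Fin.suc i Fin.≟ Fin.suc j)) (≡.sym (isYes≗does (i Fin.≟ j))))))
    (unit≡unitVec i))

  module _ {n : ℕ} where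
    private module P = RingKit (ring n)

    prodL-++ : ∀ {A : Set} (xs ys : List A) (f : A → LPoly R n) →
      prodL R (xs ++ ys) f ≋ _⊗_ R (prodL R xs f) (prodL R ys f)
    prodL-++ []       ys f = P.sym (P.*-identityˡ _)
    prodL-++ (x ∷ xs) ys f = P.trans (P.*-congˡ {f x} (prodL-++ xs ys f)) (P.sym (P.*-assoc (f x) _ _))

    prodL-cong : ∀ {A : Set} (xs : List A) {f g : A → LPoly R n} → (∀ x → f x ≋ g x) → prodL R xs f ≋ prodL R xs g
    prodL-cong []       eq = P.refl
    prodL-cong (x ∷ xs) eq = P.*-cong (eq x) (prodL-cong xs eq)

    prodL-concatMap : ∀ {A B : Set} (g : A → List B) (xs : List A) (f : B → LPoly R n) →
      prodL R (concatMap g xs) f ≋ prodL R xs (λ x → prodL R (g x) f)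
    prodL-concatMap g []       f = P.refl
    prodL-concatMap g (x ∷ xs) f = P.trans (prodL-++ (g x) (concatMap g xs) f)
      (P.*-congˡ {prodL R (g x) f} (prodL-concatMap g xs f))

    prodL-map : ∀ {A B : Set} (g : A → B) (xs : List A) (f : B → LPoly R n) →
      prodL R (map g xs) f ≋ prodL R xs (f ∘ g)
    prodL-map g []       f = P.refl
    prodL-map g (x ∷ xs) f = P.*-congˡ {f (g x)} (prodL-map g xs f)

    prodL-filter : ∀ {A : Set} {Q : A → Set} (Q? : Decidable Q) (xs : List A) (f : A → LPoly R n) →
      prodL R (filter Q? xs) f ≋ prodL R xs (λ x → if does (Q? x) then f x else one R)
    prodL-filter Q? []       f = P.refl
    prodL-filter Q? (x ∷ xs) f with does (Q? x)
    ... | true  = P.*-congˡ {f x} (prodL-filter Q? xs f)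
    ... | false = P.trans (prodL-filter Q? xs f) (P.sym (P.*-identityˡ _))

    prodL-tabulate : ∀ {A : Set} N (g : Fin N → A) (f : A → LPoly R n) (F : ℕ → LPoly R n) →
      (∀ i → f (g i) ≋ F (toℕ i)) → prodL R (List.tabulate g) f ≋ P.prod N F
    prodL-tabulate zero    g f F eq = P.refl
    prodL-tabulate (suc N) g f F eq = P.*-cong (eq Fin.zero) (prodL-tabulate N (g ∘ Fin.suc) f (F ∘ suc) (eq ∘ Fin.suc))

    prodL-pairs : ∀ N (f : Fin N × Fin N → LPoly R n) (F : ℕ → ℕ → LPoly R n) →
      (∀ i j → f (i , j) ≋ F (toℕ i) (toℕ j)) → prodL R (pairs N) f ≋ Vandermonde.pairProd (ring n) N F
    prodL-pairs N f F eq = P.trans (prodL-concatMap _ (allFin N) f) (P.trans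
      (prodL-tabulate N (λ i → i) _ (λ i → P.prod N (λ j → if does (i <? j) then F i j else one R)) (λ i →
        P.trans (prodL-map (i ,_) (filter (λ j → i Fin.<? j) (allFin N)) f) (P.trans
          (prodL-filter (λ j → i Fin.<? j) (allFin N) (λ j → f (i , j)))
          (prodL-tabulate N (λ j → j) _ (λ j → if does (toℕ i <? j) then F (toℕ i) j else one R)
            (λ j → select (does (toℕ i <? toℕ j)) (eq i j))))))
      (SymmetricProducts.pairProd-conditional (ring n) N F))
      where
      select : ∀ c {p q : LPoly R n} → p ≋ q → (if c then p else one R) ≋ (if c then q else one R)
      select true  h = h
      select false h = P.refl

  negVec-0 : ∀ n → negVec (0⃗ {n}) ≡ 0⃗
  negVec-0 zero    = ≡.refl
  negVec-0 (suc n) = ≡.cong (_ ∷_) (negVec-0 n)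

  mono-∷ : ∀ {n} x (e : Vec ℤ n) → mono (x ∷ e) ≋ _⊗_ R (mono (x ∷ 0⃗)) (push (insert0 0) (mono e))
  mono-∷ {n} x e = S.trans (suc n)
    (mono-cong (≡.cong₂ _∷_ (≡.sym (ℤₚ.+-identityʳ x)) (≡.sym (⊕-identityˡ e))))
    (mono-⊕ (x ∷ 0⃗) (ℤ.0ℤ ∷ e))

  z^ : ∀ n k → S._^_ (suc n) (z (suc n) 0) k ≋ mono (ℤ.- (+ k) ∷ 0⃗)
  z^ n zero    = S.refl (suc n)
  z^ n (suc k) = S.trans (suc n) (S.*-congˡ (suc n) {z (suc n) 0} (z^ n k))
    (S.trans (suc n) (S.sym (suc n) (mono-⊕ (negVec (unitVec (suc n) 0)) (ℤ.- (+ k) ∷ 0⃗)))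
      (mono-cong (≡.cong₂ _∷_ (neg-suc k) (≡.trans (≡.cong (_⊕ 0⃗) (negVec-0 n)) (⊕-identityˡ 0⃗)))))
    where
    neg-suc : ∀ k → ℤ.-1ℤ ℤ.+ (ℤ.- (+ k)) ≡ -[1+ k ]
    neg-suc zero    = ≡.refl
    neg-suc (suc k) = ≡.refl

  mono-replicate : ∀ n c → mono (replicate n (ℤ.- (+ c))) ≋ S.prod n n (λ i → S._^_ n (z n i) c)
  mono-replicate zero    c = S.refl zero
  mono-replicate (suc n) c = S.trans (suc n) (mono-∷ (ℤ.- (+ c)) (replicate n (ℤ.- (+ c))))
    (S.*-cong (suc n) (S.sym (suc n) (z^ n c)) (S.trans (suc n)
      (N.h-cong n (mono-replicate n c)) (S.trans (suc n)
        (N.h-prod n n (λ i → S._^_ n (z n i) c))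
        (S.prod-cong′ (suc n) n (λ i → N.h-^ n c (z n i))))))

  eval-S-sum : ∀ n l (f : ℕ → LPoly R n) φ → eval (S.sum n l f) φ ≈ R.sum l (λ k → eval (f k) φ)
  eval-S-sum n zero    f φ = refl
  eval-S-sum n (suc l) f φ = trans (eval-++ (f 0) (S.sum n l (f ∘ suc)) φ) (+-congˡ (eval-S-sum n l (f ∘ suc) φ))

  eval-concatMap : ∀ {A : Set} {n} (g : A → LPoly R n) (xs : List A) φ →
    eval (concatMap g xs) φ ≈ Σ R xs (λ x → eval (g x) φ)
  eval-concatMap g []       φ = refl
  eval-concatMap g (x ∷ xs) φ = trans (eval-++ (g x) (concatMap g xs) φ) (+-congˡ (eval-concatMap g xs φ))

  eval-hInv : ∀ n b φ → eval (hInv R n b) φ ≈ Σ R (compositions n b) (λ k → φ (Vec.map (λ i → ℤ.- (+ i)) k))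
  eval-hInv n b φ = go (compositions n b)
    where
    go : ∀ xs → eval (map (λ k → (1# , Vec.map (λ i → ℤ.- (+ i)) k)) xs) φ ≈ Σ R xs (λ k → φ (Vec.map (λ i → ℤ.- (+ i)) k))
    go []       = refl
    go (x ∷ xs) = +-cong (R.*-identityˡ _) (go xs)

  hInv≋hom-sym : ∀ n b → hInv R n b ≋ SV.hom-sym n n b (z n)
  hInv≋hom-sym zero    zero    = S.refl zero
  hInv≋hom-sym zero    (suc b) = S.refl zero
  hInv≋hom-sym (suc n) b .eval-≈ φ = begin
    eval (hInv R (suc n) b) φ ≈⟨ eval-hInv (suc n) b φ ⟩
    Σ R (compositions (suc n) b) (λ k → φ (negs k))
      ≈⟨ trans (Σ-concatMap (λ k → map (k ∷_) (compositions n (b ℕ.∸ k))) (upTo (suc b)) _)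
               (Σ-applyUpTo (suc b) (λ k → k) _) ⟩
    R.sum (suc b) (λ k → Σ R (map (k ∷_) (compositions n (b ℕ.∸ k))) (λ k → φ (negs k)))
      ≈⟨ R.sum-cong′ (suc b) {λ k → Σ R (map (k ∷_) (compositions n (b ℕ.∸ k))) (λ k → φ (negs k))} term ⟩
    R.sum (suc b) (λ k → eval (t k) φ) ≈⟨ eval-S-sum (suc n) (suc b) t φ ⟨
    eval (S.sum (suc n) (suc b) t) φ ≈⟨ eval-≈ (SP.hom-sym-expand (suc n) n b (z (suc n))) φ ⟨
    eval (SV.hom-sym (suc n) (suc n) b (z (suc n))) φ ∎
    where
    negs : ∀ {n} → Vec ℕ n → Vec ℤ n
    negs = Vec.map (λ i → ℤ.- (+ i))
    t : ℕ → LPoly R (suc n)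
    t k = _⊗_ R (S._^_ (suc n) (z (suc n) 0) k) (SV.hom-sym (suc n) n (b ℕ.∸ k) (z (suc n) ∘ suc))
    term : ∀ k → Σ R (map (k ∷_) (compositions n (b ℕ.∸ k))) (λ k → φ (negs k)) ≈ eval (t k) φ
    term k = begin
      Σ R (map (k ∷_) (compositions n (b ℕ.∸ k))) (λ k → φ (negs k))
        ≈⟨ Σ-map (k ∷_) (compositions n (b ℕ.∸ k)) _ ⟩
      Σ R (compositions n (b ℕ.∸ k)) (λ c → φ (ℤ.- (+ k) ∷ negs c))
        ≈⟨ eval-hInv n (b ℕ.∸ k) (λ e → φ (ℤ.- (+ k) ∷ e)) ⟨
      eval (hInv R n (b ℕ.∸ k)) (λ e → φ (ℤ.- (+ k) ∷ e))
        ≈⟨ eval-≈ (hInv≋hom-sym n (b ℕ.∸ k)) _ ⟩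
      eval H (λ e → φ (ℤ.- (+ k) ∷ e))
        ≈⟨ eval-cong H (λ e → R.reflexive (≡.cong φ (≡.cong₂ _∷_ (ℤₚ.+-identityʳ (ℤ.- (+ k))) (⊕-identityˡ e)))) ⟨
      eval H (λ e → φ ((ℤ.- (+ k) ∷ 0⃗) ⊕ (ℤ.0ℤ ∷ e)))
        ≈⟨ trans (mono-⊗ (ℤ.- (+ k) ∷ 0⃗) (push (insert0 0) H) φ) (eval-push (insert0 0) H _) ⟨
      eval (_⊗_ R (mono (ℤ.- (+ k) ∷ 0⃗)) (push (insert0 0) H)) φ
        ≈⟨ eval-≈ (S.*-cong (suc n) (z^ n k) (S.sym (suc n) (N.h-hom-sym n n (b ℕ.∸ k) (z n)))) φ ⟨
      eval (t k) φ ∎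
      where H = SV.hom-sym n n (b ℕ.∸ k) (z n)

  eval-scale : ∀ {n} c (P : LPoly R n) φ → eval (scale R c P) φ ≈ c * eval P φ
  eval-scale c P φ = eval-map _ c (λ e → e) (λ _ _ → ≡.refl) P φ

  sumL-scale : ∀ n N (c : ℕ → Carrier) →
    sumL R (upTo N) (λ b → scale R (c b) (hInv R n b))
    ≋ S.sum n N (λ b → _⊗_ R (κ (c b)) (SV.hom-sym n n b (z n)))
  sumL-scale n N c .eval-≈ φ = begin
    eval (concatMap (λ b → scale R (c b) (hInv R n b)) (upTo N)) φ
      ≈⟨ trans (eval-concatMap (λ b → scale R (c b) (hInv R n b)) (upTo N) φ) (Σ-applyUpTo N (λ b → b) _) ⟩
    R.sum N (λ b → eval (scale R (c b) (hInv R n b)) φ)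
      ≈⟨ R.sum-cong′ N (λ b → trans (eval-scale (c b) (hInv R n b) φ)
           (trans (*-congˡ (eval-≈ (hInv≋hom-sym n b) φ)) (sym (κ-⊗ (c b) (SV.hom-sym n n b (z n)) φ)))) ⟩
    R.sum N (λ b → eval (_⊗_ R (κ (c b)) (SV.hom-sym n n b (z n))) φ)
      ≈⟨ eval-S-sum n N (λ b → _⊗_ R (κ (c b)) (SV.hom-sym n n b (z n))) φ ⟨
    eval (S.sum n N (λ b → _⊗_ R (κ (c b)) (SV.hom-sym n n b (z n)))) φ ∎

  Q-list : ∀ {n} → Vec ℤ n → Vec ℤ n → LPoly R n
  Q-list e f = (1# , 0⃗) ∷ (1# - v , e) ∷ (u , f) ∷ (u , e ⊕ f) ∷ []

  Q-list≋Q : ∀ n (e f : Vec ℤ n) → Q-list e f ≋ I.Q n (mono e) (mono f)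
  Q-list≋Q n e f .eval-≈ φ = begin
    eval (Q-list e f) φ
      ≈⟨ R.solve 6 (λ v u a b c d →
           R.:1 R.:* a R.:+ ((R.:1 R.:- v) R.:* b R.:+ (u R.:* c R.:+ (u R.:* d R.:+ R.:0))) R.:=
           (R.:1 R.:* a R.:+ R.:0) R.:+ ((R.:1 R.:- v) R.:* (R.:1 R.:* b R.:+ R.:0) R.:+
             u R.:* ((R.:1 R.:* c R.:+ R.:0) R.:+ (R.:1 R.:* d R.:+ R.:0)))) refl v u (φ 0⃗) (φ e) (φ f) (φ (e ⊕ f)) ⟩
    eval (one R) φ + ((1# - v) * eval (mono e) φ + u * (eval (mono f) φ + eval (mono (e ⊕ f)) φ))
      ≈⟨ +-congˡ (+-cong (κ-⊗ (1# - v) (mono e) φ) (trans (κ-⊗ u inner φ)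
           (*-congˡ (trans (eval-++ (mono f) (_⊗_ R (mono e) (mono f)) φ) (+-congˡ (sym (eval-≈ (mono-⊕ e f) φ))))))) ⟨
    eval (one R) φ + (eval (_⊗_ R (κ (1# - v)) (mono e)) φ + eval (_⊗_ R (κ u) inner) φ)
      ≈⟨ +-congˡ (+-congʳ (eval-≈ (S.*-congʳ n {mono e} {κ (1# - v)} {one R ++ negate (κ v)}
           (S.trans n (K.+-homo 1# (- v)) (S.+-cong n K.1#-homo (K.-‿homo v)))) φ)) ⟩
    eval (one R) φ + (eval (_⊗_ R (one R ++ negate (κ v)) (mono e)) φ + eval (_⊗_ R (κ u) inner) φ)
      ≈⟨ trans (eval-++ (one R) (_⊗_ R (one R ++ negate (κ v)) (mono e) ++ _⊗_ R (κ u) inner) φ)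
           (+-congˡ (eval-++ (_⊗_ R (one R ++ negate (κ v)) (mono e)) (_⊗_ R (κ u) inner) φ)) ⟨
    eval (I.Q n (mono e) (mono f)) φ ∎
    where
    inner = mono f ++ _⊗_ R (mono e) (mono f)
    module K = RingMorphisms.IsRingHomomorphism (κ-hom n)

  pairs-split : ∀ n → prodL R (pairs n) (λ { (i , j) →
      _⊗_ R ((1# , unit i) ∷ (- 1# , unit j) ∷ [])
            ((1# , replicate n ℤ.0ℤ) ∷ (1# - v , unit i) ∷ (u , unit j) ∷ (u , zipWith ℤ._+_ (unit i) (unit j)) ∷ []) })
    ≋ _⊗_ R (SV.pairProd n n (λ i j → S._-_ n (y n i) (y n j))) (SV.pairProd n n (λ i j → I.Q n (y n i) (y n j)))
  pairs-split n = S.trans n (prodL-pairs n _ (λ i j → _⊗_ R (S._-_ n (y n i) (y n j)) (I.Q n (y n i) (y n j))) factor)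
    (SV.pairProd-* n n (λ i j → S._-_ n (y n i) (y n j)) (λ i j → I.Q n (y n i) (y n j)))
    where
    factor : ∀ (i j : Fin n) → _⊗_ R ((1# , unit i) ∷ (- 1# , unit j) ∷ []) (Q-list (unit i) (unit j))
      ≋ _⊗_ R (S._-_ n (y n (toℕ i)) (y n (toℕ j))) (I.Q n (y n (toℕ i)) (y n (toℕ j)))
    factor i j rewrite unit≡unitVec i | unit≡unitVec j =
      S.*-congˡ n {mono (unitVec n (toℕ i)) ++ negate (mono (unitVec n (toℕ j)))} (Q-list≋Q n _ _)

  -- In each pair z_i z_j (x_i - x_j) = z_j - z_i.
  vdm-from-y : ∀ m → _⊗_ R (mono (replicate (suc m) (ℤ.- (+ m))))
      (SV.pairProd (suc m) (suc m) (λ i j → S._-_ (suc m) (y (suc m) i) (y (suc m) j)))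
    ≋ SV.vdm (suc m) (suc m) (z (suc m))
  vdm-from-y m = S.trans n
    (S.*-congʳ n (S.trans n (mono-replicate n m) (S.sym n (SP.pairProd-separate n m (z n)))))
    (SP.vdm-inverse n n (y n) (z n) (zy≋1 n))
    where n = suc m

  -- With one variable the products over pairs are empty and h_b(z) = z^b, so the constant term is
  -- the coefficient of x^b in X^k.
  ctRow-1 : ∀ b k → ctRow 1 b (k ∷ []) ≈ binom k b
  ctRow-1 b k = begin
    CT (_⊗_ R (I.monomial 1 0 (k ∷ [])) W) ≈⟨ eval-coefs (k ∷ []) W ⟨
    eval W (coefs (k ∷ []))
      ≈⟨ eval-≈ (S.trans 1 (SP.drop-units 1 (SV.hom-sym 1 1 b (z 1)))
           (S.trans 1 (SP.hom-sym-1 1 b (z 1)) (z^ 0 b))) (coefs (k ∷ [])) ⟩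
    eval (mono (ℤ.- (+ b) ∷ [])) (coefs (k ∷ []))
      ≈⟨ trans (R.+-identityʳ _) (trans (R.*-identityˡ _) (R.*-identityʳ _)) ⟩
    coef k (ℤ.- (+ b)) ≈⟨ coef-negative k b ⟩
    binom k b ∎
    where
    W : LPoly R 1
    W = _⊗_ R (SV.pairProd 1 1 (λ i j → I.Q 1 (y 1 i) (y 1 j))) (_⊗_ R (SV.vdm 1 1 (z 1)) (SV.hom-sym 1 1 b (z 1)))

  laurentPart-expand : ∀ n a α β → laurentPart R u v n a α β ≋
    _⊗_ R (mono (replicate n (ℤ.- (+ (n ℕ.∸ 1)))))
      (_⊗_ R (_⊗_ R (SV.pairProd n n (λ i j → S._-_ n (y n i) (y n j))) (SV.pairProd n n (λ i j → I.Q n (y n i) (y n j))))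
        (S.sum n (suc ℤ.∣ β ℤ.- α ∣) (λ b → _⊗_ R
          (κ (fromℤ R (signℤ (a ℤ.+ α ℤ.+ + b)) * fromℕ R (b Comb.C ℤ.∣ a ℤ.- α ∣))) (SV.hom-sym n n b (z n)))))
  laurentPart-expand n a α β =
    S.*-congˡ n {mono (replicate n (ℤ.- (+ (n ℕ.∸ 1))))} (S.*-cong n (pairs-split n)
      (sumL-scale n (suc ℤ.∣ β ℤ.- α ∣) (λ b → fromℤ R (signℤ (a ℤ.+ α ℤ.+ + b)) * fromℕ R (b Comb.C ℤ.∣ a ℤ.- α ∣))))

  CT-combination : ∀ n N (c : ℕ → Carrier) (M Z Y P W : LPoly R n) (h : ℕ → LPoly R n) → _⊗_ R Z Y ≋ W →
    CT (_⊗_ R M (_⊗_ R Z (_⊗_ R (_⊗_ R Y P) (S.sum n N (λ b → _⊗_ R (κ (c b)) (h b))))))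
    ≈ R.sum N (λ b → c b * CT (_⊗_ R M (_⊗_ R P (_⊗_ R W (h b)))))
  CT-combination n N c M Z Y P W h ZY≋W = begin
    CT (_⊗_ R M (_⊗_ R Z (_⊗_ R (_⊗_ R Y P) (S.sum n N (λ b → _⊗_ R (κ (c b)) (h b))))))
      ≈⟨ eval-≈ (SP.distribute n N M Z Y P (λ b → κ (c b)) h) δ ⟩
    CT (S.sum n N t) ≈⟨ eval-S-sum n N t δ ⟩
    R.sum N (λ b → CT (t b)) ≈⟨ R.sum-cong′ N {λ b → CT (t b)} term ⟩
    R.sum N (λ b → c b * CT (_⊗_ R M (_⊗_ R P (_⊗_ R W (h b))))) ∎
    where
    t : ℕ → LPoly R n
    t b = _⊗_ R (κ (c b)) (_⊗_ R M (_⊗_ R P (_⊗_ R (_⊗_ R Z Y) (h b))))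
    term : ∀ b → CT (t b) ≈ c b * CT (_⊗_ R M (_⊗_ R P (_⊗_ R W (h b))))
    term b = trans (κ-⊗ (c b) (_⊗_ R M (_⊗_ R P (_⊗_ R (_⊗_ R Z Y) (h b)))) δ)
      (*-congˡ (eval-≈ (S.*-congˡ n {M} (S.*-congˡ n {P} (S.*-congʳ n {h b} ZY≋W))) δ))

  laurentCoef : ℤ → ℤ → ℕ → Carrier
  laurentCoef a α b = fromℤ R (signℤ (a ℤ.+ α ℤ.+ + b)) * fromℕ R (b Comb.C ℤ.∣ a ℤ.- α ∣)

  CT-laurentPart : ∀ n (ks : Vec ℕ n) a α β →
    _⊗_ R (mono (replicate n (ℤ.- (+ (n ℕ.∸ 1))))) (SV.pairProd n n (λ i j → S._-_ n (y n i) (y n j)))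
      ≋ SV.vdm n n (z n) →
    CT (_⊗_ R (I.monomial n 0 ks) (laurentPart R u v n a α β))
    ≈ R.sum (suc ℤ.∣ β ℤ.- α ∣) (λ b → laurentCoef a α b * ctRow n b ks)
  CT-laurentPart n ks a α β ZY≋W = trans
    (eval-≈ (S.*-congˡ n {I.monomial n 0 ks} (laurentPart-expand n a α β)) δ)
    (CT-combination n (suc ℤ.∣ β ℤ.- α ∣) (laurentCoef a α) (I.monomial n 0 ks)
      (mono (replicate n (ℤ.- (+ (n ℕ.∸ 1))))) (SV.pairProd n n (λ i j → S._-_ n (y n i) (y n j)))
      (SV.pairProd n n (λ i j → I.Q n (y n i) (y n j))) (SV.vdm n n (z n)) (λ b → SV.hom-sym n n b (z n)) ZY≋W)

  ctExpr≈Σ : ∀ m (ks : Vec ℕ (suc m)) a α β → ctExpr R u v m (shiftBy α ks) a α β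
    ≈ R.sum (suc ℤ.∣ β ℤ.- α ∣) (λ b → laurentCoef a α b * ctRow (suc m) b ks)
  ctExpr≈Σ m ks a α β = trans (ctExpr≈CT m ks a α β) (CT-laurentPart (suc m) ks a α β (vdm-from-y m))

-- The triangle sum as a combination of constant terms

module TriangleExpansion (R : CommutativeRing 0ℓ 0ℓ) (u v : CommutativeRing.Carrier R) (α : ℤ) (D a : ℕ) where
  open RingKit R
  open Vandermonde R using (sgn)
  open RowWeights R u v D
  open BinomialInversion R
  open TriangleSum R u v α D a
  open import Relation.Binary.Reasoning.Setoid setoid

  -- The induction over rows applies only to chains. A row above that fails to be strictly
  -- increasing and bounded by D has weight 0, even if the row below is only weakly increasing. The
  -- bound p ≤ x is returned because with p the successor of the previous entry it is the strict
  -- step.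
  rowWeight-support : ∀ {l} p x (rs : Vec ℕ l) (ks : Vec ℕ (2 ℕ.+ l)) → Chain ks →
    (rowWeight p (x ∷ rs) ks ≈ 0#) ⊎ (Chain (x ∷ rs) × p ℕ.≤ x)
  rowWeight-support p x rs (k ∷ ks@(k′ ∷ ks′)) (s , chain) with p ≤? x
  ... | no  p≰x = inj₁ (trans (*-congʳ (trans (*-congʳ (if-false (p ≤? x) p≰x)) (zeroˡ _))) (zeroˡ _))
  ... | yes p≤x = cases rs ks′ chain
    where
    cases : ∀ {l} (rs : Vec ℕ l) (ks′ : Vec ℕ l) → Chain (k′ ∷ ks′) →
      (rowWeight p (x ∷ rs) (k ∷ k′ ∷ ks′) ≈ 0#) ⊎ (Chain (x ∷ rs) × p ℕ.≤ x)
    cases [] [] k′≤D with x ≤? k′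
    ... | yes x≤k′ = inj₂ (≤-trans x≤k′ k′≤D , p≤x)
    ... | no  x≰k′ = inj₁ (trans (*-congʳ (trans (*-congˡ (seg-above (ℕₚ.≰⇒> x≰k′))) (zeroʳ _))) (zeroˡ _))
    cases (x′ ∷ rs) ks′@(_ ∷ _) chain with rowWeight-support (suc x) x′ rs (k′ ∷ ks′) chain
    ... | inj₁ w≈0         = inj₁ (trans (*-congˡ w≈0) (zeroʳ _))
    ... | inj₂ (ch , x<x′) = inj₂ ((inj₁ x<x′ , ch) , p≤x)

  coefficient : ℕ → Carrier
  coefficient b = sgn (a ℕ.+ b) * binom b a

  module _ (ctRow : ∀ n → ℕ → Vec ℕ n → Carrier)
    (ctRow-1 : ∀ b k → ctRow 1 b (k ∷ []) ≈ binom k b)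
    (ctRow-step : ∀ n b (ks : Vec ℕ (2 ℕ.+ n)) → Chain ks →
      rows (suc n) (λ r → rowWeight 0 r ks * ctRow (suc n) b r) ≈ ctRow (2 ℕ.+ n) b ks)
    where
    triangles≈Σ : ∀ m (ks : Vec ℕ (suc m)) → Chain ks →
      triangles ks ≈ sum (suc D) (λ b → coefficient b * ctRow (suc m) b ks)
    triangles≈Σ zero (k ∷ []) k≤D = sym (trans
      (sum-cong′ (suc D) {λ b → coefficient b * ctRow 1 b (k ∷ [])} {invTerm k a} (λ b → *-congˡ (ctRow-1 b k)))
      (binomial-inversion (suc D) k a (s≤s k≤D)))
    triangles≈Σ (suc m) ks chain = begin
      rows (suc m) (λ r → rowWeight 0 r ks * triangles r) ≈⟨ rows-cong (suc m) upperRow ⟩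
      rows (suc m) (λ r → sum (suc D) (λ b → coefficient b * (rowWeight 0 r ks * ctRow (suc m) b r)))
        ≈⟨ rows-sum (suc D) (λ b r → coefficient b * (rowWeight 0 r ks * ctRow (suc m) b r)) ⟩
      sum (suc D) (λ b → rows (suc m) (λ r → coefficient b * (rowWeight 0 r ks * ctRow (suc m) b r)))
        ≈⟨ sum-cong′ (suc D) {λ b → rows (suc m) (λ r → coefficient b * (rowWeight 0 r ks * ctRow (suc m) b r))}
             (λ b → trans (sym (*-rows (suc m) (coefficient b) (λ r → rowWeight 0 r ks * ctRow (suc m) b r)))
               (*-congˡ (ctRow-step m b ks chain))) ⟩
      sum (suc D) (λ b → coefficient b * ctRow (2 ℕ.+ m) b ks) ∎
      where
      rows-sum : ∀ {l} n (F : ℕ → Vec ℕ l → Carrier) →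
        rows l (λ r → sum n (λ b → F b r)) ≈ sum n (λ b → rows l (F b))
      rows-sum {l} zero    F = rows-0 l
      rows-sum {l} (suc n) F = trans (rows-+ l (F 0) (λ r → sum n (λ b → F (suc b) r))) (+-congˡ (rows-sum n (F ∘ suc)))

      upperRow : ∀ r → rowWeight 0 r ks * triangles r
        ≈ sum (suc D) (λ b → coefficient b * (rowWeight 0 r ks * ctRow (suc m) b r))
      upperRow r@(x ∷ rs) = begin
        rowWeight 0 r ks * triangles r ≈⟨ here (rowWeight-support 0 x rs ks chain) ⟩
        rowWeight 0 r ks * sum (suc D) (λ b → coefficient b * ctRow (suc m) b r)
          ≈⟨ *-sum (suc D) (rowWeight 0 r ks) (λ b → coefficient b * ctRow (suc m) b r) ⟩
        sum (suc D) (λ b → rowWeight 0 r ks * (coefficient b * ctRow (suc m) b r))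
          ≈⟨ sum-cong′ (suc D) {λ b → rowWeight 0 r ks * (coefficient b * ctRow (suc m) b r)}
               (λ b → solve 3 (λ w c t → w :* (c :* t) := c :* (w :* t)) refl
                 (rowWeight 0 r ks) (coefficient b) (ctRow (suc m) b r)) ⟩
        sum (suc D) (λ b → coefficient b * (rowWeight 0 r ks * ctRow (suc m) b r)) ∎
        where
        here : (rowWeight 0 r ks ≈ 0#) ⊎ (Chain r × 0 ℕ.≤ x) → rowWeight 0 r ks * triangles r
          ≈ rowWeight 0 r ks * sum (suc D) (λ b → coefficient b * ctRow (suc m) b r)
        here (inj₁ w≈0)      = trans (trans (*-congʳ w≈0) (zeroˡ _)) (sym (trans (*-congʳ w≈0) (zeroˡ _)))
        here (inj₂ (ch , _)) = *-congˡ (triangles≈Σ m r ch)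

module Count (R : CommutativeRing 0ℓ 0ℓ) (u v : CommutativeRing.Carrier R) (α : ℤ) (D a : ℕ) where
  open RingKit R
  open Vandermonde R using (sgn)
  open RowWeights R u v D using (Chain)
  open BinomialInversion R using (fromℤ-signℕ; fromℕ-C)
  open MonotoneRows R u v D using (ctRow; ctRow-step)
  open LaurentPart R u v D using (ctRow-1; laurentCoef; ctExpr≈Σ)
  open TriangleExpansion R u v α D a
  open TriangleSum R u v α D a
  open import Relation.Binary.Reasoning.Setoid setoid

  -- With a measured from α the exponent of the sign is 2α + a + b, and 2α drops out.
  coefficient≈laurentCoef : ∀ b → coefficient b ≈ laurentCoef (α ℤ.+ + a) α b
  coefficient≈laurentCoef b = sym (*-cong
    (trans (reflexive (≡.cong (fromℤ R) (≡.trans (≡.cong signℤ regroup) (signℤ-double α (a ℕ.+ b))))) (fromℤ-signℕ (a ℕ.+ b)))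
    (trans (reflexive (≡.cong (λ t → fromℕ R (b Comb.C ℤ.∣ t ∣)) ([i+j]-i≡j α (+ a)))) (fromℕ-C b a)))
    where
    module Z = RingKit ℤₚ.+-*-commutativeRing
    regroup : ((α ℤ.+ + a) ℤ.+ α) ℤ.+ + b ≡ (α ℤ.+ α) ℤ.+ + (a ℕ.+ b)
    regroup = Z.solve 3 (λ α a b → ((α Z.:+ a) Z.:+ α) Z.:+ b Z.:= (α Z.:+ α) Z.:+ (a Z.:+ b)) ≡.refl α (+ a) (+ b)

  mtSum≈ctExpr : ∀ m (ks : Vec ℕ (suc m)) → Chain ks →
    mtSum R u v m (shift ks) (α ℤ.+ + a) α β ≈ ctExpr R u v m (shift ks) (α ℤ.+ + a) α β
  mtSum≈ctExpr m ks chain = begin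
    mtSum R u v m (shift ks) (α ℤ.+ + a) α β ≈⟨ mtSum≈triangles m ks ⟩
    triangles ks ≈⟨ triangles≈Σ ctRow ctRow-1 ctRow-step m ks chain ⟩
    sum (suc D) (λ b → coefficient b * ctRow (suc m) b ks)
      ≈⟨ sum-cong′ (suc D) {λ b → coefficient b * ctRow (suc m) b ks} (λ b → *-congʳ (coefficient≈laurentCoef b)) ⟩
    sum (suc D) (λ b → laurentCoef (α ℤ.+ + a) α b * ctRow (suc m) b ks)
      ≡⟨ ≡.cong (λ N → sum (suc ℤ.∣ N ∣) (λ b → laurentCoef (α ℤ.+ + a) α b * ctRow (suc m) b ks)) ([i+j]-i≡j α (+ D)) ⟨
    sum (suc ℤ.∣ β ℤ.- α ∣) (λ b → laurentCoef (α ℤ.+ + a) α b * ctRow (suc m) b ks)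
      ≈⟨ ctExpr≈Σ m ks (α ℤ.+ + a) α β ⟨
    ctExpr R u v m (shift ks) (α ℤ.+ + a) α β ∎

-- Reduction to a bottom row of naturals

offset : ∀ {α x} → α ℤ.≤ x → ∃[ k ] x ≡ α ℤ.+ + k
offset {α} {x} α≤x = ℤ.∣ x ℤ.- α ∣ , ≡.sym (≡.trans
  (≡.cong (λ t → α ℤ.+ t) (ℤₚ.0≤i⇒+∣i∣≡i (ℤₚ.i≤j⇒0≤j-i α≤x)))
  (Z.solve 2 (λ α x → α Z.:+ (x Z.:- α) Z.:= x) ≡.refl α x))
  where module Z = RingKit ℤₚ.+-*-commutativeRing

-- The relation `_~_` will be < or ≤. It is used through `~-step`, which yields a strict step or,
-- for u = v = 1, a degenerate one.
module Offsets (R : CommutativeRing 0ℓ 0ℓ) (u v : CommutativeRing.Carrier R) (α : ℤ) (D : ℕ)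
  (_~_ : ℤ → ℤ → Set)
  (~-step : ∀ k x → (α ℤ.+ + k) ~ x → ∃[ k′ ] x ≡ α ℤ.+ + k′ × RowWeights.Step R u v D k k′)
  where
  open RowWeights R u v D

  Increasing : ∀ {m} → Vec ℤ m → Set
  Increasing {m} b = (i j : Fin m) → i Fin.< j → lookup b i ~ lookup b j

  offsets-from : ∀ {m} k (b : Vec ℤ m) → Increasing ((α ℤ.+ + k) ∷ b) → last ((α ℤ.+ + k) ∷ b) ℤ.≤ α ℤ.+ + D →
    ∃[ ks ] b ≡ shiftBy α ks × Chain (k ∷ ks)
  offsets-from k []      inc le = [] , ≡.refl , ℕₚ.≮⇒≥ (λ D<k → ℤₚ.<⇒≱ (ℤₚ.+-monoʳ-< α (ℤ.+<+ D<k)) le)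
  offsets-from k (x ∷ b) inc le with ~-step k x (inc Fin.zero (Fin.suc Fin.zero) (s≤s z≤n))
  ... | k′ , ≡.refl , s with offsets-from k′ b (λ i j i<j → inc (Fin.suc i) (Fin.suc j) (s≤s i<j)) le
  ... | ks , ≡.refl , chain = k′ ∷ ks , ≡.refl , s , chain

  offsets : ∀ {m} (b : Vec ℤ (suc m)) → Increasing b → α ℤ.≤ head b → last b ℤ.≤ α ℤ.+ + D →
    ∃[ ks ] b ≡ shiftBy α ks × Chain ks
  offsets (x ∷ b) inc α≤x le with offset α≤x
  ... | k , ≡.refl with offsets-from k b inc le
  ... | ks , ≡.refl , chain = k ∷ ks , ≡.refl , chain

-- Both cases, strict and weak, are instances of `_~_`. All data are rewritten as distances from α,
-- with D = β - α as the bound on the entries.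
mtSum≈ctExpr-increasing : (R : CommutativeRing 0ℓ 0ℓ) (u v : CommutativeRing.Carrier R) (_~_ : ℤ → ℤ → Set) →
  (∀ α D k x → (α ℤ.+ + k) ~ x → ∃[ k′ ] x ≡ α ℤ.+ + k′ × RowWeights.Step R u v D k k′) →
  (m : ℕ) (b : Vec ℤ (suc m)) (a α β : ℤ) → ((i j : Fin (suc m)) → i Fin.< j → lookup b i ~ lookup b j) →
  α ℤ.≤ a → a ℤ.≤ β → α ℤ.≤ head b → last b ℤ.≤ β →
  CommutativeRing._≈_ R (mtSum R u v m b a α β) (ctExpr R u v m b a α β)
mtSum≈ctExpr-increasing R u v _~_ step m b a α β inc α≤a a≤β α≤b b≤β
  with offset α≤a | offset (ℤₚ.≤-trans α≤a a≤β)
... | a′ , ≡.refl | D , ≡.refl with Offsets.offsets R u v α D _~_ (step α D) b inc α≤b b≤β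
... | ks , ≡.refl , chain = Count.mtSum≈ctExpr R u v α D a′ m ks chain

strict-step : ∀ R u v α D k x → α ℤ.+ + k ℤ.< x → ∃[ k′ ] x ≡ α ℤ.+ + k′ × RowWeights.Step R u v D k k′
strict-step R u v α D k x l with offset (ℤₚ.≤-trans (ℤₚ.i≤i+j α (+ k)) (ℤₚ.<⇒≤ l))
... | k′ , ≡.refl = k′ , ≡.refl , inj₁ (ℕₚ.≰⇒> (λ k′≤k → ℤₚ.≤⇒≯ (ℤₚ.+-monoʳ-≤ α (ℤ.+≤+ k′≤k)) l))

weak-step : ∀ R α D k x → α ℤ.+ + k ℤ.≤ x →
  ∃[ k′ ] x ≡ α ℤ.+ + k′ × RowWeights.Step R (CommutativeRing.1# R) (CommutativeRing.1# R) D k k′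
weak-step R α D k x l with offset (ℤₚ.≤-trans (ℤₚ.i≤i+j α (+ k)) l)
... | k′ , ≡.refl with ℕₚ.m≤n⇒m<n∨m≡n (ℕₚ.≮⇒≥ (λ k′<k → ℤₚ.<⇒≱ (ℤₚ.+-monoʳ-< α (ℤ.+<+ k′<k)) l))
...   | inj₁ k<k′ = k′ , ≡.refl , inj₁ k<k′
...   | inj₂ k≡k′ = k′ , ≡.refl , inj₂ (k≡k′ , CommutativeRing.refl R , CommutativeRing.refl R)

theorem2p3 : ((R : CommutativeRing 0ℓ 0ℓ) (u v : CommutativeRing.Carrier R)
    (m : ℕ) (b : Vec ℤ (suc m)) (a α β : ℤ) →
    StrictlyIncreasing b → α ≤ a → a ≤ β → α ≤ head b → last b ≤ β →
    CommutativeRing._≈_ R (mtSum R u v m b a α β) (ctExpr R u v m b a α β))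
    ×
    ((R : CommutativeRing 0ℓ 0ℓ) (m : ℕ) (b : Vec ℤ (suc m)) (a α β : ℤ) →
    WeaklyIncreasing b → α ≤ a → a ≤ β → α ≤ head b → last b ≤ β →
    CommutativeRing._≈_ R
    (mtSum R (CommutativeRing.1# R) (CommutativeRing.1# R) m b a α β)
    (ctExpr R (CommutativeRing.1# R) (CommutativeRing.1# R) m b a α β))
theorem2p3 =
  (λ R u v → mtSum≈ctExpr-increasing R u v ℤ._<_ (strict-step R u v)) ,
  (λ R → mtSum≈ctExpr-increasing R (CommutativeRing.1# R) (CommutativeRing.1# R) ℤ._≤_ (weak-step R))
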